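{- Let $r\ge 1$, let $\Gamma=\mathbb{Z}_2^r$ (the direct sum of $r$ copies of $\mathbb{Z}_2$), let $S\subseteq\Gamma$ with $0\notin S$, let $n=(2,2,\ldots,2)$, let $v\in\Gamma$, let $a\in\Gamma$ be of order $2$, and let $t\in\mathbb{R}$. Put $$N=\left\{(x,y)\ \middle|\ x,y\in\Gamma,\ x\mathrel{\dot>}y,\ \mathrm{wt}\left(\frac{2a(x-y)}{n}\right)\text{ is even}\right\}.$$ The cubelike graph $G=\mathrm{Cay}(\Gamma,S)$ has fractional revival at time $t$ between $v$ and $v+a$ if and only if $$\frac{t}{2\pi}\sum_{s\in S}\left((-1)^{s\cdot x}-(-1)^{s\cdot y}\right)\in\mathbb{Z}\quad\text{for all }(x,y)\in N.$$ Moreover, if these conditions hold, then there is a minimum positive time $t=\frac{2\pi}{M}$ at which fractional revival occurs between $v$ and $v+a$, where $M=\gcd\left\{\sum_{s\in S}((-1)^{s\cdot x}-(-1)^{s\cdot y})\ \middle|\ (x,y)\in N\right\}$.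
   Context: $\mathbb{Z}_2=\{0,1\}$ is the additive group of integers modulo $2$. The Cayley graph $\mathrm{Cay}(\Gamma,S)$ has vertex set $\Gamma$, with $u,v$ adjacent if and only if $u-v\in S$; for $\Gamma=\mathbb{Z}_2^r$ it is called a cubelike graph. For $s,x\in\Gamma$, $s\cdot x=\sum_{i=1}^r s_ix_i$. For $x,y\in\Gamma$, with coordinates regarded as integers in $\{0,1\}$, $x\mathrel{\dot>}y$ means that there is $i\in\{1,\ldots,r\}$ with $x_1=y_1,\ldots,x_{i-1}=y_{i-1}$ and $x_i>y_i$. The notation $\mathrm{wt}$ denotes the sum of all coordinates of a tuple, with products and quotients taken coordinatewise; here $\mathrm{wt}\left(\frac{2a(x-y)}{n}\right)=\sum_{s=1}^r a_s(x_s-y_s)$, computed with integer representatives. For a graph $G$ with adjacency matrix $A_G$, the transition matrix is $H_{A_G}(t)=\exp(\mathrm{i}tA_G)$, $t\in\mathbb{R}$, and $\mathbf{e}_u$ is the standard basis vector indexed by the vertex $u$. For distinct vertices $u,v$, $G$ has fractional revival at time $t$ from $u$ to $v$ if $H_{A_G}(t)\mathbf{e}_u=\alpha\mathbf{e}_u+\beta\mathbf{e}_v$ for some complex numbers $\alpha,\beta$ with $|\alpha|^2+|\beta|^2=1$ (equivalently $|H_{A_G}(t)_{u,u}|^2+|H_{A_G}(t)_{u,v}|^2=1$); the cases $\alpha=0$ (perfect state transfer) and $\beta=0$ (periodicity at $u$) are included. Fractional revival from $u$ to $v$ at time $t$ implies fractional revival from $v$ to $u$ at time $t$, so one speaks of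 fractional revival between $u$ and $v$.
   Formalization: The minimum-time claim is stated only for M ≠ 0; when M = 0 (e.g. r = 1, S = {1}, a = 1, where N is empty) 2π/M is undefined, revival occurs at every time and no minimum positive time exists. -}

module Defs where

open import Level using (Level; _⊔_; 0ℓ) renaming (suc to lsuc)
open import Algebra.Apartness.Bundles using (HeytingField; HeytingCommutativeRing)
open import Algebra.Bundles using (CommutativeRing; Semiring; AbelianGroup)
import Algebra.Definitions.RawSemiring as RawSemiringDefs
import Algebra.Properties.Ring as RingProperties
open import Data.Bool.Base using (if_then_else_)
open import Data.Fin.Base as Fin using (Fin)
import Data.Fin.Properties as Fin
open import Data.Integer.Base as ℤ using (ℤ; +_; -[1+_]; -1ℤ; 0ℤ; ∣_∣)
open import Data.Integer.Divisibility as ℤ using ()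
open import Data.List.Base as List using (List; []; _∷_; _++_; filter; foldr; cartesianProduct)
open import Data.List.Membership.Propositional using (_∈_)
open import Data.List.Membership.Propositional.Properties using (∈-map⁺; ∈-map⁻; ∈-++⁺ˡ; ∈-++⁺ʳ)
open import Data.List.Relation.Binary.Disjoint.Propositional using (Disjoint)
open import Data.List.Relation.Unary.All using () renaming ([] to []ᵃ)
open import Data.List.Relation.Unary.AllPairs using () renaming ([] to []ᵘ; _∷_ to _∷ᵘ_)
open import Data.List.Relation.Unary.Any using (here)
open import Data.List.Relation.Unary.Unique.Propositional using (Unique)
import Data.List.Relation.Unary.Unique.Propositional.Properties as Unique
open import Data.Nat.Base as ℕ using (ℕ; zero; suc; NonZero; _!)
import Data.Nat.Divisibility as ℕ
import Data.Nat.GCD as ℕ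
import Data.Nat.Properties as ℕ
open import Data.Parity.Base as ℙ using (Parity; 0ℙ; 1ℙ)
import Data.Parity.Properties as ℙ
open import Data.Product.Base using (∃; ∃₂; _×_; _,_; proj₁; proj₂; uncurry)
open import Data.Sum.Base using (_⊎_; inj₁; inj₂)
open import Data.Vec.Base as Vec using (Vec; []; _∷_; lookup; zipWith; replicate)
import Data.Vec.Properties as Vec
open import Function.Base using (_∘_)
open import Relation.Binary.Core using (Rel)
open import Relation.Binary.Definitions as B using (DecidableEquality; Symmetric)
open import Relation.Binary.PropositionalEquality using (_≡_; _≢_; refl; cong₂; subst)
open import Relation.Binary.Structures using (IsStrictPartialOrder)
open import Relation.Nullary using (¬_; does; _×-dec_; _→-dec_)
open import Relation.Unary using (Pred; Decidable)

-- The library has no real numbers, so ℝ is given by its axioms: a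
-- Cauchy-complete Archimedean ordered field, which determines it up to
-- isomorphism.  The axioms are phrased so that they hold constructively;
-- with classical logic, _#_ is inequality and the linearity of the order
-- is #⇒<⊎>.

record RealNumbers (c ℓ₁ ℓ₂ : Level) : Set (lsuc (c ⊔ ℓ₁ ⊔ ℓ₂)) where
  infix 4 _<_

  field
    heytingField : HeytingField c ℓ₁ ℓ₂

  open HeytingField heytingField public

  commutativeRing : CommutativeRing c ℓ₁
  commutativeRing =
    HeytingCommutativeRing.commutativeRing heytingCommutativeRing

  open RawSemiringDefs
    (Semiring.rawSemiring (CommutativeRing.semiring commutativeRing)) public
    using (_^_) renaming (_×_ to _·_)

  fromℕ : ℕ → Carrier
  fromℕ n = n · 1#

  field
    _<_                  : Rel Carrier ℓ₂
    isStrictPartialOrder : IsStrictPartialOrder _≈_ _<_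
    #⇒<⊎>                : ∀ {x y} → x # y → x < y ⊎ y < x
    <⇒#                  : ∀ {x y} → x < y → x # y
    +-monoˡ-<            : ∀ {x y} z → x < y → (x + z) < (y + z)
    *-pos                : ∀ {x y} → 0# < x → 0# < y → 0# < (x * y)

  -- |x − y| < ε, without an absolute value.
  ∣_-_∣<_ : Carrier → Carrier → Carrier → Set ℓ₂
  ∣ x - y ∣< ε = (x - y) < ε × (y - x) < ε

  IsCauchy : (ℕ → Carrier) → Set (c ⊔ ℓ₂)
  IsCauchy f = ∀ ε → 0# < ε →
    ∃ λ N → ∀ m n → N ℕ.≤ m → N ℕ.≤ n → ∣ f m - f n ∣< ε

  _⟶_ : (ℕ → Carrier) → Carrier → Set (c ⊔ ℓ₂)
  f ⟶ l = ∀ ε → 0# < ε → ∃ λ N → ∀ n → N ℕ.≤ n → ∣ f n - l ∣< ε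

  field
    archimedean : ∀ x → ∃ λ n → x < fromℕ n
    complete    : ∀ f → IsCauchy f → ∃ λ l → f ⟶ l

record Graph (p : Level) : Set (lsuc p) where
  infix 4 _~_ _~?_ _≟_

  field
    V        : Set
    _≟_      : DecidableEquality V
    vertices : List V
    complete : ∀ v → v ∈ vertices
    unique   : Unique vertices
    _~_      : Rel V p
    _~?_     : B.Decidable _~_
    ~-sym    : Symmetric _~_
    ~-irrefl : ∀ v → ¬ (v ~ v)

Γ : ℕ → Set
Γ r = Vec Parity r

0Γ : ∀ {r} → Γ r
0Γ = replicate _ 0ℙ

infixl 6 _⊕_ _⊖_

_⊕_ _⊖_ : ∀ {r} → Γ r → Γ r → Γ r
_⊕_ = zipWith ℙ._+_
_⊖_ = zipWith (AbelianGroup._-_ ℙ.+-0-abelianGroup)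

_times_ : ∀ {r} → ℕ → Γ r → Γ r
zero  times a = 0Γ
suc k times a = a ⊕ (k times a)

HasOrder : ∀ {r} → ℕ → Γ r → Set
HasOrder k a = 0 ℕ.< k × k times a ≡ 0Γ
             × (∀ j → 0 ℕ.< j → j ℕ.< k → j times a ≢ 0Γ)

elements : ∀ r → List (Γ r)
elements zero    = [] ∷ []
elements (suc r) = List.map (0ℙ ∷_) (elements r) ++ List.map (1ℙ ∷_) (elements r)

elements-complete : ∀ {r} (x : Γ r) → x ∈ elements r
elements-complete []       = here refl
elements-complete (0ℙ ∷ x) = ∈-++⁺ˡ (∈-map⁺ (0ℙ ∷_) (elements-complete x))
elements-complete (1ℙ ∷ x) = ∈-++⁺ʳ _ (∈-map⁺ (1ℙ ∷_) (elements-complete x))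

elements-unique : ∀ r → Unique (elements r)
elements-unique zero    = []ᵃ ∷ᵘ []ᵘ
elements-unique (suc r) = Unique.++⁺
  (Unique.map⁺ Vec.∷-injectiveʳ (elements-unique r))
  (Unique.map⁺ Vec.∷-injectiveʳ (elements-unique r))
  disjoint
  where
  disjoint : Disjoint (List.map (0ℙ ∷_) (elements r)) (List.map (1ℙ ∷_) (elements r))
  disjoint (p , q) with ∈-map⁻ (0ℙ ∷_) p | ∈-map⁻ (1ℙ ∷_) q
  ... | _ , _ , refl | _ , _ , ()

⊖-comm : ∀ {r} (x y : Γ r) → x ⊖ y ≡ y ⊖ x
⊖-comm = Vec.zipWith-comm ℙ.+-comm

⊖-self : ∀ {r} (x : Γ r) → x ⊖ x ≡ 0Γ
⊖-self []      = refl
⊖-self (p ∷ x) = cong₂ _∷_ (ℙ.p+p≡0ℙ p) (⊖-self x)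

Cay : ∀ {r p} (S : Pred (Γ r) p) → Decidable S → ¬ S 0Γ → Graph p
Cay {r} S S? 0∉S = record
  { V        = Γ r
  ; _≟_      = Vec.≡-dec ℙ._≟_
  ; vertices = elements r
  ; complete = elements-complete
  ; unique   = elements-unique r
  ; _~_      = λ u v → S (u ⊖ v)
  ; _~?_     = λ u v → S? (u ⊖ v)
  ; ~-sym    = λ {u} {v} → subst S (⊖-comm u v)
  ; ~-irrefl = λ v → 0∉S ∘ subst S (⊖-self v)
  }

rep : Parity → ℕ
rep 0ℙ = 0
rep 1ℙ = 1

_∙_ : ∀ {r} → Γ r → Γ r → ℕ
s ∙ x = Vec.sum (zipWith (λ p q → rep p ℕ.* rep q) s x)

infix 4 _∙>_ _∙>?_

_∙>_ : ∀ {r} → Γ r → Γ r → Set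
_∙>_ {r} x y = ∃ λ (i : Fin r) →
    (∀ j → j Fin.< i → lookup x j ≡ lookup y j)
  × rep (lookup x i) ℕ.> rep (lookup y i)

-- wt (2a(x − y)/n) for n = (2,…,2): the factor 2 and the quotient by n cancel.
weight : ∀ {r} (a x y : Γ r) → ℤ
weight a x y = Vec.foldr′ ℤ._+_ 0ℤ
  (zipWith ℤ._*_ (Vec.map (+_ ∘ rep) a)
    (zipWith ℤ._-_ (Vec.map (+_ ∘ rep) x) (Vec.map (+_ ∘ rep) y)))

N : ∀ {r} → Γ r → Γ r → Γ r → Set
N a x y = x ∙> y × (+ 2) ℤ.∣ weight a x y

_∙>?_ : ∀ {r} → B.Decidable (_∙>_ {r})
x ∙>? y = Fin.any? λ i →
  Fin.all? (λ j → (j Fin.<? i) →-dec (lookup x j ℙ.≟ lookup y j))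
  ×-dec (rep (lookup y i) ℕ.<? rep (lookup x i))

N? : ∀ {r} (a : Γ r) → B.Decidable (N a)
N? a x y = (x ∙>? y) ×-dec (2 ℕ.∣? ∣ weight a x y ∣)

-- ∑_{s∈S} ((-1)^{s·x} − (-1)^{s·y})
Δ : ∀ {r p} {S : Pred (Γ r) p} → Decidable S → Γ r → Γ r → ℤ
Δ {r} S? x y = foldr ℤ._+_ 0ℤ
  (List.map (λ s → (-1ℤ ℤ.^ (s ∙ x)) ℤ.- (-1ℤ ℤ.^ (s ∙ y)))
    (filter S? (elements r)))

-- The gcd of the empty set, and of {0}, is 0.
gcdOf : List ℤ → ℕ
gcdOf = foldr (λ z g → ℕ.gcd ∣ z ∣ g) 0

M : ∀ {r p} {S : Pred (Γ r) p} → Decidable S → Γ r → ℕ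
M {r} S? a = gcdOf (List.map (uncurry (Δ S?))
  (filter (uncurry (N? a)) (cartesianProduct (elements r) (elements r))))

module Analysis {c ℓ₁ ℓ₂} (R : RealNumbers c ℓ₁ ℓ₂) where

  open RealNumbers R hiding (refl; sym; trans; complete)

  ℝ : Set c
  ℝ = Carrier

  0<1 : 0# < 1#
  0<1 with #⇒<⊎> (invertible⇒# {1#} {0#} (1# , invˡ , invʳ))
    where
    open CommutativeRing commutativeRing using (ring)
    open RingProperties ring using (-0#≈0#)
    1-0≈1 : 1# - 0# ≈ 1#
    1-0≈1 = RealNumbers.trans R (+-congˡ -0#≈0#) (+-identityʳ 1#)
    invˡ : 1# * (1# - 0#) ≈ 1#
    invˡ = RealNumbers.trans R (*-identityˡ _) 1-0≈1
    invʳ : (1# - 0#) * 1# ≈ 1#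
    invʳ = RealNumbers.trans R (*-identityʳ _) 1-0≈1
  ... | inj₂ 0<1′ = 0<1′
  ... | inj₁ 1<0  = <-respʳ-≈ [-1]²≈1 (*-pos 0<-1 0<-1)
    where
    open IsStrictPartialOrder isStrictPartialOrder using (<-respʳ-≈; <-respˡ-≈)
    open CommutativeRing commutativeRing using (ring)
    open RingProperties ring using (-1*x≈-x; -‿involutive)
    0<-1 : 0# < - 1#
    0<-1 = <-respˡ-≈ (-‿inverseʳ 1#)
      (<-respʳ-≈ (+-identityˡ (- 1#)) (+-monoˡ-< (- 1#) 1<0))
    [-1]²≈1 : - 1# * - 1# ≈ 1#
    [-1]²≈1 = RealNumbers.trans R (-1*x≈-x (- 1#)) (-‿involutive 1#)

  0<fromℕ : ∀ n .⦃ _ : NonZero n ⦄ → 0# < fromℕ n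
  0<fromℕ (suc zero)    = <-respʳ-≈ (RealNumbers.sym R (+-identityʳ 1#)) 0<1
    where open IsStrictPartialOrder isStrictPartialOrder using (<-respʳ-≈)
  0<fromℕ (suc (suc n)) = <-trans (0<fromℕ (suc n))
    (<-respˡ-≈ (+-identityˡ _) (+-monoˡ-< (fromℕ (suc n)) 0<1))
    where
    open IsStrictPartialOrder isStrictPartialOrder
      using (<-respˡ-≈) renaming (trans to <-trans)

  fromℤ : ℤ → ℝ
  fromℤ (+ n)    = fromℕ n
  fromℤ -[1+ n ] = - fromℕ (suc n)

  IsInteger : ℝ → Set ℓ₁
  IsInteger x = ∃ λ k → x ≈ fromℤ k

  -- #⇒invertible, applied to y # 0#, inverts y - 0#.
  infixl 7 _/_⟨_⟩
  _/_⟨_⟩ : (x y : ℝ) → 0# < y → ℝ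
  x / y ⟨ 0<y ⟩ = x * proj₁ (#⇒invertible (#-sym (<⇒# 0<y)))

  infixl 7 _/ℕ_
  _/ℕ_ : ℝ → (n : ℕ) → .⦃ NonZero n ⦄ → ℝ
  x /ℕ n = x / fromℕ n ⟨ 0<fromℕ n ⟩

  1/_! : ℕ → ℝ
  1/ k ! = (1# /ℕ (k !)) ⦃ k ℕ.!≢0 ⦄

  partialSums : (ℕ → ℝ) → ℕ → ℝ
  partialSums f zero    = 0#
  partialSums f (suc k) = partialSums f k + f k

  HasSum : (ℕ → ℝ) → ℝ → Set (c ⊔ ℓ₂)
  HasSum f s = partialSums f ⟶ s

  IsSin : ℝ → ℝ → Set (c ⊔ ℓ₂)
  IsSin x = HasSum λ k → (- 1#) ^ k * x ^ suc (2 ℕ.* k) * 1/ (suc (2 ℕ.* k)) !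

  -- π is characterised as the smallest positive zero of the sine.
  record Pi : Set (c ⊔ ℓ₂) where
    field
      π       : ℝ
      0<π     : 0# < π
      sin-π   : IsSin π 0#
      minimal : ∀ x → 0# < x → x < π → ¬ IsSin x 0#

    2π : ℝ
    2π = fromℕ 2 * π

    0<2π : 0# < 2π
    0<2π = *-pos (0<fromℕ 2) 0<π

  record ℂ : Set c where
    constructor _+i_
    field
      re im : ℝ

  open ℂ public

  infix  4 _≈ᶜ_
  infixl 6 _+ᶜ_
  infixl 7 _*ᶜ_

  _≈ᶜ_ : Rel ℂ ℓ₁
  z ≈ᶜ w = re z ≈ re w × im z ≈ im w

  0ᶜ 1ᶜ : ℂ
  0ᶜ = 0# +i 0#
  1ᶜ = 1# +i 0#

  _+ᶜ_ _*ᶜ_ : ℂ → ℂ → ℂ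
  z +ᶜ w = (re z + re w) +i (im z + im w)
  z *ᶜ w = (re z * re w - im z * im w) +i (re z * im w + im z * re w)

  ∣_∣² : ℂ → ℝ
  ∣ z ∣² = re z * re z + im z * im z

  HasSumᶜ : (ℕ → ℂ) → ℂ → Set (c ⊔ ℓ₂)
  HasSumᶜ f z = HasSum (re ∘ f) (re z) × HasSum (im ∘ f) (im z)

  module _ {p} (G : Graph p) where

    open Graph G using (V; _≟_; vertices; _~?_)

    Matrix : Set c
    Matrix = V → V → ℂ

    ∑ : (V → ℂ) → ℂ
    ∑ f = foldr _+ᶜ_ 0ᶜ (List.map f vertices)

    𝐞 : V → V → ℂ
    𝐞 u w = if does (u ≟ w) then 1ᶜ else 0ᶜ

    mul : Matrix → Matrix → Matrix
    mul A B u w = ∑ λ v → A u v *ᶜ B v w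

    pow : Matrix → ℕ → Matrix
    pow A zero    = 𝐞
    pow A (suc k) = mul A (pow A k)

    apply : Matrix → (V → ℂ) → V → ℂ
    apply A f u = ∑ λ v → A u v *ᶜ f v

    scale : ℂ → Matrix → Matrix
    scale z A u v = z *ᶜ A u v

    -- E = exp A, as the entrywise sum of the power series ∑ Aᵏ/k!.
    IsExp : Matrix → Matrix → Set (c ⊔ ℓ₂)
    IsExp A E = ∀ u v → HasSumᶜ (λ k → scale (1/ k ! +i 0#) (pow A k) u v) (E u v)

    adjacency : Matrix
    adjacency u v = if does (u ~? v) then 1ᶜ else 0ᶜ

    IsTransition : ℝ → Matrix → Set (c ⊔ ℓ₂)
    IsTransition t = IsExp (scale (0# +i t) adjacency)

    RevivalFromTo : ℝ → V → V → Set (c ⊔ ℓ₁ ⊔ ℓ₂)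
    RevivalFromTo t u v = u ≢ v × ∃ λ (H : Matrix) → IsTransition t H ×
      ∃₂ λ α β → (∀ w → apply H (𝐞 u) w ≈ᶜ α *ᶜ 𝐞 u w +ᶜ β *ᶜ 𝐞 v w)
               × ∣ α ∣² + ∣ β ∣² ≈ 1#

    RevivalBetween : ℝ → V → V → Set (c ⊔ ℓ₁ ⊔ ℓ₂)
    RevivalBetween t u v = RevivalFromTo t u v × RevivalFromTo t v u

  IsMinimumPositive : ∀ {p} → Pred ℝ p → ℝ → Set (c ⊔ ℓ₂ ⊔ p)
  IsMinimumPositive P τ = 0# < τ × P τ × (∀ t → 0# < t → P t → ¬ (t < τ))

{-# OPTIONS --safe #-}

-- The characters χ x of ℤ₂ʳ diagonalise the adjacency matrix of Cay(ℤ₂ʳ, S),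
-- with eigenvalues λ x = ∑_{s∈S} (-1)^{s·x}.  Hence
-- H(t)_{u,v} = 2⁻ʳ ∑_x e^{itλ x} χ x u χ x v, and fractional revival from v to
-- v + a means that e^{itλ x} = α + β χ x a for all x, that is, that e^{itλ x}
-- depends only on the parity of a·x.  For (x, y) ∈ N this says
-- e^{it(λ x − λ y)} = 1, or t(λ x − λ y) ∈ 2πℤ.  The minimal time comes from
-- Bézout's identity: the t with tz/2π ∈ ℤ for all z in a finite set are those
-- with tM/2π ∈ ℤ, for M the gcd of the set.
--
-- The exponential is the sum of a power series whose terms are bounded by
-- D/4ᵏ, so that all limits are taken with an explicit rate D/2ⁿ.
module Submission where

open import Defs
open import Algebra.Bundles using (CommutativeRing)
import Algebra.Properties.Ring
import Algebra.Properties.Semiring.Exp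
import Algebra.Properties.Semiring.Mult
import Algebra.Solver.Ring
open import Algebra.Solver.Ring.AlmostCommutativeRing using (fromCommutativeRing; _-Raw-AlmostCommutative⟶_)
open import Data.Bool.Base using (true; false; if_then_else_)
open import Data.Fin.Base as Fin using ()
open import Data.Integer.Base as ℤ using (ℤ; +_; -[1+_]; -1ℤ; 0ℤ; 1ℤ; ∣_∣)
import Data.Integer.Divisibility.Signed as Signed
import Data.Integer.Properties as ℤ
open import Data.List.Base using (List; []; _∷_; _++_; foldr; map; filter; cartesianProduct)
open import Data.List.Membership.Propositional using (_∈_)
open import Data.List.Membership.Propositional.Properties using (∈-map⁺; ∈-map⁻; ∈-filter⁺; ∈-filter⁻; ∈-cartesianProduct⁺)
open import Data.List.Relation.Unary.All as All using (All; []; _∷_)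
open import Data.List.Relation.Unary.AllPairs using (_∷_)
open import Data.List.Relation.Unary.Any using (here; there)
open import Data.List.Relation.Unary.Unique.Propositional using (Unique)
open import Data.Maybe.Base as Maybe using (Maybe)
open import Data.Nat.Base as ℕ using (ℕ; zero; suc; z≤n; s≤s; NonZero; _!)
import Data.Nat.Divisibility as ℕ
import Data.Nat.GCD as ℕ
import Data.Nat.Properties as ℕ
open import Data.Parity.Base as ℙ using (Parity; 0ℙ; 1ℙ)
import Data.Parity.Properties as ℙ
open import Data.Product.Base as Product using (∃; ∃₂; _×_; _,_; proj₁; proj₂; uncurry)
open import Data.Sum.Base as Sum using (_⊎_; inj₁; inj₂)
open import Data.Vec.Base as Vec using ([]; _∷_; lookup)
import Data.Vec.Properties as Vec
open import Function.Base using (_∘_)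
open import Function.Bundles using (_⇔_; mk⇔)
open import Level using (Level; _⊔_)
import Relation.Binary.Reasoning.Setoid
open import Relation.Binary.PropositionalEquality as ≡ using (_≡_; _≢_)
open import Relation.Binary.Structures using (IsStrictPartialOrder)
open import Relation.Nullary using (¬_; Dec; does; yes; no; contradiction)
open import Relation.Nullary.Decidable using (dec⇒maybe; dec-true; dec-false)
open import Relation.Unary using (Pred; Decidable)

-- The real numbers are given axiomatically: their order is not decidable, and π is known only as
-- the least positive zero of the sine series. The analytic fact behind the criterion, that e^{iθ} =
-- 1 exactly for θ in 2πℤ, therefore has to be extracted from power series. It rests on the addition
-- law (Cauchy product and binomial theorem), on modulus 1 (conjugation), and on the half-angle
-- formula, which turns a period strictly between 0 and 2π into a zero of the sine below π. Wherever
-- a classical argument would compare two reals, cotransitivity of the order is used instead.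
--
-- The 4 in D/4ᵏ comes from the addition law. The error of a Cauchy product after n terms is a sum
-- of products of a term of one series with a tail of the other. With terms of size 1/4ᵏ and tails
-- of size 1/2ⁿ⁻ᵏ these add up to a constant times 1/2ⁿ, whereas terms of size 1/2ᵏ would cost an
-- extra factor n and leave the class of geometric rates.

-- Integers as scalars in a commutative ring

module IntegerScalars {c ℓ} (K : CommutativeRing c ℓ) where

  open CommutativeRing K
  open Algebra.Properties.Ring ring
  open Algebra.Properties.Semiring.Mult semiring using (×-homo-+) renaming (_×_ to _·_)
  open Relation.Binary.Reasoning.Setoid setoid

  -- The clauses repeat those of `fromℤ`, so over the reals the two maps agree by `refl` on each
  -- constructor.
  ι : ℤ → Carrier
  ι (+ n)    = n · 1#
  ι -[1+ n ] = - (suc n · 1#)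

  ι-⊖ : ∀ m n → ι (m ℤ.⊖ n) ≈ m · 1# - n · 1#
  ι-⊖ m       zero    = sym (trans (+-congˡ -0#≈0#) (+-identityʳ _))
  ι-⊖ zero    (suc n) = sym (+-identityˡ _)
  ι-⊖ (suc m) (suc n) = begin
    ι (suc m ℤ.⊖ suc n)                         ≡⟨ ≡.cong ι (ℤ.[1+m]⊖[1+n]≡m⊖n m n) ⟩
    ι (m ℤ.⊖ n)                                 ≈⟨ ι-⊖ m n ⟩
    m · 1# - n · 1#                             ≈⟨ +-congʳ (xyx⁻¹≈y 1# (m · 1#)) ⟨
    1# + m · 1# - 1# - n · 1#                   ≈⟨ +-assoc _ _ _ ⟩
    1# + m · 1# + (- 1# - n · 1#)               ≈⟨ +-congˡ (-‿+-comm 1# (n · 1#)) ⟩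
    suc m · 1# - suc n · 1#                     ∎

  ι-neg : ∀ i → ι (ℤ.- i) ≈ - ι i
  ι-neg (+ zero)  = sym -0#≈0#
  ι-neg (+ suc n) = refl
  ι-neg -[1+ n ]  = sym (-‿involutive _)

  ι-+ : ∀ i j → ι (i ℤ.+ j) ≈ ι i + ι j
  ι-+ (+ m)    (+ n)    = ×-homo-+ 1# m n
  ι-+ (+ m)    -[1+ n ] = ι-⊖ m (suc n)
  ι-+ -[1+ m ] (+ n)    = trans (ι-⊖ n (suc m)) (+-comm _ _)
  ι-+ -[1+ m ] -[1+ n ] = begin
    - (suc (suc (m ℕ.+ n)) · 1#)    ≡⟨ ≡.cong (λ k → - (suc k · 1#)) (≡.sym (ℕ.+-suc m n)) ⟩
    - ((suc m ℕ.+ suc n) · 1#)      ≈⟨ -‿cong (×-homo-+ 1# (suc m) (suc n)) ⟩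
    - (suc m · 1# + suc n · 1#)     ≈⟨ -‿+-comm _ _ ⟨
    - (suc m · 1#) - suc n · 1#     ∎

  ι-*-pos : ∀ m j → ι (+ m ℤ.* j) ≈ ι (+ m) * ι j
  ι-*-pos zero    j = trans (reflexive (≡.cong ι (ℤ.*-zeroˡ j))) (sym (zeroˡ _))
  ι-*-pos (suc m) j = begin
    ι (+ suc m ℤ.* j)             ≡⟨ ≡.cong ι (ℤ.suc-* (+ m) j) ⟩
    ι (j ℤ.+ + m ℤ.* j)           ≈⟨ ι-+ j (+ m ℤ.* j) ⟩
    ι j + ι (+ m ℤ.* j)           ≈⟨ +-cong (sym (*-identityˡ _)) (ι-*-pos m j) ⟩
    1# * ι j + m · 1# * ι j       ≈⟨ distribʳ _ _ _ ⟨
    suc m · 1# * ι j              ∎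

  ι-* : ∀ i j → ι (i ℤ.* j) ≈ ι i * ι j
  ι-* (+ m)    j = ι-*-pos m j
  ι-* -[1+ m ] j = begin
    ι (-[1+ m ] ℤ.* j)            ≡⟨ ≡.cong ι (ℤ.neg-distribˡ-* (+ suc m) j) ⟨
    ι (ℤ.- (+ suc m ℤ.* j))       ≈⟨ ι-neg (+ suc m ℤ.* j) ⟩
    - ι (+ suc m ℤ.* j)           ≈⟨ -‿cong (ι-*-pos (suc m) j) ⟩
    - (ι (+ suc m) * ι j)         ≈⟨ -‿distribˡ-* _ _ ⟩
    - ι (+ suc m) * ι j           ∎

  ι-- : ∀ i j → ι (i ℤ.- j) ≈ ι i - ι j
  ι-- i j = trans (ι-+ i (ℤ.- j)) (+-congˡ (ι-neg j))

  ι-1 : ι (+ 1) ≈ 1#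
  ι-1 = +-identityʳ 1#

  -- Sends 1 to 1# on the nose, where ι gives 1# + 0#, so that the solver
  -- recognises the constant 1#.
  coefficient : ℤ → Carrier
  coefficient (+ 1) = 1#
  coefficient i     = ι i

  coefficient≈ι : ∀ i → coefficient i ≈ ι i
  coefficient≈ι (+ 0)           = refl
  coefficient≈ι (+ 1)           = sym ι-1
  coefficient≈ι (+ suc (suc n)) = refl
  coefficient≈ι -[1+ n ]        = refl

  private
    morphism : CommutativeRing.rawRing ℤ.+-*-commutativeRing -Raw-AlmostCommutative⟶ fromCommutativeRing K
    morphism = record
      { ⟦_⟧    = coefficient
      ; +-homo = λ i j → trans (coefficient≈ι (i ℤ.+ j)) (trans (ι-+ i j) (sym (+-cong (coefficient≈ι i) (coefficient≈ι j))))
      ; *-homo = λ i j → trans (coefficient≈ι (i ℤ.* j)) (trans (ι-* i j) (sym (*-cong (coefficient≈ι i) (coefficient≈ι j))))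
      ; -‿homo = λ i → trans (coefficient≈ι (ℤ.- i)) (trans (ι-neg i) (-‿cong (sym (coefficient≈ι i))))
      ; 0-homo = refl
      ; 1-homo = refl
      }

    -- Equality of real or complex numbers cannot be decided, so the normaliser compares
    -- coefficients as integers.
    coefficient-≟ : ∀ i j → Maybe (coefficient i ≈ coefficient j)
    coefficient-≟ i j = Maybe.map (reflexive ∘ ≡.cong coefficient) (dec⇒maybe (i ℤ.≟ j))

  module Solver = Algebra.Solver.Ring (CommutativeRing.rawRing ℤ.+-*-commutativeRing)
    (fromCommutativeRing K) morphism coefficient-≟

-- Finite sums over lists

module ListSums {c ℓ} (K : CommutativeRing c ℓ) where

  open CommutativeRing K
  open IntegerScalars K
  open Solver using (solve; _:=_; _:+_)

  private variable
    a b : Level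
    A : Set a
    B : Set b

  sumOver : List A → (A → Carrier) → Carrier
  sumOver xs f = foldr _+_ 0# (map f xs)

  sum-cong : ∀ xs {f g : A → Carrier} → (∀ x → f x ≈ g x) → sumOver xs f ≈ sumOver xs g
  sum-cong []       f≈g = refl
  sum-cong (x ∷ xs) f≈g = +-cong (f≈g x) (sum-cong xs f≈g)

  sum-0 : ∀ (xs : List A) → sumOver xs (λ _ → 0#) ≈ 0#
  sum-0 []       = refl
  sum-0 (x ∷ xs) = trans (+-identityˡ _) (sum-0 xs)

  sum-+ : ∀ xs (f g : A → Carrier) → sumOver xs (λ x → f x + g x) ≈ sumOver xs f + sumOver xs g
  sum-+ []       f g = sym (+-identityˡ 0#)
  sum-+ (x ∷ xs) f g = trans (+-congˡ (sum-+ xs f g))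
    (solve 4 (λ a b c d → (a :+ b) :+ (c :+ d) := (a :+ c) :+ (b :+ d)) refl
      (f x) (g x) (sumOver xs f) (sumOver xs g))

  sum-*ˡ : ∀ xs k (f : A → Carrier) → sumOver xs (λ x → k * f x) ≈ k * sumOver xs f
  sum-*ˡ []       k f = sym (zeroʳ k)
  sum-*ˡ (x ∷ xs) k f = trans (+-congˡ (sum-*ˡ xs k f)) (sym (distribˡ _ _ _))

  sum-*ʳ : ∀ xs k (f : A → Carrier) → sumOver xs (λ x → f x * k) ≈ sumOver xs f * k
  sum-*ʳ xs k f = trans (sum-cong xs (λ x → *-comm (f x) k)) (trans (sum-*ˡ xs k f) (*-comm _ _))

  sum-++ : ∀ xs ys (f : A → Carrier) → sumOver (xs ++ ys) f ≈ sumOver xs f + sumOver ys f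
  sum-++ []       ys f = sym (+-identityˡ _)
  sum-++ (x ∷ xs) ys f = trans (+-congˡ (sum-++ xs ys f)) (sym (+-assoc _ _ _))

  sum-map : ∀ (g : B → A) ys (f : A → Carrier) → sumOver (map g ys) f ≈ sumOver ys (f ∘ g)
  sum-map g []       f = refl
  sum-map g (y ∷ ys) f = +-congˡ (sum-map g ys f)

  sum-swap : ∀ xs (ys : List B) (f : A → B → Carrier) →
    sumOver xs (λ x → sumOver ys (f x)) ≈ sumOver ys (λ y → sumOver xs (λ x → f x y))
  sum-swap []       ys f = sym (sum-0 ys)
  sum-swap (x ∷ xs) ys f = trans (+-congˡ (sum-swap xs ys f)) (sym (sum-+ ys (f x) _))

  -- Carries identities between character sums, proved over ℤ, into ℂ.
  ι-sum : ∀ (xs : List A) (f : A → ℤ) →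
    ι (foldr ℤ._+_ (+ 0) (map f xs)) ≈ sumOver xs (ι ∘ f)
  ι-sum []       f = refl
  ι-sum (x ∷ xs) f = trans (ι-+ (f x) _) (+-congˡ (ι-sum xs f))

-- Partial sums and Cauchy products of series

module CauchyProduct {c ℓ} (K : CommutativeRing c ℓ) where

  open CommutativeRing K
  open IntegerScalars K
  open Solver using (solve; _:=_; _:+_; _:*_; con)
  open Relation.Binary.Reasoning.Setoid setoid

  partialSum : (ℕ → Carrier) → ℕ → Carrier
  partialSum f zero    = 0#
  partialSum f (suc n) = partialSum f n + f n

  partialSum-cong : ∀ {f g} → (∀ k → f k ≈ g k) → ∀ n → partialSum f n ≈ partialSum g n
  partialSum-cong f≈g zero    = refl
  partialSum-cong f≈g (suc n) = +-cong (partialSum-cong f≈g n) (f≈g n)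

  partialSum-+ : ∀ f g n → partialSum (λ k → f k + g k) n ≈ partialSum f n + partialSum g n
  partialSum-+ f g zero    = sym (+-identityˡ 0#)
  partialSum-+ f g (suc n) = trans (+-congʳ (partialSum-+ f g n))
    (solve 4 (λ a b c d → (a :+ b) :+ (c :+ d) := (a :+ c) :+ (b :+ d)) refl
      (partialSum f n) (partialSum g n) (f n) (g n))

  partialSum-*ˡ : ∀ c f n → partialSum (λ k → c * f k) n ≈ c * partialSum f n
  partialSum-*ˡ c f zero    = sym (zeroʳ c)
  partialSum-*ˡ c f (suc n) = trans (+-congʳ (partialSum-*ˡ c f n)) (sym (distribˡ _ _ _))

  partialSum-suc : ∀ f n → partialSum f (suc n) ≈ f 0 + partialSum (f ∘ suc) n
  partialSum-suc f zero    = +-comm _ _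
  partialSum-suc f (suc n) = trans (+-congʳ (partialSum-suc f n)) (+-assoc _ _ _)

  -- The coefficient of degree n in a product of power series. Recursion through the shift `f ∘ suc`
  -- avoids truncated subtraction of indices; inductions then generalise over `f`.
  conv : (ℕ → Carrier) → (ℕ → Carrier) → ℕ → Carrier
  conv f g zero    = f 0 * g 0
  conv f g (suc n) = f 0 * g (suc n) + conv (f ∘ suc) g n

  conv-congˡ : ∀ {f f′} g → (∀ k → f k ≈ f′ k) → ∀ n → conv f g n ≈ conv f′ g n
  conv-congˡ g f≈f′ zero    = *-congʳ (f≈f′ 0)
  conv-congˡ g f≈f′ (suc n) = +-cong (*-congʳ (f≈f′ 0)) (conv-congˡ g (f≈f′ ∘ suc) n)

  conv-congʳ : ∀ f {g g′} → (∀ k → g k ≈ g′ k) → ∀ n → conv f g n ≈ conv f g′ n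
  conv-congʳ f g≈g′ zero    = *-congˡ (g≈g′ 0)
  conv-congʳ f g≈g′ (suc n) = +-cong (*-congˡ (g≈g′ (suc n))) (conv-congʳ (f ∘ suc) g≈g′ n)

  conv-*ˡ : ∀ c f g n → conv (λ k → c * f k) g n ≈ c * conv f g n
  conv-*ˡ c f g zero    = *-assoc _ _ _
  conv-*ˡ c f g (suc n) = trans (+-cong (*-assoc _ _ _) (conv-*ˡ c (f ∘ suc) g n)) (sym (distribˡ _ _ _))

  conv-*ʳ : ∀ c f g n → conv f (λ k → c * g k) n ≈ c * conv f g n
  conv-*ʳ c f g zero    = solve 3 (λ c x y → x :* (c :* y) := c :* (x :* y)) refl c (f 0) (g 0)
  conv-*ʳ c f g (suc n) = trans (+-congˡ (conv-*ʳ c (f ∘ suc) g n))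
    (solve 4 (λ c x y z → x :* (c :* y) :+ c :* z := c :* (x :* y :+ z)) refl c (f 0) (g (suc n)) (conv (f ∘ suc) g n))

  -- The definition peels off the end at `f 0`. Differentiating the second factor in
  -- `conv-dividedPower-suc` needs the other end.
  conv-sucʳ : ∀ f g n → conv f g (suc n) ≈ conv f (g ∘ suc) n + f (suc n) * g 0
  conv-sucʳ f g zero    = refl
  conv-sucʳ f g (suc n) = trans (+-congˡ (conv-sucʳ (f ∘ suc) g n)) (sym (+-assoc _ _ _))

  -- The left side runs over the triangle i + j ≤ n. It is cut into the row i = 0 and the smaller
  -- triangle that belongs to `f ∘ suc`.
  partialSum-conv-suc : ∀ f g n →
    partialSum (conv f g) (suc n) ≈ f 0 * partialSum g (suc n) + partialSum (conv (f ∘ suc) g) n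
  partialSum-conv-suc f g zero    = solve 2 (λ x y → con (+ 0) :+ x :* y := x :* (con (+ 0) :+ y) :+ con (+ 0)) refl (f 0) (g 0)
  partialSum-conv-suc f g (suc n) = trans (+-congʳ (partialSum-conv-suc f g n))
    (solve 5 (λ x p y q z → (x :* p :+ q) :+ (x :* y :+ z) := x :* (p :+ y) :+ (q :+ z)) refl
      (f 0) (partialSum g (suc n)) (g (suc n)) (partialSum (conv (f ∘ suc) g) n) (conv (f ∘ suc) g n))

  -- The Leibniz rule for the derivation f ↦ (k ↦ k f k) of power series; the
  -- offset s makes the induction go through.
  conv-leibniz : ∀ s f g n → ι (+ (s ℕ.+ n)) * conv f g n
    ≈ conv (λ k → ι (+ (s ℕ.+ k)) * f k) g n + conv f (λ k → ι (+ k) * g k) n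
  conv-leibniz s f g zero    = solve 3 (λ c x y → c :* (x :* y) := c :* x :* y :+ x :* (con (+ 0) :* y)) refl (ι (+ (s ℕ.+ 0))) (f 0) (g 0)
  conv-leibniz s f g (suc n) = begin
    ι (+ (s ℕ.+ suc n)) * (f 0 * g (suc n) + conv (f ∘ suc) g n)
      ≈⟨ distribˡ _ _ _ ⟩
    ι (+ (s ℕ.+ suc n)) * (f 0 * g (suc n)) + ι (+ (s ℕ.+ suc n)) * conv (f ∘ suc) g n
      ≈⟨ +-cong (*-congʳ (ι-+ (+ s) (+ suc n))) (*-congʳ (reflexive (≡.cong (ι ∘ +_) (ℕ.+-suc s n)))) ⟩
    (ι (+ s) + ι (+ suc n)) * (f 0 * g (suc n)) + ι (+ (suc s ℕ.+ n)) * conv (f ∘ suc) g n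
      ≈⟨ +-congˡ (conv-leibniz (suc s) (f ∘ suc) g n) ⟩
    (ι (+ s) + ι (+ suc n)) * (f 0 * g (suc n))
      + (conv (λ k → ι (+ (suc s ℕ.+ k)) * f (suc k)) g n + conv (f ∘ suc) (λ k → ι (+ k) * g k) n)
      ≈⟨ solve 6 (λ a b x y p q → (a :+ b) :* (x :* y) :+ (p :+ q) := (a :* x :* y :+ p) :+ (x :* (b :* y) :+ q)) refl
           (ι (+ s)) (ι (+ suc n)) (f 0) (g (suc n)) _ _ ⟩
    (ι (+ s) * f 0 * g (suc n) + conv (λ k → ι (+ (suc s ℕ.+ k)) * f (suc k)) g n)
      + (f 0 * (ι (+ suc n) * g (suc n)) + conv (f ∘ suc) (λ k → ι (+ k) * g k) n)
      ≈⟨ +-congʳ (+-cong (*-congʳ (*-congʳ (reflexive (≡.cong (ι ∘ +_) (≡.sym (ℕ.+-identityʳ s))))))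
           (conv-congˡ g (λ k → *-congʳ (reflexive (≡.cong (ι ∘ +_) (≡.sym (ℕ.+-suc s k))))) n)) ⟩
    conv (λ k → ι (+ (s ℕ.+ k)) * f k) g (suc n) + conv f (λ k → ι (+ k) * g k) (suc n) ∎

-- Divided powers and the binomial theorem

module DividedPowers {c ℓ} (K : CommutativeRing c ℓ)
  (w : ℕ → CommutativeRing.Carrier K)
  (!*w≈1 : ∀ k → CommutativeRing._≈_ K (CommutativeRing._*_ K (IntegerScalars.ι K (+ (k !))) (w k)) (CommutativeRing.1# K))
  where

  open CommutativeRing K
  open IntegerScalars K
  open CauchyProduct K
  open Algebra.Properties.Semiring.Exp semiring using (_^_; ^-congˡ)
  open Solver using (solve; _:=_; _:+_; _:*_; con)
  open Relation.Binary.Reasoning.Setoid setoid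

  dividedPower : Carrier → ℕ → Carrier
  dividedPower x k = w k * x ^ k

  dividedPower-cong : ∀ {x y} → x ≈ y → ∀ k → dividedPower x k ≈ dividedPower y k
  dividedPower-cong x≈y k = *-congˡ (^-congˡ k x≈y)

  w0≈1 : w 0 ≈ 1#
  w0≈1 = trans (sym (*-identityˡ _)) (trans (*-congʳ (sym ι-1)) (!*w≈1 0))

  ι-! : ∀ k → ι (+ (suc k !)) ≈ ι (+ suc k) * ι (+ (k !))
  ι-! k = trans (reflexive (≡.cong ι (ℤ.pos-* (suc k) (k !)))) (ι-* (+ suc k) (+ (k !)))

  w-suc : ∀ k → ι (+ suc k) * w (suc k) ≈ w k
  w-suc k = begin
    ι (+ suc k) * w (suc k)                          ≈⟨ *-identityˡ _ ⟨
    1# * (ι (+ suc k) * w (suc k))                   ≈⟨ *-congʳ (!*w≈1 k) ⟨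
    ι (+ (k !)) * w k * (ι (+ suc k) * w (suc k))    ≈⟨ solve 4 (λ f w s w′ → f :* w :* (s :* w′) := w :* (s :* f :* w′)) refl (ι (+ (k !))) (w k) (ι (+ suc k)) (w (suc k)) ⟩
    w k * (ι (+ suc k) * ι (+ (k !)) * w (suc k))    ≈⟨ *-congˡ (trans (*-congʳ (sym (ι-! k))) (!*w≈1 (suc k))) ⟩
    w k * 1#                                         ≈⟨ *-identityʳ _ ⟩
    w k                                              ∎

  -- `suc k` is a unit because it divides the unit (k + 1)!; its inverse is `w (suc k)` times k!.
  suc-cancel : ∀ k {x y} → ι (+ suc k) * x ≈ ι (+ suc k) * y → x ≈ y
  suc-cancel k {x} {y} eq = begin
    x                                              ≈⟨ expand x ⟩
    w (suc k) * ι (+ (k !)) * (ι (+ suc k) * x)    ≈⟨ *-congˡ eq ⟩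
    w (suc k) * ι (+ (k !)) * (ι (+ suc k) * y)    ≈⟨ expand y ⟨
    y                                              ∎
    where
    expand : ∀ z → z ≈ w (suc k) * ι (+ (k !)) * (ι (+ suc k) * z)
    expand z = begin
      z                                              ≈⟨ *-identityˡ z ⟨
      1# * z                                         ≈⟨ *-congʳ (trans (*-congʳ (sym (ι-! k))) (!*w≈1 (suc k))) ⟨
      ι (+ suc k) * ι (+ (k !)) * w (suc k) * z      ≈⟨ solve 4 (λ s f w z → s :* f :* w :* z := w :* f :* (s :* z)) refl (ι (+ suc k)) (ι (+ (k !))) (w (suc k)) z ⟩
      w (suc k) * ι (+ (k !)) * (ι (+ suc k) * z)    ∎

  dividedPower-suc : ∀ x k → ι (+ suc k) * dividedPower x (suc k) ≈ x * dividedPower x k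
  dividedPower-suc x k = begin
    ι (+ suc k) * (w (suc k) * (x * x ^ k))    ≈⟨ solve 4 (λ s w x p → s :* (w :* (x :* p)) := s :* w :* (x :* p)) refl (ι (+ suc k)) (w (suc k)) x (x ^ k) ⟩
    ι (+ suc k) * w (suc k) * (x * x ^ k)      ≈⟨ *-congʳ (w-suc k) ⟩
    w k * (x * x ^ k)                          ≈⟨ solve 3 (λ w x p → w :* (x :* p) := x :* (w :* p)) refl (w k) x (x ^ k) ⟩
    x * (w k * x ^ k)                          ∎

  -- Multiplying the coefficient of degree k by k is a derivation, and it turns the series of x into
  -- x times its own shift. The Leibniz rule adds the contributions x and y; the terms of index 0
  -- drop out because they carry the factor 0.
  conv-dividedPower-suc : ∀ x y n → ι (+ suc n) * conv (dividedPower x) (dividedPower y) (suc n)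
    ≈ (x + y) * conv (dividedPower x) (dividedPower y) n
  conv-dividedPower-suc x y n = begin
    ι (+ suc n) * conv X Y (suc n)
      ≈⟨ conv-leibniz 0 X Y (suc n) ⟩
    (0# * X 0 * Y (suc n) + conv (λ k → ι (+ suc k) * X (suc k)) Y n) + conv X (λ k → ι (+ k) * Y k) (suc n)
      ≈⟨ +-cong
           (+-congˡ (trans (conv-congˡ Y (dividedPower-suc x) n) (conv-*ˡ x X Y n)))
           (trans (conv-sucʳ X (λ k → ι (+ k) * Y k) n)
             (+-congʳ (trans (conv-congʳ X (dividedPower-suc y) n) (conv-*ʳ y X Y n)))) ⟩
    (0# * X 0 * Y (suc n) + x * conv X Y n) + (y * conv X Y n + X (suc n) * (0# * Y 0))
      ≈⟨ solve 7 (λ x y t a b c d → (con (+ 0) :* a :* b :+ x :* t) :+ (y :* t :+ c :* (con (+ 0) :* d)) := (x :+ y) :* t) refl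
           x y (conv X Y n) (X 0) (Y (suc n)) (X (suc n)) (Y 0) ⟩
    (x + y) * conv X Y n ∎
    where
    X = dividedPower x
    Y = dividedPower y

  -- The binomial theorem without binomial coefficients: both sides satisfy (n + 1) c(n + 1) = (x +
  -- y) c(n) with the same c(0), the coefficient form of the differential equation of the
  -- exponential.
  conv-dividedPower : ∀ x y n → conv (dividedPower x) (dividedPower y) n ≈ dividedPower (x + y) n
  conv-dividedPower x y zero    = begin
    w 0 * 1# * (w 0 * 1#)    ≈⟨ *-congʳ (trans (*-identityʳ _) w0≈1) ⟩
    1# * (w 0 * 1#)          ≈⟨ *-identityˡ _ ⟩
    w 0 * 1#                 ∎
  conv-dividedPower x y (suc n) = suc-cancel n (begin
    ι (+ suc n) * conv (dividedPower x) (dividedPower y) (suc n)   ≈⟨ conv-dividedPower-suc x y n ⟩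
    (x + y) * conv (dividedPower x) (dividedPower y) n             ≈⟨ *-congˡ (conv-dividedPower x y n) ⟩
    (x + y) * dividedPower (x + y) n                               ≈⟨ dividedPower-suc (x + y) n ⟨
    ι (+ suc n) * dividedPower (x + y) (suc n)                     ∎)

-- The group ℤ₂ʳ and its characters

⊕-comm : ∀ {r} (x y : Γ r) → x ⊕ y ≡ y ⊕ x
⊕-comm = Vec.zipWith-comm ℙ.+-comm

⊕-identityʳ : ∀ {r} (x : Γ r) → x ⊕ 0Γ ≡ x
⊕-identityʳ = Vec.zipWith-identityʳ ℙ.+-identityʳ

⊕-cancel : ∀ {r} (x y : Γ r) → x ⊕ (x ⊕ y) ≡ y
⊕-cancel x y = begin
  x ⊕ (x ⊕ y)  ≡⟨ Vec.zipWith-assoc ℙ.+-assoc x x y ⟨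
  x ⊕ x ⊕ y    ≡⟨ ≡.cong (_⊕ y) (⊖-self x) ⟩
  0Γ ⊕ y       ≡⟨ ⊕-comm 0Γ y ⟩
  y ⊕ 0Γ       ≡⟨ ⊕-identityʳ y ⟩
  y            ∎
  where open ≡.≡-Reasoning

order2⇒≢0Γ : ∀ {r} {a : Γ r} → HasOrder 2 a → a ≢ 0Γ
order2⇒≢0Γ {a = a} (_ , _ , least) a≡0 = least 1 (s≤s z≤n) (s≤s (s≤s z≤n)) (≡.trans (⊕-identityʳ a) a≡0)

x≢x⊕a : ∀ {r} {a : Γ r} → a ≢ 0Γ → ∀ x → x ≢ x ⊕ a
x≢x⊕a {a = a} a≢0 x x≡x⊕a = a≢0 (begin
  a            ≡⟨ ⊕-cancel x a ⟨
  x ⊕ (x ⊕ a)  ≡⟨ ≡.cong (x ⊕_) x≡x⊕a ⟨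
  x ⊕ x        ≡⟨ ⊖-self x ⟩
  0Γ           ∎)
  where open ≡.≡-Reasoning

-- Kept in ℤ, so that orthogonality and eigenvalues are exact integer computations; `ιᶜ` transports
-- them to ℂ.
χ : ∀ {r} → Γ r → Γ r → ℤ
χ x y = -1ℤ ℤ.^ (x ∙ y)

sign : Parity → Parity → ℤ
sign p q = -1ℤ ℤ.^ (rep p ℕ.* rep q)

χ-∷ : ∀ {r} p q (x y : Γ r) → χ (p ∷ x) (q ∷ y) ≡ sign p q ℤ.* χ x y
χ-∷ p q x y = ℤ.^-distribˡ-+-* -1ℤ (rep p ℕ.* rep q) (x ∙ y)

∙-comm : ∀ {r} (x y : Γ r) → x ∙ y ≡ y ∙ x
∙-comm []      []      = ≡.refl
∙-comm (p ∷ x) (q ∷ y) = ≡.cong₂ ℕ._+_ (ℕ.*-comm (rep p) (rep q)) (∙-comm x y)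

χ-comm : ∀ {r} (x y : Γ r) → χ x y ≡ χ y x
χ-comm x y = ≡.cong (-1ℤ ℤ.^_) (∙-comm x y)

sign-+ : ∀ p q q′ → sign p (q ℙ.+ q′) ≡ sign p q ℤ.* sign p q′
sign-+ 0ℙ q  q′ = ≡.refl
sign-+ 1ℙ 0ℙ 0ℙ = ≡.refl
sign-+ 1ℙ 0ℙ 1ℙ = ≡.refl
sign-+ 1ℙ 1ℙ 0ℙ = ≡.refl
sign-+ 1ℙ 1ℙ 1ℙ = ≡.refl

χ-⊕ : ∀ {r} (x u v : Γ r) → χ x (u ⊕ v) ≡ χ x u ℤ.* χ x v
χ-⊕ []      []      []       = ≡.refl
χ-⊕ (p ∷ x) (q ∷ u) (q′ ∷ v) = begin
  χ (p ∷ x) (q ℙ.+ q′ ∷ u ⊕ v)                             ≡⟨ χ-∷ p (q ℙ.+ q′) x (u ⊕ v) ⟩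
  sign p (q ℙ.+ q′) ℤ.* χ x (u ⊕ v)                        ≡⟨ ≡.cong₂ ℤ._*_ (sign-+ p q q′) (χ-⊕ x u v) ⟩
  sign p q ℤ.* sign p q′ ℤ.* (χ x u ℤ.* χ x v)             ≡⟨ solve 4 (λ a b c d → a :* b :* (c :* d) := a :* c :* (b :* d)) ≡.refl (sign p q) (sign p q′) (χ x u) (χ x v) ⟩
  sign p q ℤ.* χ x u ℤ.* (sign p q′ ℤ.* χ x v)             ≡⟨ ≡.cong₂ ℤ._*_ (χ-∷ p q x u) (χ-∷ p q′ x v) ⟨
  χ (p ∷ x) (q ∷ u) ℤ.* χ (p ∷ x) (q′ ∷ v)                 ∎
  where
  open ≡.≡-Reasoning
  open IntegerScalars.Solver ℤ.+-*-commutativeRing using (solve; _:=_; _:*_)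

0Γ∙ : ∀ {r} (x : Γ r) → 0Γ ∙ x ≡ 0
0Γ∙ []      = ≡.refl
0Γ∙ (p ∷ x) = 0Γ∙ x

χ-0Γˡ : ∀ {r} (x : Γ r) → χ 0Γ x ≡ 1ℤ
χ-0Γˡ x = ≡.cong (-1ℤ ℤ.^_) (0Γ∙ x)

χ-square : ∀ {r} (x u : Γ r) → χ x u ℤ.* χ x u ≡ 1ℤ
χ-square x u = begin
  χ x u ℤ.* χ x u  ≡⟨ χ-⊕ x u u ⟨
  χ x (u ⊕ u)      ≡⟨ ≡.cong (χ x) (⊖-self u) ⟩
  χ x 0Γ           ≡⟨ χ-comm x 0Γ ⟩
  χ 0Γ x           ≡⟨ χ-0Γˡ x ⟩
  1ℤ               ∎
  where open ≡.≡-Reasoning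

-1^-cases : ∀ n → -1ℤ ℤ.^ n ≡ 1ℤ ⊎ -1ℤ ℤ.^ n ≡ -1ℤ
-1^-cases zero = inj₁ ≡.refl
-1^-cases (suc n) with -1^-cases n
... | inj₁ eq = inj₂ (≡.cong (-1ℤ ℤ.*_) eq)
... | inj₂ eq = inj₁ (≡.cong (-1ℤ ℤ.*_) eq)

-- The witness is the unit vector at the first coordinate where `a` is 1. Next to 0Γ, where the
-- character has value 1, it provides the second sample point that determines α and β in
-- `condition⇒split`.
χ-nontrivial : ∀ {r} {a : Γ r} → a ≢ 0Γ → ∃ λ x → χ x a ≡ -1ℤ
χ-nontrivial {a = []}     a≢0 = contradiction ≡.refl a≢0
χ-nontrivial {a = 0ℙ ∷ a} a≢0 =
  let x , eq = χ-nontrivial (a≢0 ∘ ≡.cong (0ℙ ∷_))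
  in 0ℙ ∷ x , eq
χ-nontrivial {a = 1ℙ ∷ a} a≢0 = 1ℙ ∷ 0Γ , ≡.cong (-1ℤ ℤ.*_) (χ-0Γˡ a)

-- The lexicographic order and the set N

∙>-∷ : ∀ {r} p {x y : Γ r} → x ∙> y → p ∷ x ∙> p ∷ y
∙>-∷ p {x} {y} (i , agree , gt) = Fin.suc i , agree′ , gt
  where
  agree′ : ∀ j → j Fin.< Fin.suc i → lookup (p ∷ x) j ≡ lookup (p ∷ y) j
  agree′ Fin.zero    _         = ≡.refl
  agree′ (Fin.suc j) (s≤s j<i) = agree j j<i

-- `N` holds each unordered pair of distinct elements at most once, with the larger one first.
-- Trichotomy brings an arbitrary pair into that form.
∙>-trichotomous : ∀ {r} (x y : Γ r) → x ∙> y ⊎ x ≡ y ⊎ y ∙> x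
∙>-trichotomous-∷ : ∀ {r} p (x y : Γ r) → p ∷ x ∙> p ∷ y ⊎ p ∷ x ≡ p ∷ y ⊎ p ∷ y ∙> p ∷ x

∙>-trichotomous []       []       = inj₂ (inj₁ ≡.refl)
∙>-trichotomous (0ℙ ∷ x) (1ℙ ∷ y) = inj₂ (inj₂ (Fin.zero , (λ _ ()) , s≤s z≤n))
∙>-trichotomous (1ℙ ∷ x) (0ℙ ∷ y) = inj₁ (Fin.zero , (λ _ ()) , s≤s z≤n)
∙>-trichotomous (0ℙ ∷ x) (0ℙ ∷ y) = ∙>-trichotomous-∷ 0ℙ x y
∙>-trichotomous (1ℙ ∷ x) (1ℙ ∷ y) = ∙>-trichotomous-∷ 1ℙ x y

∙>-trichotomous-∷ p x y = Sum.map (∙>-∷ p) (Sum.map (≡.cong (p ∷_)) (∙>-∷ p)) (∙>-trichotomous x y)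

weight≡ : ∀ {r} (a x y : Γ r) → weight a x y ≡ + (a ∙ x) ℤ.- + (a ∙ y)
weight≡ []      []      []       = ≡.refl
weight≡ (p ∷ a) (q ∷ x) (q′ ∷ y) = begin
  + rep p ℤ.* (+ rep q ℤ.- + rep q′) ℤ.+ weight a x y
    ≡⟨ ≡.cong (λ z → + rep p ℤ.* (+ rep q ℤ.- + rep q′) ℤ.+ z) (weight≡ a x y) ⟩
  + rep p ℤ.* (+ rep q ℤ.- + rep q′) ℤ.+ (+ (a ∙ x) ℤ.- + (a ∙ y))
    ≡⟨ solve 5 (λ p q q′ m n → p :* (q :- q′) :+ (m :- n) := (p :* q :+ m) :- (p :* q′ :+ n)) ≡.refl (+ rep p) (+ rep q) (+ rep q′) (+ (a ∙ x)) (+ (a ∙ y)) ⟩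
  (+ rep p ℤ.* + rep q ℤ.+ + (a ∙ x)) ℤ.- (+ rep p ℤ.* + rep q′ ℤ.+ + (a ∙ y))
    ≡⟨ ≡.cong₂ (λ m n → (m ℤ.+ + (a ∙ x)) ℤ.- (n ℤ.+ + (a ∙ y))) (ℤ.pos-* (rep p) (rep q)) (ℤ.pos-* (rep p) (rep q′)) ⟨
  + ((p ∷ a) ∙ (q ∷ x)) ℤ.- + ((p ∷ a) ∙ (q′ ∷ y)) ∎
  where
  open ≡.≡-Reasoning
  open IntegerScalars.Solver ℤ.+-*-commutativeRing using (solve; _:=_; _:+_; _:*_; _:-_)

-1*-injective : ∀ {i j} → -1ℤ ℤ.* i ≡ -1ℤ ℤ.* j → i ≡ j
-1*-injective {i} {j} = ℤ.*-cancelˡ-≡ -1ℤ i j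

even⇒-1^≡1 : ∀ n → 2 ℕ.∣ n → -1ℤ ℤ.^ n ≡ 1ℤ
even⇒-1^≡1 zero          _   = ≡.refl
even⇒-1^≡1 (suc zero)    2∣1 = contradiction (ℕ.∣⇒≤ 2∣1) λ { (s≤s ()) }
even⇒-1^≡1 (suc (suc n)) 2∣n = ≡.cong (λ z → -1ℤ ℤ.* (-1ℤ ℤ.* z)) (even⇒-1^≡1 n (ℕ.∣m+n∣m⇒∣n 2∣n ℕ.∣-refl))

-1^≡1⇒even : ∀ n → -1ℤ ℤ.^ n ≡ 1ℤ → 2 ℕ.∣ n
-1^≡1⇒even zero          _  = 2 ℕ.∣0
-- The clause for 1 is absent because `-1ℤ ℤ.^ 1` computes to -1, which differs from 1 by its
-- constructor.
-1^≡1⇒even (suc (suc n)) eq = ℕ.∣m∣n⇒∣m+n (ℕ.∣-refl {2})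
  (-1^≡1⇒even n (-1*-injective {_} {1ℤ} (-1*-injective {_} { -1ℤ } eq)))

even⇒-1^≡-1^ : ∀ m n → 2 ℕ.∣ ∣ m ℤ.⊖ n ∣ → -1ℤ ℤ.^ m ≡ -1ℤ ℤ.^ n
even⇒-1^≡-1^ m       zero    even = even⇒-1^≡1 m even
even⇒-1^≡-1^ zero    (suc n) even = ≡.sym (even⇒-1^≡1 (suc n) even)
even⇒-1^≡-1^ (suc m) (suc n) even = ≡.cong (-1ℤ ℤ.*_) (even⇒-1^≡-1^ m n
  (≡.subst (λ i → 2 ℕ.∣ ∣ i ∣) (ℤ.[1+m]⊖[1+n]≡m⊖n m n) even))

-1^≡-1^⇒even : ∀ m n → -1ℤ ℤ.^ m ≡ -1ℤ ℤ.^ n → 2 ℕ.∣ ∣ m ℤ.⊖ n ∣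
-1^≡-1^⇒even m       zero    eq = -1^≡1⇒even m eq
-1^≡-1^⇒even zero    (suc n) eq = -1^≡1⇒even (suc n) (≡.sym eq)
-1^≡-1^⇒even (suc m) (suc n) eq = ≡.subst (λ i → 2 ℕ.∣ ∣ i ∣) (≡.sym (ℤ.[1+m]⊖[1+n]≡m⊖n m n))
  (-1^≡-1^⇒even m n (-1*-injective eq))

weight≡⊖ : ∀ {r} (a x y : Γ r) → weight a x y ≡ (a ∙ x) ℤ.⊖ (a ∙ y)
weight≡⊖ a x y = ≡.trans (weight≡ a x y) (ℤ.m-n≡m⊖n (a ∙ x) (a ∙ y))

-- The weight is the integer a·x - a·y, so its evenness says that the two exponents of -1 agree
-- modulo 2.
N⇒χ≡χ : ∀ {r} (a x y : Γ r) → N a x y → χ x a ≡ χ y a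
N⇒χ≡χ a x y (_ , even) = begin
  χ x a  ≡⟨ χ-comm x a ⟩
  χ a x  ≡⟨ even⇒-1^≡-1^ (a ∙ x) (a ∙ y) (≡.subst (λ i → 2 ℕ.∣ ∣ i ∣) (weight≡⊖ a x y) even) ⟩
  χ a y  ≡⟨ χ-comm a y ⟩
  χ y a  ∎
  where open ≡.≡-Reasoning

χ≡χ⇒N : ∀ {r} (a x y : Γ r) → x ∙> y → χ x a ≡ χ y a → N a x y
χ≡χ⇒N a x y x>y eq = x>y , ≡.subst (λ i → 2 ℕ.∣ ∣ i ∣) (≡.sym (weight≡⊖ a x y))
  (-1^≡-1^⇒even (a ∙ x) (a ∙ y) (≡.trans (χ-comm a x) (≡.trans eq (χ-comm y a))))

-- Summation over ℤ₂ʳ and orthogonality of characters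

private module ℤΣ = ListSums ℤ.+-*-commutativeRing
open ℤΣ using () renaming (sumOver to sumℤ)

sum-elements-suc : ∀ r (f : Γ (suc r) → ℤ) →
  sumℤ (elements (suc r)) f ≡ sumℤ (elements r) (f ∘ (0ℙ ∷_)) ℤ.+ sumℤ (elements r) (f ∘ (1ℙ ∷_))
sum-elements-suc r f = ≡.trans
  (ℤΣ.sum-++ (map (0ℙ ∷_) (elements r)) (map (1ℙ ∷_) (elements r)) f)
  (≡.cong₂ ℤ._+_ (ℤΣ.sum-map (0ℙ ∷_) (elements r) f) (ℤΣ.sum-map (1ℙ ∷_) (elements r) f))

-- Translation permutes the group. Coordinate by coordinate, a head 0 in `u` preserves the two
-- halves of `elements` and a head 1 exchanges them.
sum-translate : ∀ {r} (u : Γ r) (f : Γ r → ℤ) →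
  sumℤ (elements r) (λ w → f (u ⊕ w)) ≡ sumℤ (elements r) f
sum-translate {zero}  []       f = ≡.refl
sum-translate {suc r} (0ℙ ∷ u) f = begin
  sumℤ (elements (suc r)) (λ w → f ((0ℙ ∷ u) ⊕ w))
    ≡⟨ sum-elements-suc r _ ⟩
  sumℤ (elements r) (λ w → f (0ℙ ∷ u ⊕ w)) ℤ.+ sumℤ (elements r) (λ w → f (1ℙ ∷ u ⊕ w))
    ≡⟨ ≡.cong₂ ℤ._+_ (sum-translate u (f ∘ (0ℙ ∷_))) (sum-translate u (f ∘ (1ℙ ∷_))) ⟩
  sumℤ (elements r) (f ∘ (0ℙ ∷_)) ℤ.+ sumℤ (elements r) (f ∘ (1ℙ ∷_))
    ≡⟨ sum-elements-suc r f ⟨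
  sumℤ (elements (suc r)) f ∎
  where open ≡.≡-Reasoning
sum-translate {suc r} (1ℙ ∷ u) f = begin
  sumℤ (elements (suc r)) (λ w → f ((1ℙ ∷ u) ⊕ w))
    ≡⟨ sum-elements-suc r _ ⟩
  sumℤ (elements r) (λ w → f (1ℙ ∷ u ⊕ w)) ℤ.+ sumℤ (elements r) (λ w → f (0ℙ ∷ u ⊕ w))
    ≡⟨ ≡.cong₂ ℤ._+_ (sum-translate u (f ∘ (1ℙ ∷_))) (sum-translate u (f ∘ (0ℙ ∷_))) ⟩
  sumℤ (elements r) (f ∘ (1ℙ ∷_)) ℤ.+ sumℤ (elements r) (f ∘ (0ℙ ∷_))
    ≡⟨ ℤ.+-comm (sumℤ (elements r) (f ∘ (1ℙ ∷_))) _ ⟩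
  sumℤ (elements r) (f ∘ (0ℙ ∷_)) ℤ.+ sumℤ (elements r) (f ∘ (1ℙ ∷_))
    ≡⟨ sum-elements-suc r f ⟨
  sumℤ (elements (suc r)) f ∎
  where open ≡.≡-Reasoning

-- The inner product of two columns of the character table, which is a Hadamard matrix.
gram : ∀ {r} → Γ r → Γ r → ℤ
gram {r} u v = sumℤ (elements r) (λ x → χ x u ℤ.* χ x v)

-- The character table is a tensor power of the table of ℤ₂, so inner products factor over
-- coordinates. The factor is 2 for equal heads and 0 for different ones.
gram-∷ : ∀ {r} q q′ (u v : Γ r) → gram (q ∷ u) (q′ ∷ v) ≡ (1ℤ ℤ.+ sign 1ℙ q ℤ.* sign 1ℙ q′) ℤ.* gram u v
gram-∷ {r} q q′ u v = begin
  gram (q ∷ u) (q′ ∷ v)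
    ≡⟨ sum-elements-suc r _ ⟩
  -- On the half with head 0 the first coordinate adds 0 to the exponents by computation, so that
  -- half is already `gram u v`.
  gram u v ℤ.+ sumℤ (elements r) (λ x → χ (1ℙ ∷ x) (q ∷ u) ℤ.* χ (1ℙ ∷ x) (q′ ∷ v))
    ≡⟨ ≡.cong (ℤ._+_ (gram u v)) (ℤΣ.sum-cong (elements r) (λ x → ≡.trans
         (≡.cong₂ ℤ._*_ (χ-∷ 1ℙ q x u) (χ-∷ 1ℙ q′ x v))
         (solve 4 (λ s a s′ b → s :* a :* (s′ :* b) := s :* s′ :* (a :* b)) ≡.refl (sign 1ℙ q) (χ x u) (sign 1ℙ q′) (χ x v)))) ⟩
  gram u v ℤ.+ sumℤ (elements r) (λ x → sign 1ℙ q ℤ.* sign 1ℙ q′ ℤ.* (χ x u ℤ.* χ x v))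
    ≡⟨ ≡.cong (ℤ._+_ (gram u v)) (ℤΣ.sum-*ˡ (elements r) (sign 1ℙ q ℤ.* sign 1ℙ q′) (λ x → χ x u ℤ.* χ x v)) ⟩
  gram u v ℤ.+ sign 1ℙ q ℤ.* sign 1ℙ q′ ℤ.* gram u v
    ≡⟨ solve 2 (λ g s → g :+ s :* g := (con 1ℤ :+ s) :* g) ≡.refl (gram u v) (sign 1ℙ q ℤ.* sign 1ℙ q′) ⟩
  (1ℤ ℤ.+ sign 1ℙ q ℤ.* sign 1ℙ q′) ℤ.* gram u v ∎
  where
  open ≡.≡-Reasoning
  open IntegerScalars.Solver ℤ.+-*-commutativeRing using (solve; _:=_; _:+_; _:*_; con)

gram-self : ∀ {r} (u : Γ r) → gram u u ≡ + (2 ℕ.^ r)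
gram-self []              = ≡.refl
gram-self {suc r} (q ∷ u) = begin
  gram (q ∷ u) (q ∷ u)                              ≡⟨ gram-∷ q q u u ⟩
  (1ℤ ℤ.+ sign 1ℙ q ℤ.* sign 1ℙ q) ℤ.* gram u u     ≡⟨ ≡.cong₂ ℤ._*_ (coefficient q) (gram-self u) ⟩
  + 2 ℤ.* + (2 ℕ.^ r)                               ≡⟨ ℤ.pos-* 2 (2 ℕ.^ r) ⟨
  + (2 ℕ.^ suc r)                                   ∎
  where
  open ≡.≡-Reasoning
  coefficient : ∀ q → 1ℤ ℤ.+ sign 1ℙ q ℤ.* sign 1ℙ q ≡ + 2
  coefficient 0ℙ = ≡.refl
  coefficient 1ℙ = ≡.refl

gram-distinct : ∀ {r} (u v : Γ r) → u ≢ v → gram u v ≡ 0ℤ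
gram-distinct []       []       u≢v = contradiction ≡.refl u≢v
gram-distinct (0ℙ ∷ u) (0ℙ ∷ v) u≢v = ≡.trans (gram-∷ 0ℙ 0ℙ u v) (≡.cong (+ 2 ℤ.*_) (gram-distinct u v (u≢v ∘ ≡.cong (0ℙ ∷_))))
gram-distinct (1ℙ ∷ u) (1ℙ ∷ v) u≢v = ≡.trans (gram-∷ 1ℙ 1ℙ u v) (≡.cong (+ 2 ℤ.*_) (gram-distinct u v (u≢v ∘ ≡.cong (1ℙ ∷_))))
gram-distinct (0ℙ ∷ u) (1ℙ ∷ v) u≢v = ≡.trans (gram-∷ 0ℙ 1ℙ u v) (ℤ.*-zeroˡ (gram u v))
gram-distinct (1ℙ ∷ u) (0ℙ ∷ v) u≢v = ≡.trans (gram-∷ 1ℙ 0ℙ u v) (ℤ.*-zeroˡ (gram u v))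

-- Eigenvalues of the adjacency matrix

module _ {r p} {S : Pred (Γ r) p} (S? : Decidable S) where

  indicator : Γ r → ℤ
  indicator s = if does (S? s) then 1ℤ else 0ℤ

  eigenvalue : Γ r → ℤ
  eigenvalue x = sumℤ (elements r) (λ s → indicator s ℤ.* χ x s)

  -- The substitution w = u + s turns the sum along the row of `u` into one over the connection set,
  -- and multiplicativity of the character splits off its value at `u`. Writing w as u + (u + w)
  -- exhibits the summand as a function of u + w.
  eigenvector : ∀ x u → sumℤ (elements r) (λ w → indicator (u ⊖ w) ℤ.* χ x w) ≡ eigenvalue x ℤ.* χ x u
  eigenvector x u = begin
    sumℤ (elements r) (λ w → indicator (u ⊕ w) ℤ.* χ x w)
      ≡⟨ ℤΣ.sum-cong (elements r) (λ w → ≡.cong (λ v → indicator (u ⊕ w) ℤ.* χ x v) (≡.sym (⊕-cancel u w))) ⟩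
    sumℤ (elements r) (λ w → indicator (u ⊕ w) ℤ.* χ x (u ⊕ (u ⊕ w)))
      ≡⟨ sum-translate u (λ s → indicator s ℤ.* χ x (u ⊕ s)) ⟩
    sumℤ (elements r) (λ s → indicator s ℤ.* χ x (u ⊕ s))
      ≡⟨ ℤΣ.sum-cong (elements r) (λ s → ≡.trans (≡.cong (indicator s ℤ.*_) (χ-⊕ x u s))
           (solve 3 (λ i a b → i :* (a :* b) := i :* b :* a) ≡.refl (indicator s) (χ x u) (χ x s))) ⟩
    sumℤ (elements r) (λ s → indicator s ℤ.* χ x s ℤ.* χ x u)
      ≡⟨ ℤΣ.sum-*ʳ (elements r) (χ x u) (λ s → indicator s ℤ.* χ x s) ⟩
    eigenvalue x ℤ.* χ x u ∎
    where
    open ≡.≡-Reasoning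
    open IntegerScalars.Solver ℤ.+-*-commutativeRing using (solve; _:=_; _:*_)

  -- `Δ` sums over a filtered list, but translations act only on sums over the whole group; weights
  -- 0 and 1 mediate between the two.
  sum-filter : ∀ xs (f : Γ r → ℤ) → foldr ℤ._+_ 0ℤ (map f (filter S? xs)) ≡ sumℤ xs (λ s → indicator s ℤ.* f s)
  sum-filter []       f = ≡.refl
  sum-filter (x ∷ xs) f with S? x
  ... | yes _ = ≡.cong₂ ℤ._+_ (≡.sym (ℤ.*-identityˡ (f x))) (sum-filter xs f)
  ... | no  _ = ≡.trans (sum-filter xs f) (≡.sym (ℤ.+-identityˡ _))

  Δ≡eigenvalue-eigenvalue : ∀ x y → Δ S? x y ≡ eigenvalue x ℤ.- eigenvalue y
  Δ≡eigenvalue-eigenvalue x y = begin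
    Δ S? x y
      ≡⟨ sum-filter (elements r) _ ⟩
    sumℤ (elements r) (λ s → indicator s ℤ.* (χ s x ℤ.- χ s y))
      ≡⟨ ℤΣ.sum-cong (elements r) (λ s → ≡.trans
           (≡.cong₂ (λ i j → indicator s ℤ.* (i ℤ.- j)) (χ-comm s x) (χ-comm s y))
           (solve 3 (λ i a b → i :* (a :- b) := i :* a :+ con -1ℤ :* (i :* b)) ≡.refl (indicator s) (χ x s) (χ y s))) ⟩
    sumℤ (elements r) (λ s → indicator s ℤ.* χ x s ℤ.+ -1ℤ ℤ.* (indicator s ℤ.* χ y s))
      ≡⟨ ℤΣ.sum-+ (elements r) (λ s → indicator s ℤ.* χ x s) (λ s → -1ℤ ℤ.* (indicator s ℤ.* χ y s)) ⟩
    eigenvalue x ℤ.+ sumℤ (elements r) (λ s → -1ℤ ℤ.* (indicator s ℤ.* χ y s))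
      ≡⟨ ≡.cong (ℤ._+_ (eigenvalue x)) (≡.trans (ℤΣ.sum-*ˡ (elements r) -1ℤ (λ s → indicator s ℤ.* χ y s)) (ℤ.-1*i≡-i (eigenvalue y))) ⟩
    eigenvalue x ℤ.- eigenvalue y ∎
    where
    open ≡.≡-Reasoning
    open IntegerScalars.Solver ℤ.+-*-commutativeRing using (solve; _:=_; _:+_; _:*_; _:-_; con)

-- Ordered fields: weak order, reciprocals and bounds

n<2^n : ∀ n → n ℕ.< 2 ℕ.^ n
n<2^n zero    = s≤s z≤n
n<2^n (suc n) = ℕ.≤-trans (ℕ.+-mono-≤ (ℕ.m^n>0 2 n) (n<2^n n))
  (ℕ.≤-reflexive (≡.cong (2 ℕ.^ n ℕ.+_) (≡.sym (ℕ.+-identityʳ _))))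

module OrderedField {c ℓ₁ ℓ₂} (R : RealNumbers c ℓ₁ ℓ₂) where

  open RealNumbers R hiding (complete; zero)
  open Analysis R
  open CommutativeRing commutativeRing using (semiring)
  open IsStrictPartialOrder isStrictPartialOrder public
    using () renaming (trans to <-trans; irrefl to <-irrefl; <-respˡ-≈ to <-respˡ; <-respʳ-≈ to <-respʳ; asym to <-asym)
  open IntegerScalars commutativeRing
  open Solver using (solve; _:=_; _:+_; _:*_; :-_; _:-_; con)
  open Algebra.Properties.Semiring.Mult semiring using (×-homo-+; ×1-homo-*)
  open Relation.Binary.Reasoning.Setoid setoid

  infix 4 _≤_
  -- The negated strict order: it passes to limits, and a proof of it is a refutation, where
  -- cotransitivity may be applied to the assumed strict inequality.
  _≤_ : ℝ → ℝ → Set ℓ₂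
  x ≤ y = ¬ (y < x)

  <⇒0<- : ∀ {x y} → x < y → 0# < y - x
  <⇒0<- {x} x<y = <-respˡ (-‿inverseʳ x) (+-monoˡ-< (- x) x<y)

  0<-⇒< : ∀ {x y} → 0# < y - x → x < y
  0<-⇒< {x} {y} 0<y-x = <-respˡ (+-identityˡ x)
    (<-respʳ (solve 2 (λ x y → y :- x :+ x := y) refl x y) (+-monoˡ-< x 0<y-x))

  pos-+ : ∀ {x y} → 0# < x → 0# < y → 0# < x + y
  pos-+ {x} {y} 0<x 0<y = <-trans 0<y (<-respˡ (+-identityˡ y) (+-monoˡ-< y 0<x))

  +-mono-< : ∀ {x y z w} → x < y → z < w → x + z < y + w
  +-mono-< {x} {y} {z} {w} x<y z<w = 0<-⇒< (<-respʳ
    (solve 4 (λ x y z w → (y :- x) :+ (w :- z) := (y :+ w) :- (x :+ z)) refl x y z w)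
    (pos-+ (<⇒0<- x<y) (<⇒0<- z<w)))

  *-monoʳ-< : ∀ {x y z} → 0# < z → x < y → x * z < y * z
  *-monoʳ-< {x} {y} {z} 0<z x<y = 0<-⇒< (<-respʳ
    (solve 3 (λ x y z → (y :- x) :* z := y :* z :- x :* z) refl x y z) (*-pos (<⇒0<- x<y) 0<z))

  neg-pos : ∀ {x} → x < 0# → 0# < - x
  neg-pos {x} x<0 = <-respʳ (+-identityˡ (- x)) (<⇒0<- x<0)

  -- The substitute for comparing two reals. Cotransitivity of apartness yields an apartness at `z`,
  -- linearity orients it, and the unwanted orientation reduces to the other alternative by
  -- transitivity.
  <-cotrans : ∀ {x y} → x < y → ∀ z → x < z ⊎ z < y
  <-cotrans x<y z with #-cotrans (<⇒# x<y) z
  ... | inj₁ x#z = Sum.map₂ (λ z<x → <-trans z<x x<y) (#⇒<⊎> x#z)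
  ... | inj₂ z#y = Sum.map₁ (<-trans x<y) (Sum.swap (#⇒<⊎> z#y))

  ≈-tight : ∀ {x y} → ¬ (x < y) → ¬ (y < x) → x ≈ y
  ≈-tight {x} {y} x≮y y≮x = proj₁ (tight x y) λ x#y → Sum.[ x≮y , y≮x ]′ (#⇒<⊎> x#y)

  ≤-reflexive : ∀ {x y} → x ≈ y → x ≤ y
  ≤-reflexive x≈y = <-irrefl (sym x≈y)

  <⇒≤ : ∀ {x y} → x < y → x ≤ y
  <⇒≤ = <-asym

  ≤-respˡ : ∀ {x y z} → x ≈ y → x ≤ z → y ≤ z
  ≤-respˡ x≈y x≤z = x≤z ∘ <-respʳ (sym x≈y)

  ≤-respʳ : ∀ {x y z} → x ≈ y → z ≤ x → z ≤ y
  ≤-respʳ x≈y z≤x = z≤x ∘ <-respˡ (sym x≈y)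

  ≤-<-trans : ∀ {x y z} → x ≤ y → y < z → x < z
  ≤-<-trans {x} x≤y y<z = Sum.[ (λ y<x → contradiction y<x x≤y) , (λ x<z → x<z) ]′ (<-cotrans y<z x)

  <-≤-trans : ∀ {x y z} → x < y → y ≤ z → x < z
  <-≤-trans {z = z} x<y y≤z = Sum.[ (λ x<z → x<z) , (λ z<y → contradiction z<y y≤z) ]′ (<-cotrans x<y z)

  ≤-trans : ∀ {x y z} → x ≤ y → y ≤ z → x ≤ z
  ≤-trans x≤y y≤z z<x = y≤z (<-≤-trans z<x x≤y)

  ≤⇒0≤- : ∀ {x y} → x ≤ y → 0# ≤ y - x
  ≤⇒0≤- {x} {y} x≤y y-x<0 = x≤y (<-respˡ (solve 2 (λ x y → y :- x :+ x := y) refl x y)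
    (<-respʳ (+-identityˡ x) (+-monoˡ-< x y-x<0)))

  0≤-⇒≤ : ∀ {x y} → 0# ≤ y - x → x ≤ y
  0≤-⇒≤ {x} 0≤y-x y<x = 0≤y-x (<-respʳ (-‿inverseʳ x) (+-monoˡ-< (- x) y<x))

  nonNeg-+ : ∀ {x y} → 0# ≤ x → 0# ≤ y → 0# ≤ x + y
  nonNeg-+ {x} {y} 0≤x 0≤y x+y<0 with <-cotrans x+y<0 x
  ... | inj₂ x<0   = 0≤x x<0
  ... | inj₁ x+y<x = 0≤y (<-respˡ (solve 2 (λ x y → x :+ y :- x := y) refl x y)
    (<-respʳ (-‿inverseʳ x) (+-monoˡ-< (- x) x+y<x)))

  -0≈0 : ∀ {x} → x - 0# ≈ x
  -0≈0 {x} = solve 1 (λ x → x :- con 0ℤ := x) refl x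

  *#0⇒#0 : ∀ {x y} → x * y # 0# → x # 0#
  *#0⇒#0 {x} {y} xy#0 with #⇒invertible xy#0
  ... | z , zxy≈1 , _ = invertible⇒# (y * z , inverse , trans (*-comm _ _) inverse)
    where
    inverse : y * z * (x - 0#) ≈ 1#
    inverse = trans (solve 3 (λ x y z → y :* z :* (x :- con 0ℤ) := z :* (x :* y :- con 0ℤ)) refl x y z) zxy≈1

  -- A negative product is invertible, so both factors are invertible and hence apart from 0. Being
  -- nonnegative they are then positive, which makes the product positive.
  nonNeg-* : ∀ {x y} → 0# ≤ x → 0# ≤ y → 0# ≤ x * y
  nonNeg-* {x} {y} 0≤x 0≤y xy<0 = <-asym xy<0 (*-pos (positive 0≤x x#0) (positive 0≤y y#0))
    where
    x#0 : x # 0#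
    x#0 = *#0⇒#0 (<⇒# xy<0)
    y#0 : y # 0#
    y#0 = *#0⇒#0 (<⇒# (<-respˡ (*-comm x y) xy<0))
    positive : ∀ {z} → 0# ≤ z → z # 0# → 0# < z
    positive 0≤z z#0 = Sum.[ (λ z<0 → contradiction z<0 0≤z) , (λ 0<z → 0<z) ]′ (#⇒<⊎> z#0)

  nonNeg-cancel-+ : ∀ {x} → 0# ≤ x + x → 0# ≤ x
  nonNeg-cancel-+ 0≤x+x x<0 = 0≤x+x (<-respʳ (+-identityˡ 0#) (+-mono-< x<0 x<0))

  nonNeg-cancel-*ˡ : ∀ {x y} → 0# < x → 0# ≤ x * y → 0# ≤ y
  nonNeg-cancel-*ˡ {x} {y} 0<x 0≤xy y<0 = 0≤xy (<-respˡ (*-comm y x) (<-respʳ (zeroˡ x) (*-monoʳ-< 0<x y<0)))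

  *-monoʳ-≤ : ∀ {x y z} → 0# ≤ z → x ≤ y → x * z ≤ y * z
  *-monoʳ-≤ {x} {y} {z} 0≤z x≤y = 0≤-⇒≤ (≤-respʳ
    (solve 3 (λ x y z → (y :- x) :* z := y :* z :- x :* z) refl x y z) (nonNeg-* (≤⇒0≤- x≤y) 0≤z))

  square-zero : ∀ {x} → x * x ≈ 0# → x ≈ 0#
  square-zero {x} x²≈0 = ≈-tight
    (λ x<0 → <-irrefl (sym (trans (solve 1 (λ x → :- x :* :- x := x :* x) refl x) x²≈0)) (*-pos (neg-pos x<0) (neg-pos x<0)))
    (λ 0<x → <-irrefl (sym x²≈0) (*-pos 0<x 0<x))

  -- The same term as in the definition of division, so `x / y ⟨ 0<y ⟩` unfolds to `x * recip 0<y`.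
  recip : ∀ {y} → 0# < y → ℝ
  recip 0<y = proj₁ (#⇒invertible (#-sym (<⇒# 0<y)))

  recip-inverse : ∀ {y} (0<y : 0# < y) → recip 0<y * y ≈ 1#
  recip-inverse 0<y = trans (*-congˡ (sym -0≈0)) (proj₁ (proj₂ (#⇒invertible (#-sym (<⇒# 0<y)))))

  recip-pos : ∀ {y} (0<y : 0# < y) → 0# < recip 0<y
  recip-pos {y} 0<y = Sum.[ (λ y⁻¹<0 → contradiction (y⁻¹y<0 y⁻¹<0) (<-asym 0<1)) , (λ 0<y⁻¹ → 0<y⁻¹) ]′ (#⇒<⊎> y⁻¹#0)
    where
    y⁻¹#0 : recip 0<y # 0#
    y⁻¹#0 = *#0⇒#0 (#-sym (<⇒# (<-respʳ (sym (recip-inverse 0<y)) 0<1)))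
    y⁻¹y<0 : recip 0<y < 0# → 1# < 0#
    y⁻¹y<0 y⁻¹<0 = <-respˡ (recip-inverse 0<y) (<-respʳ (zeroˡ y) (*-monoʳ-< 0<y y⁻¹<0))

  fromℤ≡ι : ∀ i → fromℤ i ≡ ι i
  fromℤ≡ι (+ n)    = ≡.refl
  fromℤ≡ι -[1+ n ] = ≡.refl

  fromℕ-nonNeg : ∀ n → 0# ≤ fromℕ n
  fromℕ-nonNeg zero    = <-irrefl refl
  fromℕ-nonNeg (suc n) = <⇒≤ (0<fromℕ (suc n))

  fromℕ-mono : ∀ {m n} → m ℕ.≤ n → fromℕ m ≤ fromℕ n
  fromℕ-mono {m} m≤n with ℕ.m≤n⇒∃[o]m+o≡n m≤n
  ... | k , ≡.refl = 0≤-⇒≤ (≤-respʳ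
    (trans (solve 2 (λ a b → b := a :+ b :- a) refl (fromℕ m) (fromℕ k)) (+-congʳ (sym (×-homo-+ 1# m k))))
    (fromℕ-nonNeg k))

  fromℕ-* : ∀ m n → fromℕ (m ℕ.* n) ≈ fromℕ m * fromℕ n
  fromℕ-* = ×1-homo-*

  abstract
    -- Opaque, so that it stays an atom; what follows rests on `½-pos` and `½+½` alone.
    ½ : ℝ
    ½ = recip (0<fromℕ 2)

    ½-pos : 0# < ½
    ½-pos = recip-pos (0<fromℕ 2)

    ½+½ : ½ + ½ ≈ 1#
    ½+½ = trans (solve 1 (λ h → h :+ h := h :* con (+ 2)) refl ½) (recip-inverse (0<fromℕ 2))

  ½^-pos : ∀ n → 0# < ½ ^ n
  ½^-pos zero    = 0<1
  ½^-pos (suc n) = *-pos ½-pos (½^-pos n)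

  2^*½^ : ∀ n → fromℕ (2 ℕ.^ n) * ½ ^ n ≈ 1#
  2^*½^ zero    = trans (*-identityʳ _) ι-1
  2^*½^ (suc n) = begin
    fromℕ (2 ℕ.* 2 ℕ.^ n) * (½ * ½ ^ n)          ≈⟨ *-congʳ (fromℕ-* 2 (2 ℕ.^ n)) ⟩
    fromℕ 2 * fromℕ (2 ℕ.^ n) * (½ * ½ ^ n)      ≈⟨ solve 3 (λ a h b → con (+ 2) :* a :* (h :* b) := (h :+ h) :* (a :* b)) refl (fromℕ (2 ℕ.^ n)) ½ (½ ^ n) ⟩
    (½ + ½) * (fromℕ (2 ℕ.^ n) * ½ ^ n)          ≈⟨ *-cong ½+½ (2^*½^ n) ⟩
    1# * 1#                                      ≈⟨ *-identityˡ 1# ⟩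
    1#                                           ∎

  -- The Archimedean axiom gives N above D/ε, and 2ⁿ > n ≥ N keeps 2ⁿ above D/ε. Multiplying by ε/2ⁿ
  -- gives the claim.
  geometric-small : ∀ D {ε} → 0# < ε → ∃ λ N → ∀ n → N ℕ.≤ n → D * ½ ^ n < ε
  geometric-small D {ε} 0<ε =
    let N , D/ε<N = archimedean (D * recip 0<ε)
    in N , λ n N≤n →
    let 2ⁿ = fromℕ (2 ℕ.^ n)
        D/ε<2ⁿ = <-≤-trans D/ε<N (fromℕ-mono (ℕ.≤-trans N≤n (ℕ.<⇒≤ (n<2^n n))))
    in <-respˡ
         (trans (solve 4 (λ d r e h → d :* r :* (e :* h) := r :* e :* (d :* h)) refl D (recip 0<ε) ε (½ ^ n))
           (trans (*-congʳ (recip-inverse 0<ε)) (*-identityˡ _)))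
         (<-respʳ
           (trans (solve 3 (λ t e h → t :* (e :* h) := t :* h :* e) refl 2ⁿ ε (½ ^ n))
             (trans (*-congʳ (2^*½^ n)) (*-identityˡ _)))
           (*-monoʳ-< (*-pos 0<ε (½^-pos n)) D/ε<2ⁿ))

  -- The inequality |x| ≤ b without an absolute value. Stated as two nonnegativity conditions, it
  -- reduces estimates to sums and products of nonnegative numbers.
  Bounded : ℝ → ℝ → Set ℓ₂
  Bounded x b = 0# ≤ b - x × 0# ≤ b + x

  bounded-cong : ∀ {x y b d} → x ≈ y → b ≈ d → Bounded x b → Bounded y d
  bounded-cong x≈y b≈d (l , u) = ≤-respʳ (+-cong b≈d (-‿cong x≈y)) l , ≤-respʳ (+-cong b≈d x≈y) u

  bounded-+ : ∀ {x y b d} → Bounded x b → Bounded y d → Bounded (x + y) (b + d)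
  bounded-+ {x} {y} {b} {d} (l , u) (l′ , u′) =
    ≤-respʳ (solve 4 (λ x y b d → (b :- x) :+ (d :- y) := (b :+ d) :- (x :+ y)) refl x y b d) (nonNeg-+ l l′) ,
    ≤-respʳ (solve 4 (λ x y b d → (b :+ x) :+ (d :+ y) := (b :+ d) :+ (x :+ y)) refl x y b d) (nonNeg-+ u u′)

  bounded-neg : ∀ {x b} → Bounded x b → Bounded (- x) b
  bounded-neg {x} {b} (l , u) = ≤-respʳ (solve 2 (λ x b → b :+ x := b :- :- x) refl x b) u , l

  -- No distinction of signs is made: 2(bd - xy) = (b - x)(d + y) + (b + x)(d - y), and the same
  -- with y negated.
  bounded-* : ∀ {x y b d} → Bounded x b → Bounded y d → Bounded (x * y) (b * d)
  bounded-* {x} {y} {b} {d} (l , u) (l′ , u′) =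
    nonNeg-cancel-+ (≤-respʳ
      (solve 4 (λ x y b d → (b :- x) :* (d :+ y) :+ (b :+ x) :* (d :- y) := (b :* d :- x :* y) :+ (b :* d :- x :* y)) refl x y b d)
      (nonNeg-+ (nonNeg-* l u′) (nonNeg-* u l′))) ,
    nonNeg-cancel-+ (≤-respʳ
      (solve 4 (λ x y b d → (b :- x) :* (d :- y) :+ (b :+ x) :* (d :+ y) := (b :* d :+ x :* y) :+ (b :* d :+ x :* y)) refl x y b d)
      (nonNeg-+ (nonNeg-* l l′) (nonNeg-* u u′)))

  bounded-mono : ∀ {x b d} → b ≤ d → Bounded x b → Bounded x d
  bounded-mono {x} {b} {d} b≤d (l , u) =
    ≤-respʳ (solve 3 (λ x b d → (d :- b) :+ (b :- x) := d :- x) refl x b d) (nonNeg-+ (≤⇒0≤- b≤d) l) ,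
    ≤-respʳ (solve 3 (λ x b d → (d :- b) :+ (b :+ x) := d :+ x) refl x b d) (nonNeg-+ (≤⇒0≤- b≤d) u)

  bounded-nonNeg : ∀ {b} → 0# ≤ b → Bounded b b
  bounded-nonNeg {b} 0≤b = ≤-respʳ (sym (-‿inverseʳ b)) (<-irrefl refl) , nonNeg-+ 0≤b 0≤b

  bounded-0 : ∀ {b} → 0# ≤ b → Bounded 0# b
  bounded-0 {b} 0≤b = ≤-respʳ (sym -0≈0) 0≤b , ≤-respʳ (sym (+-identityʳ b)) 0≤b

  bound-nonNeg : ∀ {x b} → Bounded x b → 0# ≤ b
  bound-nonNeg {x} {b} (l , u) = nonNeg-cancel-+ (≤-respʳ (solve 2 (λ x b → b :- x :+ (b :+ x) := b :+ b) refl x b) (nonNeg-+ l u))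

  bounded-cancel-*ˡ : ∀ {k x b} → 0# < k → Bounded (k * x) (k * b) → Bounded x b
  bounded-cancel-*ˡ {k} {x} {b} 0<k (l , u) =
    nonNeg-cancel-*ˡ 0<k (≤-respʳ (solve 3 (λ k x b → k :* b :- k :* x := k :* (b :- x)) refl k x b) l) ,
    nonNeg-cancel-*ˡ 0<k (≤-respʳ (sym (distribˡ k b x)) u)

  bounded-by-ℕ : ∀ x → ∃ λ n → Bounded x (fromℕ n)
  bounded-by-ℕ x =
    let m , x<m  = archimedean x
        n , -x<n = archimedean (- x)
    in m ℕ.+ n ,
    ≤⇒0≤- (≤-trans (<⇒≤ x<m) (fromℕ-mono (ℕ.m≤m+n m n))) ,
    ≤-respʳ (solve 2 (λ x b → b :- :- x := b :+ x) refl x (fromℕ (m ℕ.+ n))) (≤⇒0≤- (≤-trans (<⇒≤ -x<n) (fromℕ-mono (ℕ.m≤n+m n m))))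

  bounded⇒∣-∣< : ∀ {x y b ε} → Bounded (x - y) b → b < ε → ∣ x - y ∣< ε
  bounded⇒∣-∣< {x} {y} {b} (l , u) b<ε =
    ≤-<-trans (0≤-⇒≤ l) b<ε ,
    ≤-<-trans (0≤-⇒≤ (≤-respʳ (solve 3 (λ x y b → b :+ (x :- y) := b :- (y :- x)) refl x y b) u)) b<ε

  -- Limits with a geometric rate

  GeometricLimit : (ℕ → ℝ) → ℝ → ℝ → Set ℓ₂
  GeometricLimit f l D = ∀ n → Bounded (f n - l) (D * ½ ^ n)

  geometric⇒⟶ : ∀ {f l} D → GeometricLimit f l D → f ⟶ l
  geometric⇒⟶ D bound ε 0<ε =
    let N , small = geometric-small D 0<ε
    in N , λ n N≤n → bounded⇒∣-∣< (bound n) (small n N≤n)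

  limit-≮ : ∀ {f k l} → f ⟶ k → f ⟶ l → ¬ (k < l)
  limit-≮ {f} {k} {l} f⟶k f⟶l k<l =
    -- With ε = (l - k)/2, a term within ε of both limits would give l - k < l - k.
    let 0<ε = *-pos (<⇒0<- k<l) ½-pos
        N  , near-k = f⟶k _ 0<ε
        N′ , near-l = f⟶l _ 0<ε
        n = N ℕ.+ N′
    in <-irrefl (sum n) (+-mono-< (proj₁ (near-k n (ℕ.m≤m+n N N′))) (proj₂ (near-l n (ℕ.m≤n+m N′ N))))
    where
    sum : ∀ n → f n - k + (l - f n) ≈ (l - k) * ½ + (l - k) * ½
    sum n = begin
      f n - k + (l - f n)              ≈⟨ solve 3 (λ f k l → f :- k :+ (l :- f) := (l :- k) :* con 1ℤ) refl (f n) k l ⟩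
      (l - k) * 1#                     ≈⟨ *-congˡ ½+½ ⟨
      (l - k) * (½ + ½)                ≈⟨ distribˡ _ _ _ ⟩
      (l - k) * ½ + (l - k) * ½        ∎

  limit-unique : ∀ {f k l} → f ⟶ k → f ⟶ l → k ≈ l
  limit-unique f⟶k f⟶l = ≈-tight (limit-≮ f⟶k f⟶l) (limit-≮ f⟶l f⟶k)

  limit-cong : ∀ {f g l} → (∀ n → f n ≈ g n) → f ⟶ l → g ⟶ l
  limit-cong f≈g f⟶l ε 0<ε =
    let N , near = f⟶l ε 0<ε
    in N , λ n N≤n → <-respˡ (+-congʳ (f≈g n)) (proj₁ (near n N≤n)) ,
                     <-respˡ (+-congˡ (-‿cong (f≈g n))) (proj₂ (near n N≤n))

  limit-≤ : ∀ {f l b N} → (∀ n → N ℕ.≤ n → f n ≤ b) → f ⟶ l → l ≤ b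
  limit-≤ {f} {l} {b} {N} f≤b f⟶l b<l =
    let N′ , near = f⟶l (l - b) (<⇒0<- b<l)
        n = N ℕ.+ N′
    in f≤b n (ℕ.m≤m+n N N′) (0<-⇒< (<-respʳ
         (solve 3 (λ l b f → l :- b :- (l :- f) := f :- b) refl l b (f n))
         (<⇒0<- (proj₂ (near n (ℕ.m≤n+m N′ N))))))

  limit-≥ : ∀ {f l b N} → (∀ n → N ℕ.≤ n → b ≤ f n) → f ⟶ l → b ≤ l
  limit-≥ {f} {l} {b} {N} b≤f f⟶l l<b =
    let N′ , near = f⟶l (b - l) (<⇒0<- l<b)
        n = N ℕ.+ N′
    in b≤f n (ℕ.m≤m+n N N′) (0<-⇒< (<-respʳ
         (solve 3 (λ l b f → b :- l :- (f :- l) := b :- f) refl l b (f n))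
         (<⇒0<- (proj₁ (near n (ℕ.m≤n+m N′ N))))))

  module _ (f : ℕ → ℝ) (D : ℝ) (step : ∀ n → Bounded (f (suc n) - f n) (D * ½ ^ n)) where

    private
      0≤D : 0# ≤ D
      0≤D = ≤-respʳ (*-identityʳ D) (bound-nonNeg (step 0))

      -- The bound is the exact geometric sum of D/2ʲ for n ≤ j < k + n. The subtracted term is kept
      -- because the induction does not close without it.
      telescope : ∀ n k → Bounded (f (k ℕ.+ n) - f n) ((D + D) * ½ ^ n - (D + D) * ½ ^ (k ℕ.+ n))
      telescope n zero    = bounded-cong (sym (-‿inverseʳ _)) (sym (-‿inverseʳ _)) (bounded-0 (<-irrefl refl))
      telescope n (suc k) = bounded-cong
        (solve 3 (λ a b c → b :- c :+ (a :- b) := a :- c) refl (f (suc k ℕ.+ n)) (f (k ℕ.+ n)) (f n))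
        -- The solver does not know that ½ + ½ = 1, so the discrepancy is collected as a multiple of
        -- 1 - (h + h) and removed afterwards.
        (trans (solve 4 (λ p d q h → p :- (d :+ d) :* q :+ d :* q := p :- (d :+ d) :* (h :* q) :+ (con (+ 1) :- (h :+ h)) :* (:- (d :* q))) refl
                 ((D + D) * ½ ^ n) D (½ ^ (k ℕ.+ n)) ½)
          (trans (+-congˡ (trans (*-congʳ (trans (+-congˡ (-‿cong ½+½)) (-‿inverseʳ 1#))) (zeroˡ _))) (+-identityʳ _)))
        (bounded-+ (telescope n k) (step (k ℕ.+ n)))

      tail : ∀ {n m} → n ℕ.≤ m → Bounded (f m - f n) ((D + D) * ½ ^ n)
      tail {n} {m} n≤m = ≡.subst (λ m → Bounded (f m - f n) ((D + D) * ½ ^ n)) (ℕ.m∸n+n≡m n≤m)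
        (bounded-mono (0≤-⇒≤ (≤-respʳ (solve 2 (λ a b → b := a :- (a :- b)) refl ((D + D) * ½ ^ n) ((D + D) * ½ ^ (m ℕ.∸ n ℕ.+ n)))
          (nonNeg-* (nonNeg-+ 0≤D 0≤D) (<⇒≤ (½^-pos (m ℕ.∸ n ℕ.+ n)))))) (telescope n (m ℕ.∸ n)))

      cauchy : IsCauchy f
      cauchy ε 0<ε =
        let N , small = geometric-small (D + D) 0<ε
        in N , λ m n N≤m N≤n → Sum.[
          (λ m≤n → Product.swap (bounded⇒∣-∣< (tail m≤n) (small m N≤m))) ,
          (λ n≤m → bounded⇒∣-∣< (tail n≤m) (small n N≤n)) ]′ (ℕ.≤-total m n)

    -- The bound on `f m - f n` is uniform in m ≥ n, so it survives m → ∞. The constant doubles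
    -- because the sum of 1/2ʲ over j ≥ n is 2/2ⁿ.
    geometric-limit : ∃ λ l → GeometricLimit f l (D + D)
    geometric-limit =
      let l , f⟶l = RealNumbers.complete R f cauchy
      in l , λ n →
      let B = (D + D) * ½ ^ n in
      ≤-respʳ (solve 3 (λ l b f → l :- (f :- b) := b :- (f :- l)) refl l B (f n))
        (≤⇒0≤- (limit-≥ {N = n} (λ m n≤m → 0≤-⇒≤ (≤-respʳ
          (solve 3 (λ m b f → b :+ (m :- f) := m :- (f :- b)) refl (f m) B (f n)) (proj₂ (tail n≤m)))) f⟶l)) ,
      ≤-respʳ (solve 3 (λ l b f → (f :+ b) :- l := b :+ (f :- l)) refl l B (f n))
        (≤⇒0≤- (limit-≤ {N = n} (λ m n≤m → 0≤-⇒≤ (≤-respʳ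
          (solve 3 (λ m b f → b :- (m :- f) := (f :+ b) :- m) refl (f m) B (f n)) (proj₁ (tail n≤m)))) f⟶l))

-- a ^ k / k ! is largest when k = a.
^≤^*! : ∀ a .⦃ _ : NonZero a ⦄ k → a ℕ.^ k ℕ.≤ a ℕ.^ a ℕ.* k !
^≤^*! a zero    = ℕ.≤-trans (ℕ.m^n>0 a a) (ℕ.≤-reflexive (≡.sym (ℕ.*-identityʳ _)))
^≤^*! a (suc k) = Sum.[ large , small ]′ (ℕ.≤-total (suc k) a)
  where
  open ℕ.≤-Reasoning
  large : suc k ℕ.≤ a → a ℕ.^ suc k ℕ.≤ a ℕ.^ a ℕ.* suc k !
  large k<a = ℕ.≤-trans (ℕ.^-monoʳ-≤ a k<a) (ℕ.m≤m*n (a ℕ.^ a) (suc k !) ⦃ ℕ._!≢0 (suc k) ⦄)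
  small : a ℕ.≤ suc k → a ℕ.^ suc k ℕ.≤ a ℕ.^ a ℕ.* suc k !
  small a≤k = begin
    a ℕ.* a ℕ.^ k                     ≤⟨ ℕ.*-mono-≤ a≤k (^≤^*! a k) ⟩
    suc k ℕ.* (a ℕ.^ a ℕ.* k !)       ≡⟨ ℕ.*-assoc (suc k) (a ℕ.^ a) (k !) ⟨
    suc k ℕ.* a ℕ.^ a ℕ.* k !         ≡⟨ ≡.cong (ℕ._* k !) (ℕ.*-comm (suc k) (a ℕ.^ a)) ⟩
    a ℕ.^ a ℕ.* suc k ℕ.* k !         ≡⟨ ℕ.*-assoc (a ℕ.^ a) (suc k) (k !) ⟩
    a ℕ.^ a ℕ.* suc k !               ∎

-- Complex numbers and complex series

module ComplexNumbers {c ℓ₁ ℓ₂} (R : RealNumbers c ℓ₁ ℓ₂) where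

  open RealNumbers R hiding (complete; zero)
  open Analysis R
  open OrderedField R
  open IntegerScalars commutativeRing
  open Solver using (solve; _:=_; _:+_; _:*_; :-_; _:-_; con)

  -- A record version of _≈ᶜ_, from which the two sides can be inferred.
  infix 4 _≋_
  record _≋_ (z w : ℂ) : Set ℓ₁ where
    constructor _,_
    field
      re≈ : re z ≈ re w
      im≈ : im z ≈ im w

  open _≋_ public

  infix 8 -ᶜ_
  -ᶜ_ : ℂ → ℂ
  -ᶜ z = (- re z) +i (- im z)

  complexRing : CommutativeRing c ℓ₁
  complexRing = record
    { Carrier = ℂ ; _≈_ = _≋_ ; _+_ = _+ᶜ_ ; _*_ = _*ᶜ_ ; -_ = -ᶜ_ ; 0# = 0ᶜ ; 1# = 1ᶜ
    ; isCommutativeRing = record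
      { isRing = record
        { +-isAbelianGroup = record
          { isGroup = record
            { isMonoid = record
              { isSemigroup = record
                { isMagma = record
                  { isEquivalence = record
                    { refl  = refl , refl
                    ; sym   = λ (p , q) → sym p , sym q
                    ; trans = λ (p , q) (p′ , q′) → trans p p′ , trans q q′
                    }
                  ; ∙-cong = λ (p , q) (p′ , q′) → +-cong p p′ , +-cong q q′
                  }
                ; assoc = λ (a +i b) (a′ +i b′) (a″ +i b″) → +-assoc a a′ a″ , +-assoc b b′ b″
                }
              ; identity = (λ (a +i b) → +-identityˡ a , +-identityˡ b) , (λ (a +i b) → +-identityʳ a , +-identityʳ b)
              }
            ; inverse = (λ (a +i b) → -‿inverseˡ a , -‿inverseˡ b) , (λ (a +i b) → -‿inverseʳ a , -‿inverseʳ b)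
            ; ⁻¹-cong = λ (p , q) → -‿cong p , -‿cong q
            }
          ; comm = λ (a +i b) (a′ +i b′) → +-comm a a′ , +-comm b b′
          }
        ; *-cong = λ (p , q) (p′ , q′) →
            +-cong (*-cong p p′) (-‿cong (*-cong q q′)) , +-cong (*-cong p q′) (*-cong q p′)
        ; *-assoc = λ (a +i b) (a′ +i b′) (a″ +i b″) →
            solve 6 (λ a b c d e f → (a :* c :- b :* d) :* e :- (a :* d :+ b :* c) :* f
                                   := a :* (c :* e :- d :* f) :- b :* (c :* f :+ d :* e)) refl a b a′ b′ a″ b″ ,
            solve 6 (λ a b c d e f → (a :* c :- b :* d) :* f :+ (a :* d :+ b :* c) :* e
                                   := a :* (c :* f :+ d :* e) :+ b :* (c :* e :- d :* f)) refl a b a′ b′ a″ b″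
        ; *-identity =
            (λ (a +i b) → solve 2 (λ a b → con 1ℤ :* a :- con 0ℤ :* b := a) refl a b ,
                          solve 2 (λ a b → con 1ℤ :* b :+ con 0ℤ :* a := b) refl a b) ,
            (λ (a +i b) → solve 2 (λ a b → a :* con 1ℤ :- b :* con 0ℤ := a) refl a b ,
                          solve 2 (λ a b → a :* con 0ℤ :+ b :* con 1ℤ := b) refl a b)
        ; distrib =
            (λ (a +i b) (a′ +i b′) (a″ +i b″) →
              solve 6 (λ a b c d e f → a :* (c :+ e) :- b :* (d :+ f)
                                     := (a :* c :- b :* d) :+ (a :* e :- b :* f)) refl a b a′ b′ a″ b″ ,
              solve 6 (λ a b c d e f → a :* (d :+ f) :+ b :* (c :+ e)
                                     := (a :* d :+ b :* c) :+ (a :* f :+ b :* e)) refl a b a′ b′ a″ b″) ,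
            (λ (a +i b) (a′ +i b′) (a″ +i b″) →
              solve 6 (λ a b c d e f → (c :+ e) :* a :- (d :+ f) :* b
                                     := (c :* a :- d :* b) :+ (e :* a :- f :* b)) refl a b a′ b′ a″ b″ ,
              solve 6 (λ a b c d e f → (c :+ e) :* b :+ (d :+ f) :* a
                                     := (c :* b :+ d :* a) :+ (e :* b :+ f :* a)) refl a b a′ b′ a″ b″)
        }
      ; *-comm = λ (a +i b) (a′ +i b′) →
          solve 4 (λ a b c d → a :* c :- b :* d := c :* a :- d :* b) refl a b a′ b′ ,
          solve 4 (λ a b c d → a :* d :+ b :* c := c :* b :+ d :* a) refl a b a′ b′
      }
    }

  private
    module ℂR = CommutativeRing complexRing
    module ℂι = IntegerScalars complexRing
    module ℂΣ = ListSums complexRing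

  open CauchyProduct complexRing
  open ℂι.Solver using () renaming (solve to solveᶜ; _:=_ to _:=ᶜ_; _:+_ to _:+ᶜ_; _:*_ to _:*ᶜ_; :-_ to :-ᶜ_; _:-_ to _:-ᶜ_; con to conᶜ)

  ofReal : ℝ → ℂ
  ofReal x = x +i 0#

  ιᶜ : ℤ → ℂ
  ιᶜ = ℂι.ι

  ι-+ᶜ : ∀ n → ιᶜ (+ n) ≋ ofReal (fromℕ n)
  ι-+ᶜ zero    = ℂR.refl
  ι-+ᶜ (suc n) = +-congˡ (re≈ (ι-+ᶜ n)) , trans (+-congˡ (im≈ (ι-+ᶜ n))) (+-identityʳ 0#)

  ιᶜ≋ofReal : ∀ i → ιᶜ i ≋ ofReal (ι i)
  ιᶜ≋ofReal (+ n)    = ι-+ᶜ n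
  ιᶜ≋ofReal -[1+ n ] = -‿cong (re≈ (ι-+ᶜ (suc n))) ,
    trans (-‿cong (im≈ (ι-+ᶜ (suc n)))) (solve 0 (:- con 0ℤ := con 0ℤ) refl)

  BoundedC : ℂ → ℝ → Set ℓ₂
  BoundedC z b = Bounded (re z) b × Bounded (im z) b

  boundedC-cong : ∀ {z w b d} → z ≋ w → b ≈ d → BoundedC z b → BoundedC w d
  boundedC-cong (p , q) b≈d (l , u) = bounded-cong p b≈d l , bounded-cong q b≈d u

  boundedC-+ : ∀ {z w b d} → BoundedC z b → BoundedC w d → BoundedC (z +ᶜ w) (b + d)
  boundedC-+ (p , q) (p′ , q′) = bounded-+ p p′ , bounded-+ q q′

  boundedC-neg : ∀ {z b} → BoundedC z b → BoundedC (-ᶜ z) b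
  boundedC-neg (p , q) = bounded-neg p , bounded-neg q

  -- Real and imaginary parts are bounded separately. Each part of a product combines two real
  -- products, whence the factor 2.
  boundedC-* : ∀ {z w b d} → BoundedC z b → BoundedC w d → BoundedC (z *ᶜ w) (fromℕ 2 * (b * d))
  boundedC-* {b = b} {d} (p , q) (p′ , q′) =
    bounded-cong refl double (bounded-+ (bounded-* p p′) (bounded-neg (bounded-* q q′))) ,
    bounded-cong refl double (bounded-+ (bounded-* p q′) (bounded-* q p′))
    where
    double : b * d + b * d ≈ fromℕ 2 * (b * d)
    double = solve 1 (λ x → x :+ x := con (+ 2) :* x) refl (b * d)

  boundedC-mono : ∀ {z b d} → b ≤ d → BoundedC z b → BoundedC z d
  boundedC-mono b≤d (p , q) = bounded-mono b≤d p , bounded-mono b≤d q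

  boundedC-0 : ∀ {b} → 0# ≤ b → BoundedC 0ᶜ b
  boundedC-0 0≤b = bounded-0 0≤b , bounded-0 0≤b

  boundedC-by-ℕ : ∀ z → ∃ λ n → BoundedC z (fromℕ n)
  boundedC-by-ℕ z =
    let m , p = bounded-by-ℕ (re z)
        n , q = bounded-by-ℕ (im z)
    in m ℕ.+ n , bounded-mono (fromℕ-mono (ℕ.m≤m+n m n)) p , bounded-mono (fromℕ-mono (ℕ.m≤n+m n m)) q

  ½^≤1 : ∀ n → ½ ^ n ≤ 1#
  ½^≤1 n = ≤-respˡ (*-identityˡ _) (≤-respʳ (2^*½^ n) (*-monoʳ-≤ (<⇒≤ (½^-pos n))
    (≤-respˡ ι-1 (fromℕ-mono (ℕ.m^n>0 2 n)))))

  GeometricSum : (ℕ → ℂ) → ℂ → ℝ → Set ℓ₂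
  GeometricSum f z D = ∀ n → BoundedC (partialSum f n +ᶜ -ᶜ z) (D * ½ ^ n)

  -- Unlike convergence itself, geometric convergence is preserved by
  -- sums and products without choosing an index for each ε.
  Converges : (ℕ → ℂ) → ℂ → Set (c ⊔ ℓ₂)
  Converges f z = ∃ (GeometricSum f z)

  converges-cong : ∀ {f g z w} → (∀ k → f k ≋ g k) → z ≋ w → Converges f z → Converges g w
  converges-cong f≋g z≋w (D , bound) = D , λ n →
    boundedC-cong (ℂR.+-cong (partialSum-cong f≋g n) (ℂR.-‿cong z≋w)) refl (bound n)

  converges-+ : ∀ {f g z w} → Converges f z → Converges g w → Converges (λ k → f k +ᶜ g k) (z +ᶜ w)
  converges-+ {f} {g} {z} {w} (D , p) (D′ , q) = D + D′ , λ n → boundedC-cong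
    (ℂR.trans
      (solveᶜ 4 (λ a b z w → (a :-ᶜ z) :+ᶜ (b :-ᶜ w) :=ᶜ (a :+ᶜ b) :-ᶜ (z :+ᶜ w)) ℂR.refl (partialSum f n) (partialSum g n) z w)
      (ℂR.+-congʳ (ℂR.sym (partialSum-+ f g n))))
    (sym (distribʳ _ _ _))
    (boundedC-+ (p n) (q n))

  converges-*ˡ : ∀ a {f z} → Converges f z → Converges (λ k → a *ᶜ f k) (a *ᶜ z)
  converges-*ˡ a {f} {z} (D , p) =
    let A , bound = boundedC-by-ℕ a
    in fromℕ 2 * (fromℕ A * D) , λ n → boundedC-cong
      (ℂR.trans
        (solveᶜ 3 (λ a b z → a :*ᶜ (b :-ᶜ z) :=ᶜ a :*ᶜ b :-ᶜ a :*ᶜ z) ℂR.refl a (partialSum f n) z)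
        (ℂR.+-congʳ (ℂR.sym (partialSum-*ˡ a f n))))
      (solve 3 (λ a d h → con (+ 2) :* (a :* (d :* h)) := con (+ 2) :* (a :* d) :* h) refl (fromℕ A) D (½ ^ n))
      (boundedC-* bound (p n))

  converges-0 : Converges (λ _ → 0ᶜ) 0ᶜ
  converges-0 = 0# , λ n → boundedC-cong (sum≋0 n) (sym (zeroˡ _)) (boundedC-0 (≤-reflexive refl))
    where
    sum≋0 : ∀ n → 0ᶜ ≋ partialSum (λ _ → 0ᶜ) n +ᶜ -ᶜ 0ᶜ
    sum≋0 zero    = ℂR.sym (ℂR.-‿inverseʳ 0ᶜ)
    sum≋0 (suc n) = ℂR.trans (sum≋0 n) (ℂR.+-congʳ (ℂR.sym (ℂR.+-identityʳ _)))

  converges-sum : ∀ {a} {A : Set a} (xs : List A) {f : A → ℕ → ℂ} {z : A → ℂ} → (∀ x → Converges (f x) (z x)) →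
    Converges (λ k → ℂΣ.sumOver xs (λ x → f x k)) (ℂΣ.sumOver xs z)
  converges-sum []       conv = converges-0
  converges-sum (x ∷ xs) conv = converges-+ (conv x) (converges-sum xs conv)

  re-partialSum : ∀ f n → re (partialSum f n) ≡ partialSums (re ∘ f) n
  re-partialSum f zero    = ≡.refl
  re-partialSum f (suc n) = ≡.cong (_+ re (f n)) (re-partialSum f n)

  im-partialSum : ∀ f n → im (partialSum f n) ≡ partialSums (im ∘ f) n
  im-partialSum f zero    = ≡.refl
  im-partialSum f (suc n) = ≡.cong (_+ im (f n)) (im-partialSum f n)

  converges⇒HasSumᶜ : ∀ {f z} → Converges f z → HasSumᶜ f z
  converges⇒HasSumᶜ {f} (D , bound) =
    limit-cong (reflexive ∘ re-partialSum f) (geometric⇒⟶ D (proj₁ ∘ bound)) ,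
    limit-cong (reflexive ∘ im-partialSum f) (geometric⇒⟶ D (proj₂ ∘ bound))

  HasSumᶜ-unique : ∀ {f z w} → HasSumᶜ f z → HasSumᶜ f w → z ≋ w
  HasSumᶜ-unique (p , q) (p′ , q′) = limit-unique p p′ , limit-unique q q′

  converges-unique : ∀ {f z w} → Converges f z → Converges f w → z ≋ w
  converges-unique p q = HasSumᶜ-unique (converges⇒HasSumᶜ p) (converges⇒HasSumᶜ q)

  -- With P and Q the partial sums of f and of conv f g,
  --   P (1 + n) G − Q (1 + n) = f 0 (G − partialSum g (1 + n)) + (P′ n G − Q′ n)
  -- where P′ and Q′ belong to the shifted sequence f ∘ suc.
  cauchy-product-bound : ∀ {g G D′} → GeometricSum g G D′ → 0# ≤ D′ →
    ∀ f {D} → 0# ≤ D → (∀ k → BoundedC (f k) (D * (½ ^ k * ½ ^ k))) →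
    ∀ n → BoundedC (partialSum f n *ᶜ G +ᶜ -ᶜ partialSum (conv f g) n) (fromℕ 4 * (D * D′) * ½ ^ n)
  cauchy-product-bound {g} {G} {D′} g→G 0≤D′ f {D} 0≤D f-bound zero = boundedC-cong
    (solveᶜ 1 (λ G → conᶜ 0ℤ :=ᶜ conᶜ 0ℤ :*ᶜ G :-ᶜ conᶜ 0ℤ) ℂR.refl G) (sym (*-identityʳ _))
    (boundedC-0 (nonNeg-* (fromℕ-nonNeg 4) (nonNeg-* 0≤D 0≤D′)))
  cauchy-product-bound {g} {G} {D′} g→G 0≤D′ f {D} 0≤D f-bound (suc n) = boundedC-cong identity sizes
    (boundedC-+ (boundedC-* (f-bound 0) (boundedC-neg (g→G (suc n))))
      (cauchy-product-bound g→G 0≤D′ (f ∘ suc) {D * (½ * ½)} (nonNeg-* 0≤D (<⇒≤ (*-pos ½-pos ½-pos))) shifted n))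
    where
    shifted : ∀ k → BoundedC (f (suc k)) (D * (½ * ½) * (½ ^ k * ½ ^ k))
    shifted k = boundedC-cong ℂR.refl
      (solve 3 (λ d h p → d :* ((h :* p) :* (h :* p)) := d :* (h :* h) :* (p :* p)) refl D ½ (½ ^ k)) (f-bound (suc k))
    identity : f 0 *ᶜ -ᶜ (partialSum g (suc n) +ᶜ -ᶜ G)
                 +ᶜ (partialSum (f ∘ suc) n *ᶜ G +ᶜ -ᶜ partialSum (conv (f ∘ suc) g) n)
               ≋ partialSum f (suc n) *ᶜ G +ᶜ -ᶜ partialSum (conv f g) (suc n)
    identity = ℂR.trans
      (solveᶜ 5 (λ x p G q r → x :*ᶜ (:-ᶜ (p :-ᶜ G)) :+ᶜ (q :*ᶜ G :-ᶜ r) :=ᶜ (x :+ᶜ q) :*ᶜ G :-ᶜ (x :*ᶜ p :+ᶜ r)) ℂR.refl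
        (f 0) (partialSum g (suc n)) G (partialSum (f ∘ suc) n) (partialSum (conv (f ∘ suc) g) n))
      (ℂR.+-cong (ℂR.*-congʳ (ℂR.sym (partialSum-suc f n))) (ℂR.-‿cong (ℂR.sym (partialSum-conv-suc f g n))))
    -- Head and remainder contribute equally. The head gives 2DD′/2ⁿ⁺¹; the shifted sequence has the
    -- constant D/4, so it gives 4(D/4)D′/2ⁿ, which is the same number.
    sizes : fromℕ 2 * (D * (1# * 1#) * (D′ * (½ * ½ ^ n))) + fromℕ 4 * (D * (½ * ½) * D′) * ½ ^ n
            ≈ fromℕ 4 * (D * D′) * (½ * ½ ^ n)
    sizes = trans
      (solve 4 (λ d e h p → con (+ 2) :* (d :* (con 1ℤ :* con 1ℤ) :* (e :* (h :* p))) :+ con (+ 4) :* (d :* (h :* h) :* e) :* p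
                         := con (+ 2) :* (d :* e) :* (h :* p) :* (con 1ℤ :+ (h :+ h))) refl D D′ ½ (½ ^ n))
      (trans (*-congˡ (+-congˡ ½+½))
        (solve 3 (λ d e p → con (+ 2) :* (d :* e) :* p :* (con 1ℤ :+ con 1ℤ) := con (+ 4) :* (d :* e) :* p) refl D D′ (½ * ½ ^ n)))

  -- Mertens' theorem with rates. With P and Q the partial sums of `f` and `conv f g`, Q - FG = (P -
  -- F)G - (PG - Q), and `cauchy-product-bound` controls the last bracket.
  converges-conv : ∀ {f F g G D} → 0# ≤ D → (∀ k → BoundedC (f k) (D * (½ ^ k * ½ ^ k))) →
    Converges f F → Converges g G → Converges (conv f g) (F *ᶜ G)
  converges-conv {f} {F} {g} {G} {D} 0≤D f-bound (A , f→F) (B , g→G) =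
    let C , G-bound = boundedC-by-ℕ G
        0≤B = ≤-respʳ (*-identityʳ B) (bound-nonNeg (proj₁ (g→G 0)))
    in fromℕ 2 * (A * fromℕ C) + fromℕ 4 * (D * B) , λ n → boundedC-cong
      (solveᶜ 4 (λ p F G q → (p :-ᶜ F) :*ᶜ G :+ᶜ (:-ᶜ (p :*ᶜ G :-ᶜ q)) :=ᶜ q :-ᶜ F :*ᶜ G) ℂR.refl
        (partialSum f n) F G (partialSum (conv f g) n))
      (solve 5 (λ a c d b h → con (+ 2) :* (a :* h :* c) :+ con (+ 4) :* (d :* b) :* h
                           := (con (+ 2) :* (a :* c) :+ con (+ 4) :* (d :* b)) :* h) refl A (fromℕ C) D B (½ ^ n))
      (boundedC-+ (boundedC-* (f→F n) G-bound) (boundedC-neg (cauchy-product-bound g→G 0≤B f 0≤D f-bound n)))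

-- The exponential of an imaginary number

module Exponential {c ℓ₁ ℓ₂} (R : RealNumbers c ℓ₁ ℓ₂) where

  open RealNumbers R hiding (complete; zero)
  open Analysis R
  open OrderedField R
  open ComplexNumbers R
  open IntegerScalars commutativeRing
  open Solver using (solve; _:=_; _:+_; _:*_; :-_; _:-_; con)
  open CauchyProduct complexRing

  private
    module ℂR = CommutativeRing complexRing
    module ℂι = IntegerScalars complexRing

  open Algebra.Properties.Semiring.Exp ℂR.semiring using () renaming (_^_ to _^ᶜ_)
  open ℂι.Solver using () renaming (solve to solveᶜ; _:=_ to _:=ᶜ_; _:*_ to _:*ᶜ_; :-_ to :-ᶜ_; _:-_ to _:-ᶜ_; con to conᶜ)

  !*1/! : ∀ k → fromℕ (k !) * 1/ k ! ≈ 1#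
  !*1/! k = trans (*-comm _ _) (trans (*-congʳ (*-identityˡ _)) (recip-inverse (0<fromℕ (k !) ⦃ k ℕ.!≢0 ⦄)))

  invFactorial : ℕ → ℂ
  invFactorial k = 1/ k ! +i 0#

  !*invFactorial : ∀ k → ιᶜ (+ (k !)) *ᶜ invFactorial k ≋ 1ᶜ
  !*invFactorial k = ℂR.trans (ℂR.*-congʳ (ι-+ᶜ (k !)))
    ( trans (solve 2 (λ f w → f :* w :- con 0ℤ :* con 0ℤ := f :* w) refl (fromℕ (k !)) (1/ k !)) (!*1/! k)
    , solve 2 (λ f w → f :* con 0ℤ :+ con 0ℤ :* w := con 0ℤ) refl (fromℕ (k !)) (1/ k !) )

  open DividedPowers complexRing invFactorial !*invFactorial

  expTerm : ℝ → ℕ → ℂ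
  expTerm θ = dividedPower (0# +i θ)

  -- A purely imaginary factor only exchanges the two parts, up to sign. The general product bound
  -- would bring a factor 2 here, hence 2ᵏ for the k-th power.
  boundedC-i* : ∀ {θ d z b} → Bounded θ d → BoundedC z b → BoundedC ((0# +i θ) *ᶜ z) (d * b)
  boundedC-i* {θ} {z = z} θ-bound (p , q) =
    bounded-cong (solve 3 (λ t x y → :- (t :* y) := con 0ℤ :* x :- t :* y) refl θ (re z) (im z)) refl
      (bounded-neg (bounded-* θ-bound q)) ,
    bounded-cong (solve 3 (λ t x y → t :* x := con 0ℤ :* y :+ t :* x) refl θ (re z) (im z)) refl
      (bounded-* θ-bound p)

  boundedC-i^ : ∀ {θ d} → Bounded θ d → ∀ k → BoundedC ((0# +i θ) ^ᶜ k) (d ^ k)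
  boundedC-i^ θ-bound zero    = bounded-nonNeg (<⇒≤ 0<1) , bounded-0 (<⇒≤ 0<1)
  boundedC-i^ θ-bound (suc k) = boundedC-i* θ-bound (boundedC-i^ θ-bound k)

  fromℕ-^ : ∀ a q k → (fromℕ a * (q * q)) ^ k ≈ fromℕ (a ℕ.^ k) * (q ^ k * q ^ k)
  fromℕ-^ a q zero    = trans (solve 0 (con 1ℤ := con 1ℤ :* (con 1ℤ :* con 1ℤ)) refl) (*-congʳ (sym ι-1))
  fromℕ-^ a q (suc k) = trans (*-congˡ (fromℕ-^ a q k)) (trans
    (solve 4 (λ a q b p → a :* (q :* q) :* (b :* (p :* p)) := a :* b :* (q :* p :* (q :* p))) refl (fromℕ a) q (fromℕ (a ℕ.^ k)) (q ^ k))
    (*-congʳ (sym (fromℕ-* a (a ℕ.^ k)))))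

  -- For a natural number a ≥ 4|θ|, `^≤^*!` gives |θ|ᵏ ≤ aᵏ/4ᵏ ≤ aᵃ k!/4ᵏ. Division by k! leaves the
  -- constant D = aᵃ.
  expTerm-bound : ∀ θ → ∃ λ D → 0# ≤ D × ∀ k → BoundedC (expTerm θ k) (D * (½ ^ k * ½ ^ k))
  expTerm-bound θ = fromℕ (a ℕ.^ a) , fromℕ-nonNeg (a ℕ.^ a) , bound
    where
    m a : ℕ
    m = proj₁ (bounded-by-ℕ (fromℕ 4 * θ))
    -- The successor makes `a` nonzero, as `^≤^*!` requires.
    a = suc m

    4θ-bound : Bounded (fromℕ 4 * θ) (fromℕ a)
    4θ-bound = bounded-mono (fromℕ-mono (ℕ.n≤1+n m)) (proj₂ (bounded-by-ℕ (fromℕ 4 * θ)))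

    θ-bound : Bounded θ (fromℕ a * (½ * ½))
    θ-bound = bounded-cong
      (trans (solve 2 (λ t h → (con (+ 4) :* t) :* (h :* h) := (h :+ h) :* (h :+ h) :* t) refl θ ½)
        (trans (*-congʳ (*-cong ½+½ ½+½)) (trans (*-congʳ (*-identityˡ 1#)) (*-identityˡ θ))))
      refl
      (bounded-* 4θ-bound (bounded-nonNeg (<⇒≤ (*-pos ½-pos ½-pos))))

    power-bound : ∀ k → BoundedC ((0# +i θ) ^ᶜ k) (fromℕ (k !) * (fromℕ (a ℕ.^ a) * (½ ^ k * ½ ^ k)))
    power-bound k = boundedC-cong ℂR.refl
      (trans (*-congʳ (trans (reflexive (≡.cong fromℕ (ℕ.*-comm (a ℕ.^ a) (k !)))) (fromℕ-* (k !) (a ℕ.^ a)))) (*-assoc _ _ _))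
      (boundedC-mono (*-monoʳ-≤ (<⇒≤ (*-pos (½^-pos k) (½^-pos k))) (fromℕ-mono (^≤^*! a k)))
        (boundedC-cong ℂR.refl (fromℕ-^ a ½ k) (boundedC-i^ θ-bound k)))

    cancel : ∀ k x → x ≈ fromℕ (k !) * (1/ k ! * x)
    cancel k x = trans (sym (*-identityˡ x)) (trans (*-congʳ (sym (!*1/! k))) (*-assoc _ _ _))

    bound : ∀ k → BoundedC (expTerm θ k) (fromℕ (a ℕ.^ a) * (½ ^ k * ½ ^ k))
    bound k =
      bounded-cong (solve 3 (λ w x y → w :* x := w :* x :- con 0ℤ :* y) refl (1/ k !) (re z) (im z)) refl
        (bounded-cancel-*ˡ (0<fromℕ (k !) ⦃ k ℕ.!≢0 ⦄) (bounded-cong (cancel k (re z)) refl (proj₁ (power-bound k)))) ,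
      bounded-cong (solve 3 (λ w x y → w :* y := w :* y :+ con 0ℤ :* x) refl (1/ k !) (re z) (im z)) refl
        (bounded-cancel-*ˡ (0<fromℕ (k !) ⦃ k ℕ.!≢0 ⦄) (bounded-cong (cancel k (im z)) refl (proj₂ (power-bound k))))
      where z = (0# +i θ) ^ᶜ k

  module _ (θ : ℝ) where

    private
      D : ℝ
      D = proj₁ (expTerm-bound θ)

      step : ∀ n → BoundedC (expTerm θ n) (D * ½ ^ n)
      step n = boundedC-mono (0≤-⇒≤ (≤-respʳ
        (solve 2 (λ d p → d :* ((con 1ℤ :- p) :* p) := d :* p :- d :* (p :* p)) refl D (½ ^ n))
        (nonNeg-* (proj₁ (proj₂ (expTerm-bound θ))) (nonNeg-* (≤⇒0≤- (½^≤1 n)) (<⇒≤ (½^-pos n))))))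
        (proj₂ (proj₂ (expTerm-bound θ)) n)

      re-step : ∀ n → Bounded (re (partialSum (expTerm θ) (suc n)) - re (partialSum (expTerm θ) n)) (D * ½ ^ n)
      re-step n = bounded-cong (solve 2 (λ p x → x := p :+ x :- p) refl (re (partialSum (expTerm θ) n)) (re (expTerm θ n))) refl (proj₁ (step n))

      im-step : ∀ n → Bounded (im (partialSum (expTerm θ) (suc n)) - im (partialSum (expTerm θ) n)) (D * ½ ^ n)
      im-step n = bounded-cong (solve 2 (λ p x → x := p :+ x :- p) refl (im (partialSum (expTerm θ) n)) (im (expTerm θ n))) refl (proj₂ (step n))

    abstract
      -- The number e^{iθ}. Opaque: its properties are all obtained from `expI-sum` and the
      -- uniqueness of sums.
      expI : ℂ
      expI = proj₁ (geometric-limit _ D re-step) +i proj₁ (geometric-limit _ D im-step)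

      expI-sum : Converges (expTerm θ) expI
      expI-sum = D + D , λ n → proj₂ (geometric-limit _ D re-step) n , proj₂ (geometric-limit _ D im-step) n

  expI-cong : ∀ {θ φ} → θ ≈ φ → expI θ ≋ expI φ
  expI-cong {θ} {φ} θ≈φ = converges-unique
    (converges-cong (dividedPower-cong (refl , θ≈φ)) ℂR.refl (expI-sum θ)) (expI-sum φ)

  -- The Cauchy product of the two series converges to the product of their sums, and by the
  -- binomial theorem its terms are those of the series for θ + φ.
  expI-+ : ∀ θ φ → expI (θ + φ) ≋ expI θ *ᶜ expI φ
  expI-+ θ φ =
    let D , 0≤D , bound = expTerm-bound θ
    in converges-unique (expI-sum (θ + φ)) (converges-cong
         (λ k → ℂR.trans (conv-dividedPower (0# +i θ) (0# +i φ) k) (dividedPower-cong (+-identityˡ 0# , refl) k))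
         ℂR.refl (converges-conv 0≤D bound (expI-sum θ) (expI-sum φ)))

  expI-0 : expI 0# ≋ 1ᶜ
  -- Only the empty partial sum differs from 1, and it differs by 1; so the constant 1 is a rate.
  expI-0 = converges-unique (expI-sum 0#) (1# , λ
    { zero    → boundedC-cong (solveᶜ 0 (:-ᶜ (conᶜ 1ℤ) :=ᶜ conᶜ 0ℤ :-ᶜ conᶜ 1ℤ) ℂR.refl) (sym (*-identityˡ 1#))
                  (boundedC-neg (bounded-nonNeg (<⇒≤ 0<1) , bounded-0 (<⇒≤ 0<1)))
    ; (suc n) → boundedC-cong (ℂR.sym (ℂR.trans (ℂR.+-congʳ (sum≋1 n)) (ℂR.-‿inverseʳ 1ᶜ))) refl
                  (boundedC-0 (nonNeg-* (<⇒≤ 0<1) (<⇒≤ (½^-pos (suc n)))))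
    })
    where
    sum≋1 : ∀ n → partialSum (expTerm 0#) (suc n) ≋ 1ᶜ
    sum≋1 zero    = ℂR.trans (ℂR.+-identityˡ _) (ℂR.trans (ℂR.*-identityʳ _) w0≈1)
    sum≋1 (suc n) = ℂR.trans (ℂR.+-cong (sum≋1 n)
      (solveᶜ 2 (λ w z → w :*ᶜ (conᶜ 0ℤ :*ᶜ z) :=ᶜ conᶜ 0ℤ) ℂR.refl (invFactorial (suc n)) ((0# +i 0#) ^ᶜ n))) (ℂR.+-identityʳ 1ᶜ)

  -- Conjugation, modulus and the sine series

  conj : ℂ → ℂ
  conj z = re z +i (- im z)

  conj-* : ∀ z w → conj (z *ᶜ w) ≋ conj z *ᶜ conj w
  conj-* (a +i b) (a′ +i b′) =
    solve 4 (λ a b c d → a :* c :- b :* d := a :* c :- (:- b) :* (:- d)) refl a b a′ b′ ,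
    solve 4 (λ a b c d → :- (a :* d :+ b :* c) := a :* (:- d) :+ (:- b) :* c) refl a b a′ b′

  conj-cong : ∀ {z w} → z ≋ w → conj z ≋ conj w
  conj-cong (p , q) = p , -‿cong q

  conj-power : ∀ θ k → conj ((0# +i θ) ^ᶜ k) ≋ (0# +i (- θ)) ^ᶜ k
  conj-power θ zero    = refl , solve 0 (:- con 0ℤ := con 0ℤ) refl
  conj-power θ (suc k) = ℂR.trans (conj-* (0# +i θ) ((0# +i θ) ^ᶜ k)) (ℂR.*-congˡ (conj-power θ k))

  conj-expTerm : ∀ θ k → conj (expTerm θ k) ≋ expTerm (- θ) k
  conj-expTerm θ k = ℂR.trans (conj-* (invFactorial k) ((0# +i θ) ^ᶜ k))
    (ℂR.*-cong (refl , solve 0 (:- con 0ℤ := con 0ℤ) refl) (conj-power θ k))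

  converges-conj : ∀ {f z} → Converges f z → Converges (conj ∘ f) (conj z)
  converges-conj {f} {z} (D , bound) = D , λ n → boundedC-cong
    (ℂR.trans
      (refl , solve 2 (λ a b → :- (a :- b) := :- a :- :- b) refl (im (partialSum f n)) (im z))
      (ℂR.+-congʳ (ℂR.sym (conj-partialSum n))))
    refl (proj₁ (bound n) , bounded-neg (proj₂ (bound n)))
    where
    conj-partialSum : ∀ n → partialSum (conj ∘ f) n ≋ conj (partialSum f n)
    conj-partialSum zero    = refl , solve 0 (con 0ℤ := :- con 0ℤ) refl
    conj-partialSum (suc n) = ℂR.trans (ℂR.+-congʳ (conj-partialSum n))
      (refl , solve 2 (λ a b → :- a :+ :- b := :- (a :+ b)) refl (im (partialSum f n)) (im (f n)))

  expI-neg : ∀ θ → expI (- θ) ≋ conj (expI θ)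
  expI-neg θ = converges-unique (expI-sum (- θ)) (converges-cong (conj-expTerm θ) ℂR.refl (converges-conj (expI-sum θ)))

  expI-*-neg : ∀ θ → expI θ *ᶜ expI (- θ) ≋ 1ᶜ
  expI-*-neg θ = ℂR.trans (ℂR.sym (expI-+ θ (- θ))) (ℂR.trans (expI-cong (-‿inverseʳ θ)) expI-0)

  ∣expI∣²≈1 : ∀ θ → ∣ expI θ ∣² ≈ 1#
  ∣expI∣²≈1 θ = trans
    (solve 2 (λ a b → a :* a :+ b :* b := a :* a :- b :* (:- b)) refl (re (expI θ)) (im (expI θ)))
    (re≈ (ℂR.trans (ℂR.*-congˡ (ℂR.sym (expI-neg θ))) (expI-*-neg θ)))

  power-even : ∀ θ k → (0# +i θ) ^ᶜ (2 ℕ.* k) ≋ ofReal ((- 1#) ^ k * θ ^ (2 ℕ.* k))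
  power-even θ zero    = sym (*-identityˡ 1#) , refl
  power-even θ (suc k) = ≡.subst (λ n → (0# +i θ) ^ᶜ n ≋ ofReal ((- 1#) ^ suc k * θ ^ n)) (≡.sym (ℕ.*-suc 2 k))
    (ℂR.trans (ℂR.*-congˡ (ℂR.*-congˡ (power-even θ k)))
      ( solve 3 (λ t s p → con 0ℤ :* (con 0ℤ :* (s :* p) :- t :* con 0ℤ) :- t :* (con 0ℤ :* con 0ℤ :+ t :* (s :* p))
                        := (:- con 1ℤ) :* s :* (t :* (t :* p))) refl θ ((- 1#) ^ k) (θ ^ (2 ℕ.* k))
      , solve 3 (λ t s p → con 0ℤ :* (con 0ℤ :* con 0ℤ :+ t :* (s :* p)) :+ t :* (con 0ℤ :* (s :* p) :- t :* con 0ℤ)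
                        := con 0ℤ) refl θ ((- 1#) ^ k) (θ ^ (2 ℕ.* k)) ))

  im-expTerm-even : ∀ θ k → im (expTerm θ (2 ℕ.* k)) ≈ 0#
  im-expTerm-even θ k = trans (im≈ (ℂR.*-congˡ {invFactorial (2 ℕ.* k)} (power-even θ k)))
    (solve 2 (λ w x → w :* con 0ℤ :+ con 0ℤ :* x := con 0ℤ) refl (1/ (2 ℕ.* k) !) ((- 1#) ^ k * θ ^ (2 ℕ.* k)))

  im-expTerm-odd : ∀ θ k → im (expTerm θ (suc (2 ℕ.* k))) ≈ (- 1#) ^ k * θ ^ suc (2 ℕ.* k) * 1/ (suc (2 ℕ.* k)) !
  im-expTerm-odd θ k = trans (im≈ (ℂR.*-congˡ {invFactorial (suc (2 ℕ.* k))} (ℂR.*-congˡ (power-even θ k))))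
    (solve 4 (λ w t s p → w :* (con 0ℤ :* con 0ℤ :+ t :* (s :* p)) :+ con 0ℤ :* (con 0ℤ :* (s :* p) :- t :* con 0ℤ)
                       := s :* (t :* p) :* w) refl (1/ (suc (2 ℕ.* k)) !) θ ((- 1#) ^ k) (θ ^ (2 ℕ.* k)))

  sinTerm : ℝ → ℕ → ℝ
  sinTerm θ k = (- 1#) ^ k * θ ^ suc (2 ℕ.* k) * 1/ (suc (2 ℕ.* k)) !

  -- Terms are taken two at a time: the even one is real, the odd one contributes a term of the
  -- sine. The sine's partial sums thus form a subsequence of the imaginary parts.
  im-partialSum-even : ∀ θ n → im (partialSum (expTerm θ) (2 ℕ.* n)) ≈ partialSums (sinTerm θ) n
  im-partialSum-even θ zero    = refl
  im-partialSum-even θ (suc n) = ≡.subst (λ m → im (partialSum (expTerm θ) m) ≈ partialSums (sinTerm θ) (suc n)) (≡.sym (ℕ.*-suc 2 n))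
    (+-cong (trans (+-cong (im-partialSum-even θ n) (im-expTerm-even θ n)) (+-identityʳ _)) (im-expTerm-odd θ n))

  expI-isSin : ∀ θ → IsSin θ (im (expI θ))
  expI-isSin θ = limit-cong (im-partialSum-even θ)
    λ ε 0<ε →
      let D , bound = expI-sum θ
          M , near = geometric⇒⟶ D (proj₂ ∘ bound) ε 0<ε
      in M , λ n M≤n → near (2 ℕ.* n) (ℕ.≤-trans M≤n (ℕ.m≤n*m n 2))

  isSin-unique : ∀ {θ s} → IsSin θ s → im (expI θ) ≈ s
  isSin-unique {θ} = limit-unique (expI-isSin θ)

-- The periods of the exponential

module Periodicity {c ℓ₁ ℓ₂} (R : RealNumbers c ℓ₁ ℓ₂) (pi : Analysis.Pi R) where

  open RealNumbers R hiding (complete; zero)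
  open Analysis R
  open Analysis.Pi pi
  open OrderedField R
  open ComplexNumbers R
  open Exponential R
  open IntegerScalars commutativeRing
  open Solver using (solve; _:=_; _:+_; _:*_; :-_; _:-_; con)
  open Relation.Binary.Reasoning.Setoid setoid

  private module ℂR = CommutativeRing complexRing

  double-cancel : ∀ {x} → x + x ≈ 0# → x ≈ 0#
  double-cancel {x} x+x≈0 = begin
    x                 ≈⟨ *-identityʳ x ⟨
    x * 1#            ≈⟨ *-congˡ ½+½ ⟨
    x * (½ + ½)       ≈⟨ solve 2 (λ x h → x :* (h :+ h) := (x :+ x) :* h) refl x ½ ⟩
    (x + x) * ½       ≈⟨ *-congʳ x+x≈0 ⟩
    0# * ½            ≈⟨ zeroˡ ½ ⟩
    0#                ∎

  halves : ∀ x → x * ½ + x * ½ ≈ x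
  halves x = trans (sym (distribˡ x ½ ½)) (trans (*-congˡ ½+½) (*-identityʳ x))

  -- Since sin π = 0 and e^{iπ} has modulus 1, the square of e^{iπ} is cos² π = 1.
  expI-2π : expI 2π ≋ 1ᶜ
  expI-2π = ℂR.trans (expI-cong (solve 1 (λ p → con (+ 2) :* p := p :+ p) refl π))
    (ℂR.trans (expI-+ π π) (cos²≈1 , trans (+-cong (*-congˡ im≈0) (*-congʳ im≈0)) (trans (+-cong (zeroʳ _) (zeroˡ _)) (+-identityˡ 0#))))
    where
    e = expI π
    im≈0 : im e ≈ 0#
    im≈0 = isSin-unique sin-π
    cos²≈1 : re e * re e - im e * im e ≈ 1#
    cos²≈1 = begin
      re e * re e - im e * im e                      ≈⟨ solve 2 (λ a b → a :* a :- b :* b := a :* a :+ b :* b :- (b :+ b) :* b) refl (re e) (im e) ⟩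
      ∣ e ∣² - (im e + im e) * im e                  ≈⟨ +-cong (∣expI∣²≈1 π) (-‿cong (trans (*-congˡ im≈0) (zeroʳ _))) ⟩
      1# - 0#                                        ≈⟨ -0≈0 ⟩
      1#                                             ∎

  expI-2πℕ : ∀ n → expI (2π * fromℕ n) ≋ 1ᶜ
  expI-2πℕ zero    = ℂR.trans (expI-cong (zeroʳ 2π)) expI-0
  expI-2πℕ (suc n) = ℂR.trans (expI-cong (trans (distribˡ _ _ _) (+-congʳ (*-identityʳ 2π))))
    (ℂR.trans (expI-+ 2π (2π * fromℕ n)) (ℂR.trans (ℂR.*-cong expI-2π (expI-2πℕ n)) (ℂR.*-identityˡ 1ᶜ)))

  expI-2πℤ : ∀ k → expI (2π * ι k) ≋ 1ᶜ
  expI-2πℤ (+ n)    = expI-2πℕ n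
  expI-2πℤ -[1+ n ] = ℂR.trans (expI-cong (solve 2 (λ p x → p :* :- x := :- (p :* x)) refl 2π (fromℕ (suc n))))
    (ℂR.trans (expI-neg (2π * fromℕ (suc n))) (ℂR.trans (conj-cong (expI-2πℕ (suc n)))
      (refl , solve 0 (:- con 0ℤ := con 0ℤ) refl)))

  -- By the half-angle formula sin (θ/2) = 0, where 0 < θ/2 < π.
  expI≋1⇒≮2π : ∀ {θ} → expI θ ≋ 1ᶜ → 0# < θ → ¬ (θ < 2π)
  expI≋1⇒≮2π {θ} eθ≋1 0<θ θ<2π = minimal ψ (*-pos 0<θ ½-pos) ψ<π
    λ ε 0<ε →
      let M , near = expI-isSin ψ ε 0<ε
      in M , λ n M≤n → <-respˡ (+-congˡ (-‿cong sin≈0)) (proj₁ (near n M≤n)) ,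
                       <-respˡ (+-congʳ sin≈0) (proj₂ (near n M≤n))
    where
    ψ = θ * ½
    e = expI ψ
    ψ<π : ψ < π
    ψ<π = <-respʳ (trans (solve 2 (λ p h → con (+ 2) :* p :* h := p :* (h :+ h)) refl π ½) (trans (*-congˡ ½+½) (*-identityʳ π)))
      (*-monoʳ-< ½-pos θ<2π)
    cos-θ : re e * re e - im e * im e ≈ 1#
    cos-θ = re≈ (ℂR.trans (ℂR.sym (expI-+ ψ ψ)) (ℂR.trans (expI-cong (halves θ)) eθ≋1))
    sin≈0 : im e ≈ 0#
    sin≈0 = square-zero (double-cancel (begin
      im e * im e + im e * im e                              ≈⟨ solve 2 (λ a b → b :* b :+ b :* b := a :* a :+ b :* b :- (a :* a :- b :* b)) refl (re e) (im e) ⟩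
      ∣ e ∣² - (re e * re e - im e * im e)                   ≈⟨ +-cong (∣expI∣²≈1 ψ) (-‿cong cos-θ) ⟩
      1# - 1#                                                ≈⟨ -‿inverseʳ 1# ⟩
      0#                                                     ∎))

  expI≋1⇒≈0 : ∀ {θ} → expI θ ≋ 1ᶜ → θ < 2π → - θ < 2π → θ ≈ 0#
  expI≋1⇒≈0 {θ} eθ≋1 θ<2π -θ<2π = ≈-tight
    (λ θ<0 → expI≋1⇒≮2π (ℂR.trans (expI-neg θ) (ℂR.trans (conj-cong eθ≋1) (refl , solve 0 (:- con 0ℤ := con 0ℤ) refl)))
               (neg-pos θ<0) -θ<2π)
    (λ 0<θ → expI≋1⇒≮2π eθ≋1 0<θ θ<2π)

  -- A floor would require deciding the order. The intervals (k - 1, k + 1) overlap, so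
  -- cotransitivity can choose one, and distance below 1 is enough because 0 is the only period
  -- strictly between -2π and 2π.
  NearInteger : ℝ → Set ℓ₂
  NearInteger y = ∃ λ k → y - ι k < 1# × ι k - y < 1#

  between⇒near-integer : ∀ y j → ι j - 1# < y → y < ι j + fromℕ 1 → NearInteger y
  between⇒near-integer y j j-1<y y<j+1 = j ,
    0<-⇒< (<-respʳ (solve 2 (λ y j → j :+ (con 1ℤ :+ con 0ℤ) :- y := con 1ℤ :- (y :- j)) refl y (ι j)) (<⇒0<- y<j+1)) ,
    0<-⇒< (<-respʳ (solve 2 (λ y j → y :- (j :- con 1ℤ) := con 1ℤ :- (j :- y)) refl y (ι j)) (<⇒0<- j-1<y))

  -- An upward search with `m` steps left. Cotransitivity at j < j + 1 yields either j < y, and the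
  -- search moves on to j + 1, or y < j + 1, and j is near.
  near-integer-from : ∀ y m j → ι j - 1# < y → y < ι j + fromℕ (suc m) → NearInteger y
  near-integer-from y zero    j j-1<y y<j+1   = between⇒near-integer y j j-1<y y<j+1
  near-integer-from y (suc m) j j-1<y y<j+m+2 = Sum.[ next , between⇒near-integer y j j-1<y ]′
    (<-cotrans (0<-⇒< {ι j} {ι j + fromℕ 1} (<-respʳ (solve 1 (λ j → con 1ℤ := j :+ (con 1ℤ :+ con 0ℤ) :- j) refl (ι j)) 0<1)) y)
    where
    next : ι j < y → NearInteger y
    next j<y = near-integer-from y m (j ℤ.+ 1ℤ)
      (<-respˡ (trans (solve 1 (λ j → j := j :+ (con 1ℤ :+ con 0ℤ) :- con 1ℤ) refl (ι j)) (+-congʳ (sym (ι-+ j 1ℤ)))) j<y)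
      (<-respʳ (trans (solve 2 (λ j n → j :+ (con 1ℤ :+ n) := j :+ (con 1ℤ :+ con 0ℤ) :+ n) refl (ι j) (fromℕ (suc m))) (+-congʳ (sym (ι-+ j 1ℤ)))) y<j+m+2)

  near-integer : ∀ y → NearInteger y
  near-integer y =
    let n , 0≤n-y , 0≤n+y = bounded-by-ℕ y
    -- The search starts at -n, where n ≥ |y|; its window ends at -n + (2n + 1) = n + 1, which lies
    -- above y.
    in near-integer-from y (n ℕ.+ n) (ℤ.- + n)
      (0<-⇒< (<-respʳ
        (trans (solve 2 (λ y n → con 1ℤ :+ (n :+ y) := y :- (:- n :- con 1ℤ)) refl y (fromℕ n)) (+-congˡ (-‿cong (+-congʳ (sym (ι-neg (+ n)))))))
        (<-respˡ (+-identityˡ 0#) (pos-nonNeg-+ 0<1 0≤n+y))))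
      (0<-⇒< (<-respʳ
        (trans (solve 2 (λ y n → con 1ℤ :+ (n :- y) := :- n :+ (con 1ℤ :+ (n :+ n)) :- y) refl y (fromℕ n))
          (+-congʳ (+-cong (sym (ι-neg (+ n))) (+-congˡ (sym (ι-+ (+ n) (+ n)))))))
        (<-respˡ (+-identityˡ 0#) (pos-nonNeg-+ 0<1 0≤n-y))))
    where
    pos-nonNeg-+ : ∀ {x y} → 0# < x → 0# ≤ y → 0# + 0# < x + y
    pos-nonNeg-+ {x} {y} 0<x 0≤y = <-respˡ (sym (+-identityˡ 0#))
      (<-≤-trans 0<x (0≤-⇒≤ (≤-respʳ (solve 2 (λ x y → y := x :+ y :- x) refl x y) 0≤y)))

  -- Subtracting 2πk leaves a period strictly between -2π and 2π, which has to vanish.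
  near-multiple : ∀ {θ y} k → expI θ ≋ 1ᶜ → θ ≈ y * 2π → y - ι k < 1# → ι k - y < 1# → θ ≈ 2π * ι k
  near-multiple {θ} {y} k eθ≋1 θ≈2πy y-k<1 k-y<1 = begin
    θ                              ≈⟨ solve 2 (λ t q → t := t :- q :+ q) refl θ (2π * ι k) ⟩
    θ - 2π * ι k + 2π * ι k        ≈⟨ +-congʳ φ≈0 ⟩
    0# + 2π * ι k                  ≈⟨ +-identityˡ (2π * ι k) ⟩
    2π * ι k                       ∎
    where
    scaled : (y - ι k) * 2π ≈ θ - 2π * ι k
    scaled = trans (solve 3 (λ y k p → (y :- k) :* p := y :* p :- p :* k) refl y (ι k) 2π) (+-congʳ (sym θ≈2πy))
    e[-2πk]≋1 : expI (- (2π * ι k)) ≋ 1ᶜ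
    e[-2πk]≋1 = ℂR.trans (ℂR.sym (ℂR.*-identityˡ (expI (- (2π * ι k)))))
      (ℂR.trans (ℂR.*-congʳ (ℂR.sym (expI-2πℤ k))) (expI-*-neg (2π * ι k)))
    eφ≋1 : expI (θ - 2π * ι k) ≋ 1ᶜ
    eφ≋1 = ℂR.trans (expI-+ θ (- (2π * ι k))) (ℂR.trans (ℂR.*-cong eθ≋1 e[-2πk]≋1) (ℂR.*-identityˡ 1ᶜ))
    φ≈0 : θ - 2π * ι k ≈ 0#
    φ≈0 = expI≋1⇒≈0 eφ≋1
      (<-respˡ scaled (<-respʳ (*-identityˡ 2π) (*-monoʳ-< 0<2π y-k<1)))
      (<-respˡ (trans (solve 3 (λ y k p → (k :- y) :* p := :- ((y :- k) :* p)) refl y (ι k) 2π) (-‿cong scaled))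
        (<-respʳ (*-identityˡ 2π) (*-monoʳ-< 0<2π k-y<1)))

  *-recip-cancel : ∀ θ {y} (0<y : 0# < y) → θ ≈ θ * recip 0<y * y
  *-recip-cancel θ 0<y = trans (sym (*-identityʳ θ)) (trans (*-congˡ (sym (recip-inverse 0<y))) (sym (*-assoc _ _ _)))

  expI≋1⇒2πℤ : ∀ θ → expI θ ≋ 1ᶜ → ∃ λ k → θ ≈ 2π * ι k
  expI≋1⇒2πℤ θ eθ≋1 =
    let k , y-k<1 , k-y<1 = near-integer (θ * recip 0<2π)
    in k , near-multiple k eθ≋1 (*-recip-cancel θ 0<2π) y-k<1 k-y<1

-- Fourier inversion on ℤ₂ʳ

module Spectrum {c ℓ₁ ℓ₂ p} (R : RealNumbers c ℓ₁ ℓ₂) {r : ℕ}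
  (S : Pred (Γ r) p) (S? : Decidable S) (0∉S : ¬ S 0Γ) where

  open RealNumbers R hiding (complete; zero)
  open Analysis R
  open OrderedField R
  open ComplexNumbers R
  open Exponential R
  open IntegerScalars commutativeRing
  open Solver using (solve; _:=_; _:+_; _:*_; :-_; _:-_; con)

  private
    module ℂR = CommutativeRing complexRing
    module ℂι = IntegerScalars complexRing

  open ListSums complexRing
  open Algebra.Properties.Semiring.Exp ℂR.semiring using () renaming (_^_ to _^ᶜ_)
  open ℂι.Solver using () renaming (solve to solveᶜ; _:=_ to _:=ᶜ_; _:+_ to _:+ᶜ_; _:*_ to _:*ᶜ_)
  open Relation.Binary.Reasoning.Setoid ℂR.setoid

  G : Graph p
  G = Cay S S? 0∉S

  open Graph G using (_≟_)

  δ : Γ r → Γ r → ℂ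
  δ = 𝐞 G

  δ-≡ : ∀ {u v} → u ≡ v → δ u v ≡ 1ᶜ
  δ-≡ {u} {v} u≡v = ≡.cong (λ b → if b then 1ᶜ else 0ᶜ) (dec-true (u ≟ v) u≡v)

  δ-≢ : ∀ {u v} → u ≢ v → δ u v ≡ 0ᶜ
  δ-≢ {u} {v} u≢v = ≡.cong (λ b → if b then 1ᶜ else 0ᶜ) (dec-false (u ≟ v) u≢v)

  sum-δ-∉ : ∀ {u} xs (f : Γ r → ℂ) → All (u ≢_) xs → sumOver xs (λ v → f v *ᶜ δ u v) ≋ 0ᶜ
  sum-δ-∉ []       f []          = ℂR.refl
  sum-δ-∉ {u} (x ∷ xs) f (u≢x ∷ u∉xs) = ℂR.trans
    (ℂR.+-cong (ℂR.trans (ℂR.*-congˡ (ℂR.reflexive (δ-≢ {u} {x} u≢x))) (ℂR.zeroʳ (f x))) (sum-δ-∉ xs f u∉xs))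
    (ℂR.+-identityˡ 0ᶜ)

  sum-δ-∈ : ∀ {u xs} (f : Γ r → ℂ) → Unique xs → u ∈ xs → sumOver xs (λ v → f v *ᶜ δ u v) ≋ f u
  sum-δ-∈ {u} {_ ∷ xs} f (u∉xs ∷ _) (here ≡.refl) = ℂR.trans
    (ℂR.+-cong (ℂR.trans (ℂR.*-congˡ (ℂR.reflexive (δ-≡ {u} {u} ≡.refl))) (ℂR.*-identityʳ (f u))) (sum-δ-∉ xs f u∉xs))
    (ℂR.+-identityʳ (f u))
  sum-δ-∈ {u} {x ∷ xs} f (x∉xs ∷ unique) (there u∈xs) = ℂR.trans
    (ℂR.+-cong (ℂR.trans (ℂR.*-congˡ (ℂR.reflexive (δ-≢ {u} {x} λ u≡x → All.lookup x∉xs u∈xs (≡.sym u≡x)))) (ℂR.zeroʳ (f x)))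
      (sum-δ-∈ f unique u∈xs))
    (ℂR.+-identityˡ (f u))

  Σᶜ : (Γ r → ℂ) → ℂ
  Σᶜ = sumOver (elements r)

  sum-δ : ∀ (f : Γ r → ℂ) u → Σᶜ (λ v → f v *ᶜ δ u v) ≋ f u
  sum-δ f u = sum-δ-∈ f (elements-unique r) (elements-complete u)

  apply-δ : ∀ H u w → apply G H (δ u) w ≋ H w u
  apply-δ H u w = sum-δ (H w) u

  2⁻ʳ : ℂ
  2⁻ʳ = ofReal (½ ^ r)

  2⁻ʳ*2^r : 2⁻ʳ *ᶜ ιᶜ (+ (2 ℕ.^ r)) ≋ 1ᶜ
  2⁻ʳ*2^r = ℂR.trans (ℂR.*-congˡ {2⁻ʳ} (ι-+ᶜ (2 ℕ.^ r)))
    ( trans (solve 2 (λ h n → h :* n :- con 0ℤ :* con 0ℤ := n :* h) refl (½ ^ r) (fromℕ (2 ℕ.^ r))) (2^*½^ r)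
    , solve 2 (λ h n → h :* con 0ℤ :+ con 0ℤ :* n := con 0ℤ) refl (½ ^ r) (fromℕ (2 ℕ.^ r)) )

  orthogonality : ∀ u v → 2⁻ʳ *ᶜ ιᶜ (gram u v) ≋ δ u v
  orthogonality u v = by-cases (u ≟ v)
    where
    by-cases : Dec (u ≡ v) → 2⁻ʳ *ᶜ ιᶜ (gram u v) ≋ δ u v
    by-cases (yes ≡.refl) = ℂR.trans (ℂR.*-congˡ (ℂR.reflexive (≡.cong ιᶜ (gram-self u))))
      (ℂR.trans 2⁻ʳ*2^r (ℂR.reflexive (≡.sym (δ-≡ {u} {u} ≡.refl))))
    by-cases (no u≢v) = ℂR.trans (ℂR.*-congˡ (ℂR.reflexive (≡.cong ιᶜ (gram-distinct u v u≢v))))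
      (ℂR.trans (ℂR.zeroʳ 2⁻ʳ) (ℂR.reflexive (≡.sym (δ-≢ {u} {v} u≢v))))

  χᶜ : Γ r → Γ r → ℂ
  χᶜ x u = ιᶜ (χ x u)

  χᶜ-⊕ : ∀ x u v → χᶜ x (u ⊕ v) ≋ χᶜ x u *ᶜ χᶜ x v
  χᶜ-⊕ x u v = ℂR.trans (ℂR.reflexive (≡.cong ιᶜ (χ-⊕ x u v))) (ℂι.ι-* (χ x u) (χ x v))

  χᶜ-square : ∀ x u → χᶜ x u *ᶜ χᶜ x u ≋ 1ᶜ
  χᶜ-square x u = ℂR.trans (ℂR.sym (ℂι.ι-* (χ x u) (χ x u))) (ℂR.trans (ℂR.reflexive (≡.cong ιᶜ (χ-square x u))) ℂι.ι-1)

  gramᶜ : ∀ u v → Σᶜ (λ x → χᶜ x u *ᶜ χᶜ x v) ≋ ιᶜ (gram u v)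
  gramᶜ u v = ℂR.sym (ℂR.trans (ℂι-sum (λ x → χ x u ℤ.* χ x v)) (sum-cong (elements r) (λ x → ℂι.ι-* (χ x u) (χ x v))))
    where
    ℂι-sum = ListSums.ι-sum complexRing (elements r)

  -- The matrix with eigenvalue `E x` on the character of x: the sum of the orthogonal projections
  -- onto the characters, weighted by `E`.
  synthesis : (Γ r → ℂ) → Γ r → Γ r → ℂ
  synthesis E u v = 2⁻ʳ *ᶜ Σᶜ (λ x → χᶜ x u *ᶜ χᶜ x v *ᶜ E x)

  synthesis-cong : ∀ {E F : Γ r → ℂ} → (∀ x → E x ≋ F x) → ∀ u v → synthesis E u v ≋ synthesis F u v
  synthesis-cong E≋F u v = ℂR.*-congˡ (sum-cong (elements r) (λ x → ℂR.*-congˡ (E≋F x)))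

  synthesis-*ˡ : ∀ k E u v → synthesis (λ x → k *ᶜ E x) u v ≋ k *ᶜ synthesis E u v
  synthesis-*ˡ k E u v = begin
    2⁻ʳ *ᶜ Σᶜ (λ x → χᶜ x u *ᶜ χᶜ x v *ᶜ (k *ᶜ E x))
      ≈⟨ ℂR.*-congˡ (sum-cong (elements r) (λ x → solveᶜ 3 (λ a k e → a :*ᶜ (k :*ᶜ e) :=ᶜ k :*ᶜ (a :*ᶜ e)) ℂR.refl (χᶜ x u *ᶜ χᶜ x v) k (E x))) ⟩
    2⁻ʳ *ᶜ Σᶜ (λ x → k *ᶜ (χᶜ x u *ᶜ χᶜ x v *ᶜ E x))
      ≈⟨ ℂR.*-congˡ (sum-*ˡ (elements r) k (λ x → χᶜ x u *ᶜ χᶜ x v *ᶜ E x)) ⟩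
    2⁻ʳ *ᶜ (k *ᶜ Σᶜ (λ x → χᶜ x u *ᶜ χᶜ x v *ᶜ E x))
      ≈⟨ solveᶜ 3 (λ a k e → a :*ᶜ (k :*ᶜ e) :=ᶜ k :*ᶜ (a :*ᶜ e)) ℂR.refl 2⁻ʳ k _ ⟩
    k *ᶜ synthesis E u v ∎

  synthesis-+ : ∀ E F u v → synthesis (λ x → E x +ᶜ F x) u v ≋ synthesis E u v +ᶜ synthesis F u v
  synthesis-+ E F u v = begin
    2⁻ʳ *ᶜ Σᶜ (λ x → χᶜ x u *ᶜ χᶜ x v *ᶜ (E x +ᶜ F x))
      ≈⟨ ℂR.*-congˡ (sum-cong (elements r) (λ x → ℂR.distribˡ (χᶜ x u *ᶜ χᶜ x v) (E x) (F x))) ⟩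
    2⁻ʳ *ᶜ Σᶜ (λ x → χᶜ x u *ᶜ χᶜ x v *ᶜ E x +ᶜ χᶜ x u *ᶜ χᶜ x v *ᶜ F x)
      ≈⟨ ℂR.*-congˡ (sum-+ (elements r) (λ x → χᶜ x u *ᶜ χᶜ x v *ᶜ E x) (λ x → χᶜ x u *ᶜ χᶜ x v *ᶜ F x)) ⟩
    2⁻ʳ *ᶜ (Σᶜ (λ x → χᶜ x u *ᶜ χᶜ x v *ᶜ E x) +ᶜ Σᶜ (λ x → χᶜ x u *ᶜ χᶜ x v *ᶜ F x))
      ≈⟨ ℂR.distribˡ 2⁻ʳ _ _ ⟩
    synthesis E u v +ᶜ synthesis F u v ∎

  synthesis-1 : ∀ u v → synthesis (λ _ → 1ᶜ) u v ≋ δ u v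
  synthesis-1 u v = ℂR.trans
    (ℂR.*-congˡ (ℂR.trans (sum-cong (elements r) (λ x → ℂR.*-identityʳ (χᶜ x u *ᶜ χᶜ x v))) (gramᶜ u v)))
    (orthogonality u v)

  -- Translation by `a` acts on the character of x with the eigenvalue `χᶜ x a`.
  synthesis-χ : ∀ a u v → synthesis (λ x → χᶜ x a) u v ≋ δ u (v ⊕ a)
  synthesis-χ a u v = ℂR.trans
    (ℂR.*-congˡ (sum-cong (elements r) (λ x → ℂR.trans
      (ℂR.*-assoc (χᶜ x u) (χᶜ x v) (χᶜ x a))
      (ℂR.trans (ℂR.*-congˡ (ℂR.sym (χᶜ-⊕ x v a))) (ℂR.sym (ℂR.*-identityʳ _))))))
    (synthesis-1 u (v ⊕ a))

  δ-comm : ∀ u v → δ u v ≋ δ v u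
  δ-comm u v = ℂR.trans (ℂR.sym (synthesis-1 u v)) (ℂR.trans
    (ℂR.*-congˡ (sum-cong (elements r) (λ x → ℂR.*-congʳ (ℂR.*-comm (χᶜ x u) (χᶜ x v))))) (synthesis-1 v u))

  -- Each character is also a left eigenvector, so a single column of the matrix determines all of
  -- `E`. After exchanging the sums, orthogonality leaves only y = x.
  analysis : ∀ E x u → Σᶜ (λ w → χᶜ x w *ᶜ synthesis E w u) ≋ χᶜ x u *ᶜ E x
  analysis E x u = begin
    Σᶜ (λ w → χᶜ x w *ᶜ synthesis E w u)
      ≈⟨ sum-cong (elements r) (λ w → ℂR.sym (ℂR.trans
           (sum-*ˡ (elements r) (χᶜ x w *ᶜ 2⁻ʳ) (λ y → χᶜ y w *ᶜ χᶜ y u *ᶜ E y)) (ℂR.*-assoc (χᶜ x w) 2⁻ʳ _))) ⟩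
    Σᶜ (λ w → Σᶜ (λ y → χᶜ x w *ᶜ 2⁻ʳ *ᶜ (χᶜ y w *ᶜ χᶜ y u *ᶜ E y)))
      ≈⟨ sum-swap (elements r) (elements r) (λ w y → χᶜ x w *ᶜ 2⁻ʳ *ᶜ (χᶜ y w *ᶜ χᶜ y u *ᶜ E y)) ⟩
    Σᶜ (λ y → Σᶜ (λ w → χᶜ x w *ᶜ 2⁻ʳ *ᶜ (χᶜ y w *ᶜ χᶜ y u *ᶜ E y)))
      ≈⟨ sum-cong (elements r) inner ⟩
    Σᶜ (λ y → χᶜ y u *ᶜ E y *ᶜ δ x y)
      ≈⟨ sum-δ (λ y → χᶜ y u *ᶜ E y) x ⟩
    χᶜ x u *ᶜ E x ∎
    where
    -- `gram` sums over the first argument of the character, while here the sum runs over the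
    -- second.
    swapped : ∀ x w → χᶜ x w ≋ χᶜ w x
    swapped x w = ℂR.reflexive (≡.cong ιᶜ (χ-comm x w))
    inner : ∀ y → Σᶜ (λ w → χᶜ x w *ᶜ 2⁻ʳ *ᶜ (χᶜ y w *ᶜ χᶜ y u *ᶜ E y)) ≋ χᶜ y u *ᶜ E y *ᶜ δ x y
    inner y = begin
      Σᶜ (λ w → χᶜ x w *ᶜ 2⁻ʳ *ᶜ (χᶜ y w *ᶜ χᶜ y u *ᶜ E y))
        ≈⟨ sum-cong (elements r) (λ w → ℂR.trans
             (solveᶜ 5 (λ a h b d e → a :*ᶜ h :*ᶜ (b :*ᶜ d :*ᶜ e) :=ᶜ d :*ᶜ e :*ᶜ h :*ᶜ (a :*ᶜ b)) ℂR.refl (χᶜ x w) 2⁻ʳ (χᶜ y w) (χᶜ y u) (E y))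
             (ℂR.*-congˡ (ℂR.*-cong (swapped x w) (swapped y w)))) ⟩
      Σᶜ (λ w → χᶜ y u *ᶜ E y *ᶜ 2⁻ʳ *ᶜ (χᶜ w x *ᶜ χᶜ w y))
        ≈⟨ sum-*ˡ (elements r) (χᶜ y u *ᶜ E y *ᶜ 2⁻ʳ) (λ w → χᶜ w x *ᶜ χᶜ w y) ⟩
      χᶜ y u *ᶜ E y *ᶜ 2⁻ʳ *ᶜ Σᶜ (λ w → χᶜ w x *ᶜ χᶜ w y)
        ≈⟨ ℂR.*-congˡ (gramᶜ x y) ⟩
      χᶜ y u *ᶜ E y *ᶜ 2⁻ʳ *ᶜ ιᶜ (gram x y)
        ≈⟨ ℂR.*-assoc (χᶜ y u *ᶜ E y) 2⁻ʳ (ιᶜ (gram x y)) ⟩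
      χᶜ y u *ᶜ E y *ᶜ (2⁻ʳ *ᶜ ιᶜ (gram x y))
        ≈⟨ ℂR.*-congˡ (orthogonality x y) ⟩
      χᶜ y u *ᶜ E y *ᶜ δ x y ∎

  -- The transition matrix of the Cayley graph

  module _ (t : ℝ) where

    phase : Γ r → ℝ
    phase x = t * ι (eigenvalue S? x)

    adjacency≋indicator : ∀ u w → adjacency G u w ≋ ιᶜ (indicator S? (u ⊖ w))
    adjacency≋indicator u w = by-cases (does (S? (u ⊖ w)))
      where
      by-cases : ∀ b → (if b then 1ᶜ else 0ᶜ) ≋ ιᶜ (if b then 1ℤ else 0ℤ)
      by-cases true  = ℂR.sym ℂι.ι-1
      by-cases false = ℂR.refl

    eigenvectorᶜ : ∀ x u → Σᶜ (λ w → scale G (0# +i t) (adjacency G) u w *ᶜ χᶜ x w) ≋ (0# +i phase x) *ᶜ χᶜ x u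
    eigenvectorᶜ x u = begin
      Σᶜ (λ w → (0# +i t) *ᶜ adjacency G u w *ᶜ χᶜ x w)
        ≈⟨ sum-cong (elements r) (λ w → ℂR.trans (ℂR.*-assoc (0# +i t) (adjacency G u w) (χᶜ x w))
             (ℂR.*-congˡ (ℂR.trans (ℂR.*-congʳ (adjacency≋indicator u w)) (ℂR.sym (ℂι.ι-* (indicator S? (u ⊖ w)) (χ x w)))))) ⟩
      Σᶜ (λ w → (0# +i t) *ᶜ ιᶜ (indicator S? (u ⊖ w) ℤ.* χ x w))
        ≈⟨ sum-*ˡ (elements r) (0# +i t) (λ w → ιᶜ (indicator S? (u ⊖ w) ℤ.* χ x w)) ⟩
      (0# +i t) *ᶜ Σᶜ (λ w → ιᶜ (indicator S? (u ⊖ w) ℤ.* χ x w))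
        ≈⟨ ℂR.*-congˡ (ι-sum (elements r) (λ w → indicator S? (u ⊖ w) ℤ.* χ x w)) ⟨
      (0# +i t) *ᶜ ιᶜ (foldr ℤ._+_ 0ℤ (map (λ w → indicator S? (u ⊖ w) ℤ.* χ x w) (elements r)))
        ≈⟨ ℂR.*-congˡ (ℂR.trans (ℂR.reflexive (≡.cong ιᶜ (eigenvector S? x u))) (ℂι.ι-* (eigenvalue S? x) (χ x u))) ⟩
      (0# +i t) *ᶜ (ιᶜ (eigenvalue S? x) *ᶜ χᶜ x u)
        ≈⟨ ℂR.*-assoc (0# +i t) (ιᶜ (eigenvalue S? x)) (χᶜ x u) ⟨
      (0# +i t) *ᶜ ιᶜ (eigenvalue S? x) *ᶜ χᶜ x u
        ≈⟨ ℂR.*-congʳ (ℂR.trans (ℂR.*-congˡ (ιᶜ≋ofReal (eigenvalue S? x)))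
             ( solve 2 (λ t l → con 0ℤ :* l :- t :* con 0ℤ := con 0ℤ) refl t (ι (eigenvalue S? x))
             , solve 2 (λ t l → con 0ℤ :* con 0ℤ :+ t :* l := t :* l) refl t (ι (eigenvalue S? x)) )) ⟩
      (0# +i phase x) *ᶜ χᶜ x u ∎

    -- For k = 0 this is orthogonality of the characters; every further factor multiplies the
    -- component at x by its eigenvalue.
    pow-spectral : ∀ k u v → pow G (scale G (0# +i t) (adjacency G)) k u v ≋ synthesis (λ x → (0# +i phase x) ^ᶜ k) u v
    pow-spectral zero    u v = ℂR.sym (synthesis-1 u v)
    pow-spectral (suc k) u v = begin
      Σᶜ (λ w → A u w *ᶜ pow G A k w v)
        ≈⟨ sum-cong (elements r) (λ w → ℂR.trans (ℂR.*-congˡ (pow-spectral k w v)) (ℂR.sym (ℂR.trans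
             (sum-*ˡ (elements r) (A u w *ᶜ 2⁻ʳ) (λ x → χᶜ x w *ᶜ χᶜ x v *ᶜ z x ^ᶜ k)) (ℂR.*-assoc (A u w) 2⁻ʳ _)))) ⟩
      Σᶜ (λ w → Σᶜ (λ x → A u w *ᶜ 2⁻ʳ *ᶜ (χᶜ x w *ᶜ χᶜ x v *ᶜ z x ^ᶜ k)))
        ≈⟨ sum-swap (elements r) (elements r) (λ w x → A u w *ᶜ 2⁻ʳ *ᶜ (χᶜ x w *ᶜ χᶜ x v *ᶜ z x ^ᶜ k)) ⟩
      Σᶜ (λ x → Σᶜ (λ w → A u w *ᶜ 2⁻ʳ *ᶜ (χᶜ x w *ᶜ χᶜ x v *ᶜ z x ^ᶜ k)))
        ≈⟨ sum-cong (elements r) inner ⟩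
      Σᶜ (λ x → 2⁻ʳ *ᶜ (χᶜ x u *ᶜ χᶜ x v *ᶜ z x ^ᶜ suc k))
        ≈⟨ sum-*ˡ (elements r) 2⁻ʳ (λ x → χᶜ x u *ᶜ χᶜ x v *ᶜ z x ^ᶜ suc k) ⟩
      synthesis (λ x → z x ^ᶜ suc k) u v ∎
      where
      A = scale G (0# +i t) (adjacency G)
      z : Γ r → ℂ
      z x = 0# +i phase x
      inner : ∀ x → Σᶜ (λ w → A u w *ᶜ 2⁻ʳ *ᶜ (χᶜ x w *ᶜ χᶜ x v *ᶜ z x ^ᶜ k)) ≋ 2⁻ʳ *ᶜ (χᶜ x u *ᶜ χᶜ x v *ᶜ z x ^ᶜ suc k)
      inner x = begin
        Σᶜ (λ w → A u w *ᶜ 2⁻ʳ *ᶜ (χᶜ x w *ᶜ χᶜ x v *ᶜ z x ^ᶜ k))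
          ≈⟨ sum-cong (elements r) (λ w → solveᶜ 5 (λ a h b d e → a :*ᶜ h :*ᶜ (b :*ᶜ d :*ᶜ e) :=ᶜ a :*ᶜ b :*ᶜ (h :*ᶜ d :*ᶜ e)) ℂR.refl
               (A u w) 2⁻ʳ (χᶜ x w) (χᶜ x v) (z x ^ᶜ k)) ⟩
        Σᶜ (λ w → A u w *ᶜ χᶜ x w *ᶜ (2⁻ʳ *ᶜ χᶜ x v *ᶜ z x ^ᶜ k))
          ≈⟨ sum-*ʳ (elements r) (2⁻ʳ *ᶜ χᶜ x v *ᶜ z x ^ᶜ k) (λ w → A u w *ᶜ χᶜ x w) ⟩
        Σᶜ (λ w → A u w *ᶜ χᶜ x w) *ᶜ (2⁻ʳ *ᶜ χᶜ x v *ᶜ z x ^ᶜ k)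
          ≈⟨ ℂR.*-congʳ (eigenvectorᶜ x u) ⟩
        z x *ᶜ χᶜ x u *ᶜ (2⁻ʳ *ᶜ χᶜ x v *ᶜ z x ^ᶜ k)
          ≈⟨ solveᶜ 5 (λ z a h b d → z :*ᶜ a :*ᶜ (h :*ᶜ b :*ᶜ d) :=ᶜ h :*ᶜ (a :*ᶜ b :*ᶜ (z :*ᶜ d))) ℂR.refl
               (z x) (χᶜ x u) 2⁻ʳ (χᶜ x v) (z x ^ᶜ k) ⟩
        2⁻ʳ *ᶜ (χᶜ x u *ᶜ χᶜ x v *ᶜ z x ^ᶜ suc k) ∎

    evolution : Γ r → Γ r → ℂ
    evolution = synthesis (λ x → expI (phase x))

    -- The series is summed on each eigenspace separately; only finite sums over the group are
    -- interchanged with it.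
    evolution-isTransition : IsTransition G t evolution
    evolution-isTransition u v = converges⇒HasSumᶜ (converges-cong
      (λ k → ℂR.trans (synthesis-*ˡ (invFactorial k) (λ x → (0# +i phase x) ^ᶜ k) u v)
        (ℂR.*-congˡ {invFactorial k} (ℂR.sym (pow-spectral k u v))))
      ℂR.refl
      (converges-*ˡ 2⁻ʳ (converges-sum (elements r) (λ x → converges-*ˡ (χᶜ x u *ᶜ χᶜ x v) (expI-sum (phase x))))))

    -- `RevivalFromTo` supplies some transition matrix; uniqueness of limits identifies it with the
    -- spectral one.
    transition-unique : ∀ H → IsTransition G t H → ∀ u v → H u v ≋ evolution u v
    transition-unique H isTransition u v = HasSumᶜ-unique (isTransition u v) (evolution-isTransition u v)

    -- Both sides of the revival equation are paired with the character of x. The column at `u`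
    -- gives `χᶜ x u` times the exponential, and the right side gives `χᶜ x u` times α + β `χᶜ x a`.
    -- The common factor squares to 1, so it cancels.
    revival⇒expI : ∀ {u a} → RevivalFromTo G t u (u ⊕ a) → ∃₂ λ α β → ∀ x → expI (phase x) ≋ α +ᶜ β *ᶜ χᶜ x a
    revival⇒expI {u} {a} (_ , H , isTransition , α , β , image , _) = α , β , λ x → begin
      expI (phase x)
        ≈⟨ cancel x (expI (phase x)) ⟨
      χᶜ x u *ᶜ (χᶜ x u *ᶜ expI (phase x))
        ≈⟨ ℂR.*-congˡ (transform x) ⟨
      χᶜ x u *ᶜ (χᶜ x u *ᶜ (α +ᶜ β *ᶜ χᶜ x a))
        ≈⟨ cancel x (α +ᶜ β *ᶜ χᶜ x a) ⟩
      α +ᶜ β *ᶜ χᶜ x a ∎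
      where
      cancel : ∀ x z → χᶜ x u *ᶜ (χᶜ x u *ᶜ z) ≋ z
      cancel x z = ℂR.trans (ℂR.sym (ℂR.*-assoc (χᶜ x u) (χᶜ x u) z)) (ℂR.trans (ℂR.*-congʳ (χᶜ-square x u)) (ℂR.*-identityˡ z))
      image≋ : ∀ w → α *ᶜ δ u w +ᶜ β *ᶜ δ (u ⊕ a) w ≋ evolution w u
      image≋ w = ℂR.trans (ℂR.sym (proj₁ (image w) , proj₂ (image w)))
        (ℂR.trans (apply-δ H u w) (transition-unique H isTransition w u))
      transform : ∀ x → χᶜ x u *ᶜ (α +ᶜ β *ᶜ χᶜ x a) ≋ χᶜ x u *ᶜ expI (phase x)
      transform x = begin
        χᶜ x u *ᶜ (α +ᶜ β *ᶜ χᶜ x a)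
          ≈⟨ solveᶜ 4 (λ u α β a → u :*ᶜ (α :+ᶜ β :*ᶜ a) :=ᶜ α :*ᶜ u :+ᶜ β :*ᶜ (u :*ᶜ a)) ℂR.refl (χᶜ x u) α β (χᶜ x a) ⟩
        α *ᶜ χᶜ x u +ᶜ β *ᶜ (χᶜ x u *ᶜ χᶜ x a)
          ≈⟨ ℂR.+-congˡ (ℂR.*-congˡ (χᶜ-⊕ x u a)) ⟨
        α *ᶜ χᶜ x u +ᶜ β *ᶜ χᶜ x (u ⊕ a)
          ≈⟨ ℂR.+-cong (ℂR.*-congˡ (sum-δ (χᶜ x) u)) (ℂR.*-congˡ (sum-δ (χᶜ x) (u ⊕ a))) ⟨
        α *ᶜ Σᶜ (λ w → χᶜ x w *ᶜ δ u w) +ᶜ β *ᶜ Σᶜ (λ w → χᶜ x w *ᶜ δ (u ⊕ a) w)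
          ≈⟨ ℂR.+-cong (sum-*ˡ (elements r) α (λ w → χᶜ x w *ᶜ δ u w)) (sum-*ˡ (elements r) β (λ w → χᶜ x w *ᶜ δ (u ⊕ a) w)) ⟨
        Σᶜ (λ w → α *ᶜ (χᶜ x w *ᶜ δ u w)) +ᶜ Σᶜ (λ w → β *ᶜ (χᶜ x w *ᶜ δ (u ⊕ a) w))
          ≈⟨ sum-+ (elements r) (λ w → α *ᶜ (χᶜ x w *ᶜ δ u w)) (λ w → β *ᶜ (χᶜ x w *ᶜ δ (u ⊕ a) w)) ⟨
        Σᶜ (λ w → α *ᶜ (χᶜ x w *ᶜ δ u w) +ᶜ β *ᶜ (χᶜ x w *ᶜ δ (u ⊕ a) w))
          ≈⟨ sum-cong (elements r) (λ w → ℂR.trans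
               (solveᶜ 5 (λ α β x d e → α :*ᶜ (x :*ᶜ d) :+ᶜ β :*ᶜ (x :*ᶜ e) :=ᶜ x :*ᶜ (α :*ᶜ d :+ᶜ β :*ᶜ e)) ℂR.refl α β (χᶜ x w) (δ u w) (δ (u ⊕ a) w))
               (ℂR.*-congˡ (image≋ w))) ⟩
        Σᶜ (λ w → χᶜ x w *ᶜ evolution w u)
          ≈⟨ analysis (λ x → expI (phase x)) x u ⟩
        χᶜ x u *ᶜ expI (phase x) ∎

    -- Eigenvalues of the form α + β `χᶜ x a` belong to α times the identity plus β times the
    -- translation by `a`.
    expI⇒revival : ∀ {a} → a ≢ 0Γ → (∃₂ λ α β → (∀ x → expI (phase x) ≋ α +ᶜ β *ᶜ χᶜ x a) × ∣ α ∣² + ∣ β ∣² ≈ 1#) →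
      ∀ u → RevivalFromTo G t u (u ⊕ a)
    expI⇒revival {a} a≢0 (α , β , split , norm) u =
      x≢x⊕a a≢0 u , evolution , evolution-isTransition , α , β , (λ w → re≈ (image w) , im≈ (image w)) , norm
      where
      image : ∀ w → apply G evolution (δ u) w ≋ α *ᶜ δ u w +ᶜ β *ᶜ δ (u ⊕ a) w
      image w = begin
        apply G evolution (δ u) w
          ≈⟨ apply-δ evolution u w ⟩
        evolution w u
          ≈⟨ synthesis-cong split w u ⟩
        synthesis (λ x → α +ᶜ β *ᶜ χᶜ x a) w u
          ≈⟨ synthesis-+ (λ _ → α) (λ x → β *ᶜ χᶜ x a) w u ⟩
        synthesis (λ _ → α) w u +ᶜ synthesis (λ x → β *ᶜ χᶜ x a) w u
          ≈⟨ ℂR.+-cong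
               (ℂR.trans (synthesis-cong (λ _ → ℂR.sym (ℂR.*-identityʳ α)) w u) (ℂR.trans (synthesis-*ˡ α (λ _ → 1ᶜ) w u) (ℂR.*-congˡ (ℂR.trans (synthesis-1 w u) (δ-comm w u)))))
               (ℂR.trans (synthesis-*ˡ β (λ x → χᶜ x a) w u) (ℂR.*-congˡ (ℂR.trans (synthesis-χ a w u) (δ-comm w (u ⊕ a))))) ⟩
        α *ᶜ δ u w +ᶜ β *ᶜ δ (u ⊕ a) w ∎

-- The differences over N and their gcd

gcdOf-∣ : ∀ {z} zs → z ∈ zs → gcdOf zs ℕ.∣ ∣ z ∣
gcdOf-∣ (z ∷ zs) (here ≡.refl) = ℕ.gcd[m,n]∣m ∣ z ∣ (gcdOf zs)
gcdOf-∣ (z ∷ zs) (there z∈zs)  = ℕ.∣-trans (ℕ.gcd[m,n]∣n ∣ z ∣ (gcdOf zs)) (gcdOf-∣ zs z∈zs)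

module _ {r p} {S : Pred (Γ r) p} (S? : Decidable S) (a : Γ r) where

  -- The list inside the definition of `M`, so that `M S? a` is its `gcdOf` by definition.
  differences : List ℤ
  differences = map (uncurry (Δ S?)) (filter (uncurry (N? a)) (cartesianProduct (elements r) (elements r)))

  Δ∈differences : ∀ {x y} → N a x y → Δ S? x y ∈ differences
  Δ∈differences {x} {y} Nxy = ∈-map⁺ (uncurry (Δ S?))
    (∈-filter⁺ (uncurry (N? a)) (∈-cartesianProduct⁺ (elements-complete x) (elements-complete y)) Nxy)

  ∈differences⇒Δ : ∀ {z} → z ∈ differences → ∃₂ λ x y → N a x y × z ≡ Δ S? x y
  ∈differences⇒Δ z∈ =
    let (x , y) , xy∈ , z≡Δ = ∈-map⁻ (uncurry (Δ S?)) z∈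
    in x , y , proj₂ (∈-filter⁻ (uncurry (N? a)) {xs = cartesianProduct (elements r) (elements r)} xy∈) , z≡Δ

-- Integral multiples and Bézout's identity

module IntegralMultiples {c ℓ₁ ℓ₂} (R : RealNumbers c ℓ₁ ℓ₂) where

  open RealNumbers R hiding (complete; zero)
  open Analysis R
  open OrderedField R
  open IntegerScalars commutativeRing
  open Solver using (solve; _:=_; _:*_; _:-_)

  -- A record, so that s and z can be inferred.
  record Integral (s : ℝ) (z : ℤ) : Set ℓ₁ where
    constructor integral
    field
      multiple   : ℤ
      ≈-multiple : s * ι z ≈ ι multiple

  IsInteger⇒Integral : ∀ s z → IsInteger (s * fromℤ z) → Integral s z
  IsInteger⇒Integral s z (k , eq) = integral k
    (trans (*-congˡ (reflexive (≡.sym (fromℤ≡ι z)))) (trans eq (reflexive (fromℤ≡ι k))))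

  Integral⇒IsInteger : ∀ {s z} → Integral s z → IsInteger (s * fromℤ z)
  Integral⇒IsInteger {s} {z} (integral k eq) = k ,
    trans (*-congˡ (reflexive (fromℤ≡ι z))) (trans eq (reflexive (≡.sym (fromℤ≡ι k))))

  integral-- : ∀ {s z w} → Integral s z → Integral s w → Integral s (z ℤ.- w)
  integral-- {s} {z} {w} (integral k p) (integral l q) = integral (k ℤ.- l) (trans (*-congˡ (ι-- z w)) (trans
    (solve 3 (λ s z w → s :* (z :- w) := s :* z :- s :* w) refl s (ι z) (ι w))
    (trans (+-cong p (-‿cong q)) (sym (ι-- k l)))))

  integral-* : ∀ {s z} i → Integral s z → Integral s (i ℤ.* z)
  integral-* {s} {z} i (integral k p) = integral (i ℤ.* k) (trans (*-congˡ (ι-* i z)) (trans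
    (solve 3 (λ s i z → s :* (i :* z) := i :* (s :* z)) refl s (ι i) (ι z))
    (trans (*-congˡ p) (sym (ι-* i k)))))

  integral-∣∣ : ∀ {s} z → Integral s z → Integral s (+ ∣ z ∣)
  integral-∣∣     (+ n)    sz = sz
  integral-∣∣ {s} -[1+ n ] sz = ≡.subst (Integral s) (ℤ.-1*i≡-i -[1+ n ]) (integral-* -1ℤ sz)

  -- Over ℕ, Bézout's identity comes in two mirrored forms without subtraction; this turns either
  -- one into an integer combination.
  bézout⇒≡ : ∀ d x m y n → d ℕ.+ y ℕ.* n ≡ x ℕ.* m → + x ℤ.* + m ℤ.- + y ℤ.* + n ≡ + d
  bézout⇒≡ d x m y n eq = begin
    + x ℤ.* + m ℤ.- + y ℤ.* + n              ≡⟨ ≡.cong₂ ℤ._-_ (ℤ.pos-* x m) (ℤ.pos-* y n) ⟨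
    + (x ℕ.* m) ℤ.- + (y ℕ.* n)              ≡⟨ ≡.cong (λ k → + k ℤ.- + (y ℕ.* n)) eq ⟨
    + d ℤ.+ + (y ℕ.* n) ℤ.- + (y ℕ.* n)      ≡⟨ ℤ.+-assoc (+ d) (+ (y ℕ.* n)) (ℤ.- + (y ℕ.* n)) ⟩
    + d ℤ.+ (+ (y ℕ.* n) ℤ.- + (y ℕ.* n))    ≡⟨ ≡.cong (ℤ._+_ (+ d)) (ℤ.+-inverseʳ (+ (y ℕ.* n))) ⟩
    + d ℤ.+ 0ℤ                               ≡⟨ ℤ.+-identityʳ (+ d) ⟩
    + d                                      ∎
    where open ≡.≡-Reasoning

  integral-gcd : ∀ {s} m n → Integral s (+ m) → Integral s (+ n) → Integral s (+ ℕ.gcd m n)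
  integral-gcd {s} m n sm sn = combine (ℕ.Bézout.identity (ℕ.gcd-GCD m n))
    where
    combine : ℕ.Bézout.Identity (ℕ.gcd m n) m n → Integral s (+ ℕ.gcd m n)
    combine (ℕ.Bézout.+- x y eq) = ≡.subst (Integral s) (bézout⇒≡ _ x m y n eq) (integral-- (integral-* (+ x) sm) (integral-* (+ y) sn))
    combine (ℕ.Bézout.-+ x y eq) = ≡.subst (Integral s) (bézout⇒≡ _ y n x m eq) (integral-- (integral-* (+ y) sn) (integral-* (+ x) sm))

  -- The integers z with s z integral form a subgroup of ℤ, so it contains the gcd of any of its
  -- finite subsets; the empty one gives 0.
  integral-gcdOf : ∀ {s} zs → (∀ {z} → z ∈ zs → Integral s z) → Integral s (+ gcdOf zs)
  integral-gcdOf {s} []       _   = integral 0ℤ (zeroʳ s)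
  integral-gcdOf     (z ∷ zs) szs = integral-gcd ∣ z ∣ (gcdOf zs)
    (integral-∣∣ z (szs (here ≡.refl))) (integral-gcdOf zs (szs ∘ there))

  integer≮1 : ∀ {x} → IsInteger x → 0# < x → ¬ (x < 1#)
  integer≮1 (+ zero    , x≈k) 0<x x<1 = <-irrefl (sym x≈k) 0<x
  integer≮1 (+ suc n   , x≈k) 0<x x<1 = ≤-respˡ ι-1 (fromℕ-mono (s≤s (z≤n {n}))) (<-respˡ x≈k x<1)
  integer≮1 (-[1+ n ]  , x≈k) 0<x x<1 = <-asym (0<fromℕ (suc n))
    (<-respʳ (trans (+-congʳ x≈k) (-‿inverseˡ (fromℕ (suc n)))) (<-respˡ (+-identityˡ _) (+-monoˡ-< (fromℕ (suc n)) 0<x)))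

-- Fractional revival and its minimal time

module Revival {c ℓ₁ ℓ₂ p} (R : RealNumbers c ℓ₁ ℓ₂) (pi : Analysis.Pi R) {r : ℕ}
  (S : Pred (Γ r) p) (S? : Decidable S) (0∉S : ¬ S 0Γ) (v a : Γ r) (a≢0 : a ≢ 0Γ) where

  open RealNumbers R hiding (complete; zero)
  open Analysis R
  open Analysis.Pi pi
  open OrderedField R
  open ComplexNumbers R
  open Exponential R
  open Periodicity R pi
  open IntegralMultiples R
  open Spectrum R S S? 0∉S
  open IntegerScalars commutativeRing
  open Solver using (solve; _:=_; _:+_; _:*_; :-_; _:-_; con)

  private
    module ℂR = CommutativeRing complexRing
    module ℂι = IntegerScalars complexRing

  open ℂι.Solver using () renaming (solve to solveᶜ; _:=_ to _:=ᶜ_; _:+_ to _:+ᶜ_; _:*_ to _:*ᶜ_; :-_ to :-ᶜ_; _:-_ to _:-ᶜ_; con to conᶜ)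

  Revives : ℝ → Set _
  Revives τ = RevivalBetween (Cay S S? 0∉S) τ v (v ⊕ a)

  Condition : ℝ → Set _
  Condition t = ∀ x y → N a x y → IsInteger (t / 2π ⟨ 0<2π ⟩ * fromℤ (Δ S? x y))

  module _ (t : ℝ) where

    phase-difference : ∀ x y → phase t x - phase t y ≈ t * ι (Δ S? x y)
    phase-difference x y = trans
      (solve 3 (λ t a b → t :* a :- t :* b := t :* (a :- b)) refl t (ι (eigenvalue S? x)) (ι (eigenvalue S? y)))
      (*-congˡ (trans (sym (ι-- (eigenvalue S? x) (eigenvalue S? y))) (reflexive (≡.cong ι (≡.sym (Δ≡eigenvalue-eigenvalue S? x y))))))

    expI≋⇒integral : ∀ x y → expI (phase t x) ≋ expI (phase t y) → Integral (t / 2π ⟨ 0<2π ⟩) (Δ S? x y)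
    expI≋⇒integral x y ex≋ey =
      let k , θ≈2πk = expI≋1⇒2πℤ (phase t x - phase t y)
            (ℂR.trans (expI-+ (phase t x) (- phase t y)) (ℂR.trans (ℂR.*-congʳ ex≋ey) (expI-*-neg (phase t y))))
      in integral k (begin
           t * recip 0<2π * ι (Δ S? x y)      ≈⟨ solve 3 (λ t r d → t :* r :* d := r :* (t :* d)) refl t (recip 0<2π) (ι (Δ S? x y)) ⟩
           recip 0<2π * (t * ι (Δ S? x y))    ≈⟨ *-congˡ (trans (sym (phase-difference x y)) θ≈2πk) ⟩
           recip 0<2π * (2π * ι k)            ≈⟨ *-assoc _ _ _ ⟨
           recip 0<2π * 2π * ι k              ≈⟨ *-congʳ (recip-inverse 0<2π) ⟩
           1# * ι k                           ≈⟨ *-identityˡ (ι k) ⟩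
           ι k                                ∎)
      where open Relation.Binary.Reasoning.Setoid setoid

    integral⇒expI≋ : ∀ x y → Integral (t / 2π ⟨ 0<2π ⟩) (Δ S? x y) → expI (phase t x) ≋ expI (phase t y)
    integral⇒expI≋ x y (integral k eq) = ℂR.trans (expI-cong (begin
           phase t x                                          ≈⟨ solve 2 (λ a b → a := b :+ (a :- b)) refl (phase t x) (phase t y) ⟩
           phase t y + (phase t x - phase t y)                ≈⟨ +-congˡ (phase-difference x y) ⟩
           phase t y + t * ι (Δ S? x y)                       ≈⟨ +-congˡ (*-congʳ (*-recip-cancel t 0<2π)) ⟩
           phase t y + t * recip 0<2π * 2π * ι (Δ S? x y)     ≈⟨ +-congˡ (solve 3 (λ s p d → s :* p :* d := p :* (s :* d)) refl (t * recip 0<2π) 2π (ι (Δ S? x y))) ⟩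
           phase t y + 2π * (t * recip 0<2π * ι (Δ S? x y))   ≈⟨ +-congˡ (*-congˡ eq) ⟩
           phase t y + 2π * ι k                               ∎))
         (ℂR.trans (expI-+ (phase t y) (2π * ι k)) (ℂR.trans (ℂR.*-congˡ (expI-2πℤ k)) (ℂR.*-identityʳ (expI (phase t y)))))
      where open Relation.Binary.Reasoning.Setoid setoid

    revives⇒condition : Revives t → Condition t
    revives⇒condition (revival , _) x y Nxy =
      let α , β , split = revival⇒expI t revival
      in Integral⇒IsInteger (expI≋⇒integral x y (ℂR.trans (split x) (ℂR.trans
           (ℂR.+-congˡ (ℂR.*-congˡ (ℂR.reflexive (≡.cong ιᶜ (N⇒χ≡χ a x y Nxy))))) (ℂR.sym (split y)))))

    χ≡χ⇒expI≋ : Condition t → ∀ x y → χ x a ≡ χ y a → expI (phase t x) ≋ expI (phase t y)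
    χ≡χ⇒expI≋ condition x y χ≡χ = by-order (∙>-trichotomous x y)
      where
      by-order : x ∙> y ⊎ x ≡ y ⊎ y ∙> x → expI (phase t x) ≋ expI (phase t y)
      by-order (inj₁ x>y)           = integral⇒expI≋ x y (IsInteger⇒Integral _ (Δ S? x y) (condition x y (χ≡χ⇒N a x y x>y χ≡χ)))
      by-order (inj₂ (inj₁ ≡.refl)) = ℂR.refl
      by-order (inj₂ (inj₂ y>x))    = ℂR.sym (integral⇒expI≋ y x (IsInteger⇒Integral _ (Δ S? y x) (condition y x (χ≡χ⇒N a y x y>x (≡.sym χ≡χ)))))

    -- The exponential takes one value e₀ where the character at `a` is 1 and one value e₁ where it
    -- is -1. Solving α + β = e₀ and α - β = e₁ gives the half-sum and the half-difference.
    condition⇒split : Condition t →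
      ∃₂ λ α β → (∀ x → expI (phase t x) ≋ α +ᶜ β *ᶜ χᶜ x a) × ∣ α ∣² + ∣ β ∣² ≈ 1#
    condition⇒split condition = α , β , (λ x → split x (-1^-cases (x ∙ a))) , norm
      where
      x₁ : Γ r
      x₁ = proj₁ (χ-nontrivial a≢0)
      e₀ e₁ α β : ℂ
      e₀ = expI (phase t 0Γ)
      e₁ = expI (phase t x₁)
      α = ofReal ½ *ᶜ (e₀ +ᶜ e₁)
      β = ofReal ½ *ᶜ (e₀ +ᶜ -ᶜ e₁)
      unhalve : ∀ z → (ofReal ½ +ᶜ ofReal ½) *ᶜ z ≋ z
      unhalve z = ℂR.trans (ℂR.*-congʳ (½+½ , +-identityˡ 0#)) (ℂR.*-identityˡ z)
      split : ∀ x → χ x a ≡ 1ℤ ⊎ χ x a ≡ -1ℤ → expI (phase t x) ≋ α +ᶜ β *ᶜ χᶜ x a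
      split x (inj₁ χ≡1) = ℂR.trans (χ≡χ⇒expI≋ condition x 0Γ (≡.trans χ≡1 (≡.sym (χ-0Γˡ a))))
        (ℂR.sym (ℂR.trans (ℂR.+-congˡ (ℂR.*-congˡ (ℂR.trans (ℂR.reflexive (≡.cong ιᶜ χ≡1)) ℂι.ι-1)))
          (ℂR.trans (solveᶜ 3 (λ h p q → h :*ᶜ (p :+ᶜ q) :+ᶜ h :*ᶜ (p :-ᶜ q) :*ᶜ conᶜ 1ℤ :=ᶜ (h :+ᶜ h) :*ᶜ p) ℂR.refl (ofReal ½) e₀ e₁)
            (unhalve e₀))))
      split x (inj₂ χ≡-1) = ℂR.trans (χ≡χ⇒expI≋ condition x x₁ (≡.trans χ≡-1 (≡.sym (proj₂ (χ-nontrivial a≢0)))))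
        (ℂR.sym (ℂR.trans (ℂR.+-congˡ (ℂR.*-congˡ (ℂR.reflexive (≡.cong ιᶜ χ≡-1))))
          (ℂR.trans (solveᶜ 3 (λ h p q → h :*ᶜ (p :+ᶜ q) :+ᶜ h :*ᶜ (p :-ᶜ q) :*ᶜ conᶜ -1ℤ :=ᶜ (h :+ᶜ h) :*ᶜ q) ℂR.refl (ofReal ½) e₀ e₁)
            (unhalve e₁))))
      norm : ∣ α ∣² + ∣ β ∣² ≈ 1#
      norm = begin
        ∣ α ∣² + ∣ β ∣²
          -- The parallelogram law. The factor 2h² is written (h + h) h so that ½ + ½ = 1 can be
          -- used.
          ≈⟨ solve 5 (λ h p p′ q q′ →
               let reα = h :* (p :+ q) :- con 0ℤ :* (p′ :+ q′)
                   imα = h :* (p′ :+ q′) :+ con 0ℤ :* (p :+ q)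
                   reβ = h :* (p :- q) :- con 0ℤ :* (p′ :- q′)
                   imβ = h :* (p′ :- q′) :+ con 0ℤ :* (p :- q)
               in reα :* reα :+ imα :* imα :+ (reβ :* reβ :+ imβ :* imβ)
                  := (h :+ h) :* (h :* ((p :* p :+ p′ :* p′) :+ (q :* q :+ q′ :* q′))))
               refl ½ (re e₀) (im e₀) (re e₁) (im e₁) ⟩
        (½ + ½) * (½ * (∣ e₀ ∣² + ∣ e₁ ∣²))
          ≈⟨ *-cong ½+½ (*-congˡ (+-cong (∣expI∣²≈1 (phase t 0Γ)) (∣expI∣²≈1 (phase t x₁)))) ⟩
        1# * (½ * (1# + 1#))
          ≈⟨ solve 1 (λ h → con 1ℤ :* (h :* (con 1ℤ :+ con 1ℤ)) := h :+ h) refl ½ ⟩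
        ½ + ½
          ≈⟨ ½+½ ⟩
        1# ∎
        where open Relation.Binary.Reasoning.Setoid setoid

    condition⇒revives : Condition t → Revives t
    -- The reverse direction is again a revival by `a`, because v + a + a = v.
    condition⇒revives condition = revival v , ≡.subst (RevivalFromTo G t (v ⊕ a)) v⊕a⊕a≡v (revival (v ⊕ a))
      where
      revival : ∀ u → RevivalFromTo G t u (u ⊕ a)
      revival = expI⇒revival t a≢0 (condition⇒split condition)
      v⊕a⊕a≡v : v ⊕ a ⊕ a ≡ v
      v⊕a⊕a≡v = ≡.trans (⊕-comm (v ⊕ a) a) (≡.trans (≡.cong (a ⊕_) (⊕-comm v a)) (⊕-cancel a v))

  module _ .⦃ _ : NonZero (M S? a) ⦄ where

    private
      m : ℕ
      m = M S? a

      0<m : 0# < fromℕ m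
      0<m = 0<fromℕ m

    -- At this time each quantity in the condition is a difference divided by m, and m divides all
    -- differences.
    condition-2π/M : Condition (2π /ℕ m)
    condition-2π/M x y Nxy =
      let Signed.divides q Δ≡qm = Signed.∣ᵤ⇒∣ {+ m} {Δ S? x y} (gcdOf-∣ (differences S? a) (Δ∈differences S? a Nxy))
      in Integral⇒IsInteger (integral {z = Δ S? x y} q (begin
           2π * recip 0<m * recip 0<2π * ι (Δ S? x y)         ≈⟨ *-congˡ (trans (reflexive (≡.cong ι Δ≡qm)) (ι-* q (+ m))) ⟩
           2π * recip 0<m * recip 0<2π * (ι q * fromℕ m)      ≈⟨ solve 5 (λ p r s q m → p :* r :* s :* (q :* m) := (s :* p) :* (r :* m) :* q) refl 2π (recip 0<m) (recip 0<2π) (ι q) (fromℕ m) ⟩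
           recip 0<2π * 2π * (recip 0<m * fromℕ m) * ι q      ≈⟨ *-congʳ (*-cong (recip-inverse 0<2π) (recip-inverse 0<m)) ⟩
           1# * 1# * ι q                                      ≈⟨ solve 1 (λ q → con 1ℤ :* con 1ℤ :* q := q) refl (ι q) ⟩
           ι q                                                ∎))
      where open Relation.Binary.Reasoning.Setoid setoid

    -- At an earlier positive revival time t, Bézout's identity would make (t/2π) m an integer
    -- strictly between 0 and 1. If the gcd were 0, all differences would vanish and revival would
    -- occur at every time.
    minimum : IsMinimumPositive Revives (2π /ℕ m)
    minimum = *-pos 0<2π (recip-pos 0<m) , condition⇒revives (2π /ℕ m) condition-2π/M , λ t 0<t revives t<2π/m →
      integer≮1
        (Integral⇒IsInteger (integral-gcdOf (differences S? a) λ z∈ →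
          let x , y , Nxy , z≡Δ = ∈differences⇒Δ S? a z∈
          in ≡.subst (Integral (t / 2π ⟨ 0<2π ⟩)) (≡.sym z≡Δ) (IsInteger⇒Integral _ (Δ S? x y) (revives⇒condition t revives x y Nxy))))
        (*-pos (*-pos 0<t (recip-pos 0<2π)) 0<m)
        (<-respʳ (begin
          2π * recip 0<m * recip 0<2π * fromℕ m       ≈⟨ solve 4 (λ p r s m → p :* r :* s :* m := (s :* p) :* (r :* m)) refl 2π (recip 0<m) (recip 0<2π) (fromℕ m) ⟩
          recip 0<2π * 2π * (recip 0<m * fromℕ m)     ≈⟨ *-cong (recip-inverse 0<2π) (recip-inverse 0<m) ⟩
          1# * 1#                                     ≈⟨ *-identityˡ 1# ⟩
          1#                                          ∎)
          (*-monoʳ-< 0<m (*-monoʳ-< (recip-pos 0<2π) t<2π/m)))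
      where open Relation.Binary.Reasoning.Setoid setoid

open import Data.Nat.Base using (_≤_)

corollary2p4 :
    ∀ {c ℓ₁ ℓ₂ p : Level} (R : RealNumbers c ℓ₁ ℓ₂) →
    let open RealNumbers R using (_*_)
        open Analysis R
    in
    (pi : Pi) →
    let open Pi pi in
    ∀ (r : ℕ) → 1 ≤ r →
    (S : Pred (Γ r) p) (S? : Decidable S) (0∉S : ¬ S 0Γ) →
    (v a : Γ r) → HasOrder 2 a →
    (t : ℝ) →
    let Revives : Pred ℝ _
        Revives τ = RevivalBetween (Cay S S? 0∉S) τ v (v ⊕ a)
        Condition = ∀ x y → N a x y → IsInteger (t / 2π ⟨ 0<2π ⟩ * fromℤ (Δ S? x y))
    in
    (Revives t ⇔ Condition)
    × (Condition → .⦃ _ : NonZero (M S? a) ⦄ → IsMinimumPositive Revives (2π /ℕ M S? a))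
corollary2p4 R pi r _ S S? 0∉S v a order t =
  mk⇔ (revives⇒condition t) (condition⇒revives t) , λ _ → minimum
  where open Revival R pi S S? 0∉S v a (order2⇒≢0Γ order)
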